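{- The elements of $\mathrm{Orb}(\mathsf S_T)$ are exactly the following: (1) the three singletons $\{T\}$, $\{T^\phi\}$, $\{T^{\phi^2}\}$; (2) one $T$-sls consisting of Type II points, one $T^\phi$-sls consisting of Type II points, and one $T^{\phi^2}$-sls consisting of Type II points; (3) $q-2$ $T$-slses consisting of Type III points, $q-2$ $T^\phi$-slses consisting of Type III points, and $q-2$ $T^{\phi^2}$-slses consisting of Type III points; (4) $\mathcal P_{2,q}$, all of whose points and all of whose lines have Type I; (5) $q^3-q-3$ $\mathbb{F}_q$-planes all of whose points have Type II and all of whose lines have Type III; (6) $q^3-q-3$ $\mathbb{F}_q$-planes all of whose points have Type III and all of whose lines have Type II; (7) $q^4-3q^3+q+6$ $\mathbb{F}_q$-planes all of whose points and all of whose lines have Type III.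
   Context: Let $q$ be a prime power, $\mathbb{F}_{q^3}^*=\mathbb{F}_{q^3}\setminus\{0\}$. Points of $\mathrm{PG}(2,q^3)$ have homogeneous coordinates $(x,y,z)$ and lines $[a,b,c]$, with incidence iff $ax+by+cz=0$. An $\mathbb{F}_q$-plane is a subplane of $\mathrm{PG}(2,q^3)$ of order $q$; its lines are the lines of $\mathrm{PG}(2,q^3)$ meeting it in $q+1$ points. Let $\phi$ be the collineation $(x,y,z)\mapsto(z^q,x^q,y^q)$ (on lines $[d,e,f]\mapsto[f^q,d^q,e^q]$); its fixed points form the $\mathbb{F}_q$-plane $\mathcal P_{2,q}=\{(x,x^q,x^{q^2}):x\in\mathbb{F}_{q^3}^*\}$. A point has Type I, II or III according as its $\phi$-orbit is a single point, three collinear points, or three non-collinear points; a line has Type I, II or III according as its $\phi$-orbit is a single line, three concurrent lines, or three non-concurrent lines. Let $T=(0,0,1)$, so $T^\phi=(1,0,0)$, $T^{\phi^2}=(0,1,0)$. For $t\in\mathbb{F}_{q^3}^*$ let $\psi_t\colon(x,y,z)\mapsto(tx,t^qy,t^{q^2}z)$, and $\mathsf S_T=\{\psi_t:t\in\mathbb{F}_{q^3}^*\}$ (the subgroup of $\mathrm{PGL}(3,q^3)$ fixing $\mathcal P_{2,q}$ and the line $T^\phi T^{\phi^2}$ setwise). $\mathrm{Orb}(\mathsf S_T)$ denotes the set of point orbits of $\mathsf S_T$. The orbits of $\mathsf S_T$ contained in the line $T^\phi T^{\phi^2}$ other than $\{T^\phi\},\{T^{\phi^2}\}$ are called $T$-slses;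 those in the line $T^{\phi^2}T$ other than the vertex singletons are $T^\phi$-slses; those in the line $TT^\phi$ other than the vertex singletons are $T^{\phi^2}$-slses. -}

module Defs where

open import Level using (0ℓ)
open import Data.Nat as ℕ using (ℕ; zero; suc; _≥_)
open import Data.Nat.Primality using (Prime)
open import Data.Product using (Σ; ∃; _×_; _,_)
open import Data.Sum using (_⊎_)
open import Data.List using (List; length)
open import Data.List.Membership.Propositional using (_∈_)
open import Data.List.Relation.Unary.All using (All)
open import Data.List.Relation.Unary.Any using (Any)
open import Data.List.Relation.Unary.AllPairs using (AllPairs)
open import Data.List.Relation.Unary.Unique.Propositional using (Unique)
open import Relation.Nullary using (¬_)
open import Relation.Binary.Definitions using (DecidableEquality)
open import Relation.Binary.PropositionalEquality using (_≡_; _≢_)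
open import Algebra.Structures using (IsCommutativeRing)

IsPrimePower : ℕ → Set
IsPrimePower q = Σ ℕ λ p → Σ ℕ λ n → Prime p × n ≥ 1 × q ≡ p ℕ.^ n

record FiniteField : Set₁ where
  infixl 7 _*_
  infixl 6 _+_
  field
    Carrier   : Set
    _+_ _*_   : Carrier → Carrier → Carrier
    -_        : Carrier → Carrier
    0# 1#     : Carrier
    isCommutativeRing : IsCommutativeRing _≡_ _+_ _*_ -_ 0# 1#
    0≢1       : 0# ≢ 1#
    inverse   : ∀ x → x ≢ 0# → ∃ λ y → x * y ≡ 1#
    _≟_       : DecidableEquality Carrier
    elements  : List Carrier
    complete  : ∀ x → x ∈ elements
    distinct  : Unique elements

  order : ℕ
  order = length elements

-- The projective plane PG(2, F) over a finite field F of order q^3,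
-- with the maps φ and ψ_t of the paper.  Here q is the parameter.

module PG (F : FiniteField) (q : ℕ) where
  open FiniteField F

  pow : Carrier → ℕ → Carrier
  pow x zero    = 1#
  pow x (suc n) = x * pow x n

  fr : Carrier → Carrier
  fr x = pow x q

  -- homogeneous coordinate triples (used both for points and lines)
  Triple : Set
  Triple = Carrier × Carrier × Carrier

  NonZeroT : Triple → Set
  NonZeroT (x , y , z) = ¬ (x ≡ 0# × y ≡ 0# × z ≡ 0#)

  scale : Carrier → Triple → Triple
  scale l (x , y , z) = (l * x , l * y , l * z)

  infix 4 _∼_
  _∼_ : Triple → Triple → Set
  P ∼ Q = ∃ λ l → l ≢ 0# × Q ≡ scale l P

  Inc : Triple → Triple → Set
  Inc (x , y , z) (a , b , c) = a * x + b * y + c * z ≡ 0#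

  det : Triple → Triple → Triple → Carrier
  det (a , b , c) (d , e , f) (g , h , i) =
    a * (e * i + - (f * h)) + - (b * (d * i + - (f * g))) + c * (d * h + - (e * g))

  Collinear : Triple → Triple → Triple → Set
  Collinear P Q R = det P Q R ≡ 0#

  Concurrent : Triple → Triple → Triple → Set
  Concurrent L M N = det L M N ≡ 0#

  -- φ : (x,y,z) ↦ (z^q, x^q, y^q); on lines [d,e,f] ↦ [f^q,d^q,e^q]
  φ : Triple → Triple
  φ (x , y , z) = (fr z , fr x , fr y)

  ψ : Carrier → Triple → Triple
  ψ t (x , y , z) = (t * x , fr t * y , fr (fr t) * z)

  T Tφ Tφ² : Triple
  T   = (0# , 0# , 1#)
  Tφ  = (1# , 0# , 0#)
  Tφ² = (0# , 1# , 0#)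

  PointTypeI PointTypeII PointTypeIII : Triple → Set
  PointTypeI   P = φ P ∼ P
  PointTypeII  P = ¬ (φ P ∼ P) × Collinear P (φ P) (φ (φ P))
  PointTypeIII P = ¬ Collinear P (φ P) (φ (φ P))

  LineTypeI LineTypeII LineTypeIII : Triple → Set
  LineTypeI   L = φ L ∼ L
  LineTypeII  L = ¬ (φ L ∼ L) × Concurrent L (φ L) (φ (φ L))
  LineTypeIII L = ¬ Concurrent L (φ L) (φ (φ L))

  -- point sets are predicates on triples (closed under scaling)
  PointSet : Set₁
  PointSet = Triple → Set

  P2q : PointSet
  P2q Q = ∃ λ x → x ≢ 0# × Q ∼ (x , fr x , fr (fr x))

  Orb : Triple → PointSet
  Orb P Q = ∃ λ t → t ≢ 0# × Q ∼ ψ t P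

  Exactly : (Triple → Triple → Set) → ℕ → (Triple → Set) → Set
  Exactly R k S = Σ (List Triple) λ xs →
      length xs ≡ k
    × All S xs
    × AllPairs (λ a b → ¬ R a b) xs
    × (∀ P → S P → Any (λ a → R a P) xs)

  -- lines of PG(2,q^3) meeting S in at least two distinct points
  -- (the candidate lines of S as a subplane)
  LineOf : PointSet → Triple → Set
  LineOf S ℓ = NonZeroT ℓ × ∃ λ P → ∃ λ Q →
      NonZeroT P × NonZeroT Q × S P × S Q × ¬ (P ∼ Q) × Inc P ℓ × Inc Q ℓ

  record IsFqPlane (S : PointSet) : Set where
    field
      lineSize   : ∀ ℓ → LineOf S ℓ →
                   Exactly _∼_ (suc q) (λ P → NonZeroT P × S P × Inc P ℓ)
      linesMeet  : ∀ ℓ m → LineOf S ℓ → LineOf S m →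
                   ∃ λ P → NonZeroT P × S P × Inc P ℓ × Inc P m
      quadrangle : ∃ λ A → ∃ λ B → ∃ λ C → ∃ λ D →
                     NonZeroT A × NonZeroT B × NonZeroT C × NonZeroT D
                   × S A × S B × S C × S D
                   × ¬ Collinear A B C × ¬ Collinear A B D
                   × ¬ Collinear A C D × ¬ Collinear B C D

  AllPoints : PointSet → (Triple → Set) → Set
  AllPoints S Ty = ∀ P → NonZeroT P → S P → Ty P

  AllLines : PointSet → (Triple → Set) → Set
  AllLines S Ty = ∀ ℓ → LineOf S ℓ → Ty ℓ

  data Vertex : Set where
    vT vTφ vTφ² : Vertex

  vertex : Vertex → Triple
  vertex vT   = T
  vertex vTφ  = Tφ
  vertex vTφ² = Tφ²

  -- OnSide v P: P is a point of the side of the triangle opposite the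
  -- vertex v, other than the two vertices on it.  The S_T-orbits of such
  -- points are the v-slses.
  --   opposite T      : line T^φ T^{φ^2}  (z = 0)
  --   opposite T^φ    : line T^{φ^2} T    (x = 0)
  --   opposite T^{φ^2}: line T T^φ        (y = 0)
  OnSide : Vertex → Triple → Set
  OnSide vT   (x , y , z) = z ≡ 0# × x ≢ 0# × y ≢ 0#
  OnSide vTφ  (x , y , z) = x ≡ 0# × y ≢ 0# × z ≢ 0#
  OnSide vTφ² (x , y , z) = y ≡ 0# × z ≢ 0# × x ≢ 0#

  OffTriangle : Triple → Set
  OffTriangle (x , y , z) = x ≢ 0# × y ≢ 0# × z ≢ 0#

  SameOrb : Triple → Triple → Set
  SameOrb P Q = Orb P Q

  Kind5 Kind6 Kind7 : PointSet → Set
  Kind5 S = IsFqPlane S × AllPoints S PointTypeII  × AllLines S LineTypeIII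
  Kind6 S = IsFqPlane S × AllPoints S PointTypeIII × AllLines S LineTypeII
  Kind7 S = IsFqPlane S × AllPoints S PointTypeIII × AllLines S LineTypeIII

  record OrbitClassification : Set where
    field
      vertexOrbit : ∀ v Q → NonZeroT Q → (Orb (vertex v) Q → Q ∼ vertex v)
                                        × (Q ∼ vertex v → Orb (vertex v) Q)
      slsII   : ∀ v → Exactly SameOrb 1
                  (λ P → NonZeroT P × OnSide v P × AllPoints (Orb P) PointTypeII)
      slsIII  : ∀ v → Exactly SameOrb (q ℕ.∸ 2)
                  (λ P → NonZeroT P × OnSide v P × AllPoints (Orb P) PointTypeIII)
      slsCover : ∀ v P → NonZeroT P → OnSide v P →
                   AllPoints (Orb P) PointTypeII ⊎ AllPoints (Orb P) PointTypeIII
      p2qOrbit : ∀ Q → NonZeroT Q → (Orb (1# , 1# , 1#) Q → P2q Q)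
                                  × (P2q Q → Orb (1# , 1# , 1#) Q)
      p2qPlane : IsFqPlane P2q
      p2qPoints : AllPoints P2q PointTypeI
      p2qLines  : AllLines P2q LineTypeI
      count5 : Exactly SameOrb (q ℕ.^ 3 ℕ.∸ q ℕ.∸ 3)
                 (λ P → NonZeroT P × OffTriangle P × Kind5 (Orb P))
      count6 : Exactly SameOrb (q ℕ.^ 3 ℕ.∸ q ℕ.∸ 3)
                 (λ P → NonZeroT P × OffTriangle P × Kind6 (Orb P))
      count7 : Exactly SameOrb (q ℕ.^ 4 ℕ.+ q ℕ.+ 6 ℕ.∸ 3 ℕ.* q ℕ.^ 3)
                 (λ P → NonZeroT P × OffTriangle P × Kind7 (Orb P))
      offCover : ∀ P → NonZeroT P → OffTriangle P →
                   P2q P ⊎ Kind5 (Orb P) ⊎ Kind6 (Orb P) ⊎ Kind7 (Orb P)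

-- Write D(P) = det(P, φP, φ²P); a point has type III iff D(P) ≠ 0.  Off the triangle an orbit
-- Orb P is the image of P2q under diag(x, y, z), so it is a subplane, and its lines form the
-- orbit of the dual point P* = (1/x, 1/y, 1/z).  Hence the kind of Orb P depends only on whether
-- D(P) and D(P*) vanish, and both vanish only for P2q: then x y^q z^(q²) and its conjugates have
-- the same characteristic polynomial as N(x), N(y), N(z).
--
-- The counts rest on N : F* → F_q* being onto with fibres of size q² + q + 1 (a bound on roots of
-- polynomials, squeezed by |F*| = (q − 1)(q² + q + 1)) and on Hilbert 90.  Every orbit of type II
-- points off the triangle meets the line [1,1,1] of P2q exactly once, which leaves
-- q³ + 1 − (q + 1) − 3 points (1, y, −1−y); dualising gives (6), and (7) is what remains of the
-- (q − 1)(q³ − 1) orbits off the triangle.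
module Submission where

-- Elements of F_q* act as scalars, so off the triangle the points of an orbit correspond to the
-- classes of t in F* modulo F_q*, and so do its lines. Incidence between them is the vanishing of
-- the trace of a product, whatever `P` is, so the subplane axioms become statements about
-- trace-zero elements. The subfield F_q occurs only as the set of fixed points of Frobenius: linear
-- algebra over it is replaced by the Moore determinant `moore` and by the fact that a q-polynomial
-- of degree q² has at most q² < q³ roots, which supplies every choice in general position.
--
-- The line [1,1,1] is a transversal because S_T modulo scalars acts regularly on the lines of P2q,
-- and a type II point lies on exactly one of them.
--
-- Sizes of sets of orbits are lengths of lists of representatives. Complements are counted by
-- filtering, and relations between sizes stay additive in ℕ until the very end, so that the
-- truncated subtractions of the statement are exact.

open import Defs
open import Level using (0ℓ)
open import Data.Nat using (ℕ; _^_)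
open import Data.Nat as ℕ using (zero; suc; z≤n; s≤s)
import Data.Nat.Properties as ℕₚ
import Data.Nat.Solver as ℕ-Solver
open import Data.Product using (∃; Σ; _×_; _,_; proj₁; proj₂)
open import Data.Sum using (_⊎_; inj₁; inj₂; [_,_]′)
open import Data.List using (List; []; _∷_; length; map; foldr; _++_; filter; cartesianProduct)
open import Data.List.Properties using (length-map; length-++)
open import Data.List.Membership.Propositional using (_∈_)
open import Data.List.Membership.Propositional.Properties using (∈-map⁺; ∈-map⁻; ∈-cartesianProduct⁺; ∈-cartesianProduct⁻)
import Data.List.Membership.Propositional.Properties.WithK as ∈-WithK
open import Data.List.Relation.Unary.All as All using (All; []; _∷_)
import Data.List.Relation.Unary.All.Properties as Allₚ
open import Data.List.Relation.Unary.Any as Any using (Any; here; there; _─_)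
import Data.List.Relation.Unary.Any.Properties as Anyₚ
open import Data.List.Relation.Unary.AllPairs as AllPairs using (AllPairs; []; _∷_)
import Data.List.Relation.Unary.AllPairs.Properties as AllPairsₚ
open import Data.List.Relation.Unary.Unique.Propositional using (Unique)
import Data.List.Relation.Unary.Unique.Propositional.Properties as Uniqueₚ
open import Data.List.Relation.Binary.Permutation.Propositional using (_↭_)
open import Data.List.Relation.Binary.BagAndSetEquality using (∼bag⇒↭)
open import Relation.Nullary using (¬_; Dec; yes; no; ¬?; contradiction)
open import Relation.Nullary.Decidable using (_×-dec_; map′)
open import Relation.Unary using (Decidable)
open import Relation.Binary.Definitions using (DecidableEquality; Symmetric; Transitive)
open import Relation.Binary.PropositionalEquality using (_≡_; _≢_; refl; sym; trans; cong; cong₂; subst; subst₂; module ≡-Reasoning)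
open import Function using (_∘_; mk⇔)
open import Algebra.Bundles using (RawRing; CommutativeRing; CommutativeMonoid)
open import Algebra.Structures using (IsCommutativeMonoid)

-- Counting up to a relation

-- At the type of triples this is definitionally PG.Exactly.
Count : {A : Set} → (A → A → Set) → ℕ → (A → Set) → Set
Count {A} R k S = Σ (List A) λ xs →
    length xs ≡ k
  × All S xs
  × AllPairs (λ a b → ¬ R a b) xs
  × (∀ x → S x → Any (λ a → R a x) xs)

module _ {A : Set} where

  length-─ : {P : A → Set} {xs : List A} (p : Any P xs) → suc (length (xs ─ p)) ≡ length xs
  length-─ (here _)  = refl
  length-─ {xs = _ ∷ _ ∷ _} (there p) = cong suc (length-─ p)

  any-─ : {P Q : A → Set} {xs : List A} (p : Any P xs) →
          (∀ {x} → P x → ¬ Q x) → Any Q xs → Any Q (xs ─ p)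
  any-─ (here px) d (here qx) = contradiction qx (d px)
  any-─ (here px) d (there q) = q
  any-─ (there p) d (here qx) = here qx
  any-─ (there p) d (there q) = there (any-─ p d q)

  module _ {R : A → A → Set} (R-sym : Symmetric R) (R-trans : Transitive R) where

    -- Pigeonhole: the head of `xs` uses up a representative in `ys`. No later element can need the
    -- same one, since two elements related to one `y` are related to each other.
    length-≤ : ∀ {xs ys} → AllPairs (λ a b → ¬ R a b) xs →
               All (λ x → Any (λ y → R y x) ys) xs → length xs ℕ.≤ length ys
    length-≤ [] _ = z≤n
    length-≤ {ys = ys} (x# ∷ xs#) (p ∷ ps) =
      subst (suc _ ℕ.≤_) (length-─ p) (s≤s (length-≤ xs# (All.zipWith avoid (x# , ps))))
      where
      avoid : ∀ {z} → (¬ R _ z × Any (λ y → R y z) ys) → Any (λ y → R y z) (ys ─ p)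
      avoid (x≁z , q) = any-─ p (λ yx yz → x≁z (R-trans (R-sym yx) yz)) q

    count-unique : ∀ {S k l} → Count R k S → Count R l S → k ≡ l
    count-unique (xs , refl , xs∈ , xs# , xs∋) (ys , refl , ys∈ , ys# , ys∋) =
      ℕₚ.≤-antisym (length-≤ xs# (All.map (ys∋ _) xs∈)) (length-≤ ys# (All.map (xs∋ _) ys∈))

    count-∪ : ∀ {S T k l} → (∀ {x y} → S x → T y → ¬ R x y) →
              Count R k S → Count R l T → Count R (k ℕ.+ l) (λ x → S x ⊎ T x)
    count-∪ {S} {T} disj (xs , refl , xs∈ , xs# , xs∋) (ys , refl , ys∈ , ys# , ys∋) =
        xs ++ ys , length-++ xs , Allₚ.++⁺ (All.map inj₁ xs∈) (All.map inj₂ ys∈)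
      , AllPairsₚ.++⁺ xs# ys# (All.map (λ sx → All.map (disj sx) ys∈) xs∈) , covers
      where
      covers : ∀ x → S x ⊎ T x → Any (λ a → R a x) (xs ++ ys)
      covers x (inj₁ s) = Anyₚ.++⁺ˡ (xs∋ x s)
      covers x (inj₂ t) = Anyₚ.++⁺ʳ xs (ys∋ x t)

  module _ {R : A → A → Set} where

    count-resp : ∀ {S T k} → (∀ {x} → S x → T x) → (∀ {x} → T x → S x) → Count R k S → Count R k T
    count-resp f g (xs , ≡k , xs∈ , xs# , xs∋) = xs , ≡k , All.map f xs∈ , xs# , λ x → xs∋ x ∘ g

    -- `T` passes from an element to its representative, so the filter keeps a representative for
    -- everything in `T`. The size is existential: it is identified later by comparing counts.
    count-filter : ∀ {S T k} → Decidable T → (∀ {x y} → R x y → T y → T x) →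
                   Count R k S → ∃ λ l → Count R l (λ x → S x × T x)
    count-filter {S} {T} T? T-resp (xs , _ , xs∈ , xs# , xs∋) =
        _ , filter T? xs , refl
      , All.zip (Allₚ.filter⁺ T? xs∈ , Allₚ.all-filter T? xs) , AllPairsₚ.filter⁺ T? xs# , covers
      where
      filter-any : ∀ {x ys} → T x → Any (λ a → R a x) ys → Any (λ a → R a x) (filter T? ys)
      filter-any {ys = y ∷ ys} t (here r) with T? y
      ... | yes _ = here r
      ... | no ¬t = contradiction (T-resp r t) ¬t
      filter-any {ys = y ∷ ys} t (there p) with T? y
      ... | yes _ = there (filter-any t p)
      ... | no _  = filter-any t p

      covers : ∀ x → S x × T x → Any (λ a → R a x) (filter T? xs)
      covers x (s , t) = filter-any t (xs∋ x s)

  -- The last hypothesis joins surjectivity and compatibility of `f` with the relations: the list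
  -- need not contain the preimage `x` itself, only some `y` related to it, and `f y` must represent
  -- `z`.
  count-map : ∀ {B : Set} {R : A → A → Set} {R′ : B → B → Set} {S S′ k} (f : A → B) →
              (∀ {x} → S x → S′ (f x)) →
              (∀ {x y} → S x → S y → R′ (f x) (f y) → R x y) →
              (∀ {z} → S′ z → ∃ λ x → S x × (∀ {y} → S y → R y x → R′ (f y) z)) →
              Count R k S → Count R′ k S′
  count-map {B} {R = R} {R′} {S} {S′} f f∈ inj surj (xs , refl , xs∈ , xs# , xs∋) =
      map f xs , length-map f xs , Allₚ.map⁺ (All.map f∈ xs∈) , AllPairsₚ.map⁺ (apart xs∈ xs#) , covers
    where
    apart : ∀ {ys} → All S ys → AllPairs (λ a b → ¬ R a b) ys → AllPairs (λ a b → ¬ R′ (f a) (f b)) ys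
    apart [] [] = []
    apart (s ∷ ss) (y# ∷ ys#) = All.zipWith (λ (¬r , t) r′ → ¬r (inj s t r′)) (y# , ss) ∷ apart ss ys#

    any-map : ∀ {P : A → Set} {Q : B → Set} {ys} → All S ys → (∀ {y} → S y → P y → Q (f y)) →
              Any P ys → Any Q (map f ys)
    any-map (s ∷ _) h (here p) = here (h s p)
    any-map (_ ∷ ss) h (there p) = there (any-map ss h p)

    covers : ∀ z → S′ z → Any (λ b → R′ b z) (map f xs)
    covers z s′ with x , s , h ← surj s′ = any-map xs∈ h (xs∋ x s)

module _ {A : Set} {R : A → A → Set} (R-sym : Symmetric R) (R-trans : Transitive R) where

  -- The size of the complement is whatever the filter leaves. Adding `T` back gives a second count
  -- of `S`, and uniqueness of counts yields the equation without subtraction.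
  count-∖ : ∀ {S T k l} → Decidable T → (∀ {x y} → R x y → T y → T x) → (∀ {x} → T x → S x) →
            Count R k S → Count R l T → ∃ λ m → Count R m (λ x → S x × ¬ T x) × k ≡ l ℕ.+ m
  count-∖ {S} {T} T? T-resp T⊆S #S #T
    with m , #D ← count-filter {S = S} {T = λ x → ¬ T x} (λ x → ¬? (T? x)) (λ r ¬t t → ¬t (T-resp (R-sym r) t)) #S
    = m , #D , count-unique R-sym R-trans #S (count-resp to from (count-∪ R-sym R-trans disj #T #D))
    where
    disj : ∀ {x y} → T x → S y × ¬ T y → ¬ R x y
    disj t (_ , ¬t) r = ¬t (T-resp (R-sym r) t)
    to : ∀ {x} → T x ⊎ (S x × ¬ T x) → S x
    to (inj₁ t) = T⊆S t
    to (inj₂ (s , _)) = s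
    from : ∀ {x} → S x → T x ⊎ (S x × ¬ T x)
    from {x} s with T? x
    ... | yes t = inj₁ t
    ... | no ¬t = inj₂ (s , ¬t)

length-cartesianProduct : {A B : Set} (xs : List A) (ys : List B) →
                          length (cartesianProduct xs ys) ≡ length xs ℕ.* length ys
length-cartesianProduct []       ys = refl
length-cartesianProduct (x ∷ xs) ys = trans (length-++ (map (x ,_) ys))
  (cong₂ ℕ._+_ (length-map (x ,_) ys) (length-cartesianProduct xs ys))

count-× : {A B : Set} {S : A → Set} {T : B → Set} {k l : ℕ} → Count _≡_ k S → Count _≡_ l T →
          Count {A × B} _≡_ (k ℕ.* l) (λ (a , b) → S a × T b)
count-× (xs , refl , xs∈ , xs# , xs∋) (ys , refl , ys∈ , ys# , ys∋) =
    cartesianProduct xs ys , length-cartesianProduct xs ys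
  , All.tabulate (λ p∈ → let a∈ , b∈ = ∈-cartesianProduct⁻ xs ys p∈ in All.lookup xs∈ a∈ , All.lookup ys∈ b∈)
  , Uniqueₚ.cartesianProduct⁺ xs# ys#
  , λ (a , b) (s , t) → Any.map sym (∈-cartesianProduct⁺ (Any.map sym (xs∋ a s)) (Any.map sym (ys∋ b t)))

count-singleton : {A : Set} {R : A → A → Set} {S : A → Set} (a : A) → S a → (∀ {x} → S x → R a x) → Count R 1 S
count-singleton a s covers = a ∷ [] , refl , s ∷ [] , [] ∷ [] , λ x t → here (covers t)

module _ {A B : Set} (_≟_ : DecidableEquality B) (f : A → B) (m : ℕ)
         (fibre-≤ : ∀ c xs → Unique xs → All (λ x → f x ≡ c) xs → length xs ℕ.≤ m) where

  private
    length-split : ∀ c (xs : List A) → length xs ≡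
      length (filter (λ x → f x ≟ c) xs) ℕ.+ length (filter (λ x → ¬? (f x ≟ c)) xs)
    length-split c [] = refl
    length-split c (x ∷ xs) with f x ≟ c
    ... | yes _ = cong suc (length-split c xs)
    ... | no _  = trans (cong suc (length-split c xs)) (sym (ℕₚ.+-suc _ _))

  -- The fibres are removed one value at a time. Read backwards, the inequality bounds the number of
  -- values of `f` from below.
  length-≤-fibres : ∀ xs (cs : List B) → Unique xs → All (λ x → f x ∈ cs) xs → length xs ℕ.≤ length cs ℕ.* m
  length-≤-fibres [] [] _ _ = z≤n
  length-≤-fibres (x ∷ xs) [] _ (() ∷ _)
  length-≤-fibres xs (c ∷ cs) xs# f∈ = begin
    length xs                            ≡⟨ length-split c xs ⟩
    length (filter =c xs) ℕ.+ length (filter ≠c xs)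
      ≤⟨ ℕₚ.+-mono-≤ (fibre-≤ c _ (AllPairsₚ.filter⁺ =c xs#) (Allₚ.all-filter =c xs))
                     (length-≤-fibres _ cs (AllPairsₚ.filter⁺ ≠c xs#) rest∈) ⟩
    m ℕ.+ length cs ℕ.* m                ∎
    where
    open ℕₚ.≤-Reasoning
    =c = λ x → f x ≟ c
    ≠c = λ x → ¬? (f x ≟ c)
    drop-c : ∀ {b} → b ∈ c ∷ cs × b ≢ c → b ∈ cs
    drop-c (here b≡c , b≢c) = contradiction b≡c b≢c
    drop-c (there b∈ , _)   = b∈
    rest∈ : All (λ x → f x ∈ cs) (filter ≠c xs)
    rest∈ = All.zipWith drop-c (Allₚ.filter⁺ ≠c f∈ , Allₚ.all-filter ≠c xs)

-- A ring solver with integer coefficients over an abstract commutative ring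

module IntSolver (R : CommutativeRing 0ℓ 0ℓ) where

  open import Data.Bool using (Bool; T)
  open import Data.Maybe using (nothing)
  open import Data.Vec using (Vec)
  open import Tactic.RingSolver.Core.AlmostCommutativeRing using (AlmostCommutativeRing; fromCommutativeRing)
  open import Tactic.RingSolver.Core.Polynomial.Parameters
  open import Tactic.RingSolver.Core.Expression public using (Expr; Κ; Ι; _⊕_; _⊗_; _⊛_; ⊝_; module Eval)

  private
    ring : AlmostCommutativeRing 0ℓ 0ℓ
    ring = fromCommutativeRing R (λ _ → nothing)

    open AlmostCommutativeRing ring renaming (refl to ≈-refl; sym to ≈-sym; trans to ≈-trans)
    open import Algebra.Properties.Semiring.Mult semiring using (×-homo-+; ×1-homo-*; ×-homo-1) renaming (_×_ to _·_)
    open import Algebra.Properties.Semiring.Exp.TCOptimised semiring using (^-congˡ)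
    open import Tactic.RingSolver.NonReflective ring as N using (_⊜_)
    import Relation.Binary.Reasoning.Setoid setoid as ≈R

    -- The coefficients are integers, with (m , n) standing for m − n; unlike the
    -- elements of an abstract ring they can be tested for being zero.
    Diff : Set
    Diff = ℕ × ℕ

    rawDiff : RawRing 0ℓ 0ℓ
    rawDiff = record
      { Carrier = Diff
      ; _≈_     = _≡_
      ; _+_     = λ (a , b) (c , d) → a ℕ.+ c , b ℕ.+ d
      ; _*_     = λ (a , b) (c , d) → a ℕ.* c ℕ.+ b ℕ.* d , a ℕ.* d ℕ.+ b ℕ.* c
      ; -_      = λ (a , b) → b , a
      ; 0#      = 0 , 0
      ; 1#      = 1 , 0
      }

    isZero : Diff → Bool
    isZero (a , b) = a ℕ.≡ᵇ b

    ⟦_⟧ᵈ : Diff → Carrier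
    ⟦ a , b ⟧ᵈ = a · 1# + - (b · 1#)

    homo-+ : ∀ x y → ⟦ RawRing._+_ rawDiff x y ⟧ᵈ ≈ ⟦ x ⟧ᵈ + ⟦ y ⟧ᵈ
    homo-+ (a , b) (c , d) = ≈-trans
      (+-cong (×-homo-+ 1# a c) (-‿cong (×-homo-+ 1# b d)))
      (N.solve 4 (λ a b c d → ((a ⊕ c) ⊕ (⊝ (b ⊕ d))) ⊜ ((a ⊕ (⊝ b)) ⊕ (c ⊕ (⊝ d)))) ≈-refl _ _ _ _)

    -- The sign rules are derived by hand because `N.solve` takes its coefficients in the abstract
    -- ring and cannot compute with them. Afterwards `- B` and `- D` enter it as atoms.
    homo-* : ∀ x y → ⟦ RawRing._*_ rawDiff x y ⟧ᵈ ≈ ⟦ x ⟧ᵈ * ⟦ y ⟧ᵈ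
    homo-* (a , b) (c , d) = begin
      (a ℕ.* c ℕ.+ b ℕ.* d) · 1# + - ((a ℕ.* d ℕ.+ b ℕ.* c) · 1#)
        ≈⟨ +-cong (sum-of-products a c b d) (-‿cong (sum-of-products a d b c)) ⟩
      (A * C + B * D) + - (A * D + B * C)
        ≈⟨ +-cong (+-congˡ (≈-sym -B*-D≈B*D)) (≈-sym (-‿+-comm _ _)) ⟩
      (A * C + - B * - D) + (- (A * D) + - (B * C))
        ≈⟨ +-congˡ (+-cong (-‿distribʳ-* A D) (-‿distribˡ-* B C)) ⟩
      (A * C + - B * - D) + (A * - D + - B * C)
        ≈⟨ N.solve 4 (λ a b c d → ((a ⊗ c ⊕ b ⊗ d) ⊕ (a ⊗ d ⊕ b ⊗ c)) ⊜ ((a ⊕ b) ⊗ (c ⊕ d))) ≈-refl A (- B) C (- D) ⟩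
      (A + - B) * (C + - D) ∎
      where
      open ≈R
      open import Algebra.Properties.Ring (CommutativeRing.ring R) using (-‿distribˡ-*; -‿distribʳ-*; -‿involutive)
      A = a · 1#
      B = b · 1#
      C = c · 1#
      D = d · 1#
      sum-of-products : ∀ k l m n → (k ℕ.* l ℕ.+ m ℕ.* n) · 1# ≈ (k · 1#) * (l · 1#) + (m · 1#) * (n · 1#)
      sum-of-products k l m n = ≈-trans (×-homo-+ 1# (k ℕ.* l) (m ℕ.* n)) (+-cong (×1-homo-* k l) (×1-homo-* m n))
      -B*-D≈B*D : - B * - D ≈ B * D
      -B*-D≈B*D = ≈-trans (≈-sym (-‿distribˡ-* B (- D))) (≈-trans (-‿cong (≈-sym (-‿distribʳ-* B D))) (-‿involutive (B * D)))

    homo-- : ∀ x → ⟦ RawRing.-_ rawDiff x ⟧ᵈ ≈ - ⟦ x ⟧ᵈ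
    homo-- (a , b) = ≈-trans (+-comm _ _) (≈-trans (+-congˡ (≈-sym (-‿involutive _))) (-‿+-comm _ _))
      where open import Algebra.Properties.Ring (CommutativeRing.ring R) using (-‿involutive)

    homo-0 : ⟦ 0 , 0 ⟧ᵈ ≈ 0#
    homo-0 = CommutativeRing.-‿inverseʳ R 0#

    homo-1 : ⟦ 1 , 0 ⟧ᵈ ≈ 1#
    homo-1 = ≈-trans (+-assoc 1# 0# (- 0#)) (≈-trans (+-congˡ homo-0) (+-identityʳ 1#))

    -- Cancelling first makes equal integers evaluate to the same expression, and
    -- the constants 0 and 1 to 0# and 1# on the nose.
    reduced : Diff → Carrier
    reduced (0 , 0) = 0#
    reduced (1 , 0) = 1#
    reduced x       = ⟦ x ⟧ᵈ

    ⟦_⟧ᶜ : Diff → Carrier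
    ⟦ a , b ⟧ᶜ = reduced (a ℕ.∸ b , b ℕ.∸ a)

    reduced≈ : ∀ x → reduced x ≈ ⟦ x ⟧ᵈ
    reduced≈ (0 , 0) = ≈-sym homo-0
    reduced≈ (1 , 0) = ≈-sym homo-1
    reduced≈ (0 , suc _) = ≈-refl
    reduced≈ (1 , suc _) = ≈-refl
    reduced≈ (suc (suc _) , _) = ≈-refl

    agree : ∀ x → ⟦ x ⟧ᶜ ≈ ⟦ x ⟧ᵈ
    agree (0 , 0) = reduced≈ (0 , 0)
    agree (0 , suc b) = reduced≈ (0 , suc b)
    agree (suc a , 0) = reduced≈ (suc a , 0)
    agree (suc a , suc b) = ≈-trans (agree (a , b)) (begin
      A + - B                       ≈⟨ +-identityˡ _ ⟨
      0# + (A + - B)                ≈⟨ +-congʳ (CommutativeRing.-‿inverseʳ R 1#) ⟨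
      (1# + - 1#) + (A + - B)       ≈⟨ N.solve 4 (λ x y a b → ((x ⊕ y) ⊕ (a ⊕ b)) ⊜ ((x ⊕ a) ⊕ (y ⊕ b))) ≈-refl 1# (- 1#) A (- B) ⟩
      (1# + A) + (- 1# + - B)       ≈⟨ +-congˡ (-‿+-comm 1# B) ⟩
      (1# + A) + - (1# + B)         ∎)
      where
      open ≈R
      A = a · 1#
      B = b · 1#

    zero-homo : ∀ x → T (isZero x) → 0# ≈ ⟦ x ⟧ᶜ
    zero-homo (a , b) t with refl ← ℕₚ.≡ᵇ⇒≡ a b t = ≈-sym (≈-trans (agree (a , a)) (CommutativeRing.-‿inverseʳ R (a · 1#)))

    homo : Homomorphism 0ℓ 0ℓ 0ℓ 0ℓ
    homo = record
      { from = record { rawRing = rawDiff ; isZero = isZero }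
      ; to = ring
      ; morphism = record
        { ⟦_⟧ = ⟦_⟧ᶜ
        ; +-homo = λ x y → ≈-trans (agree (RawRing._+_ rawDiff x y)) (≈-trans (homo-+ x y) (≈-sym (+-cong (agree x) (agree y))))
        ; *-homo = λ x y → ≈-trans (agree (RawRing._*_ rawDiff x y)) (≈-trans (homo-* x y) (≈-sym (*-cong (agree x) (agree y))))
        ; -‿homo = λ x → ≈-trans (agree (RawRing.-_ rawDiff x)) (≈-trans (homo-- x) (≈-sym (-‿cong (agree x))))
        ; 0-homo = ≈-refl
        ; 1-homo = ≈-refl
        }
      ; Zero-C⟶Zero-R = zero-homo
      }

    open Eval (AlmostCommutativeRing.rawRing ring) ⟦_⟧ᶜ
    open import Tactic.RingSolver.Core.Polynomial.Base (Homomorphism.from homo)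
    open import Tactic.RingSolver.Core.Polynomial.Semantics homo renaming (⟦_⟧ to ⟦_⟧ₚ)
    open import Tactic.RingSolver.Core.Polynomial.Homomorphism homo

    norm : ∀ {n} → Expr Diff n → Poly n
    norm (Κ x)   = κ x
    norm (Ι x)   = ι x
    norm (x ⊕ y) = norm x ⊞ norm y
    norm (x ⊗ y) = norm x ⊠ norm y
    norm (⊝ x)   = ⊟ norm x
    norm (x ⊛ i) = norm x ⊡ i

    ⟦_⇓⟧ : ∀ {n} → Expr Diff n → Vec Carrier n → Carrier
    ⟦ e ⇓⟧ = ⟦ norm e ⟧ₚ

    correct : ∀ {n} (e : Expr Diff n) ρ → ⟦ e ⇓⟧ ρ ≈ ⟦ e ⟧ ρ
    correct (Κ x)   ρ = κ-hom x ρ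
    correct (Ι x)   ρ = ι-hom x ρ
    correct (x ⊕ y) ρ = ≈-trans (⊞-hom (norm x) (norm y) ρ) (+-cong (correct x ρ) (correct y ρ))
    correct (x ⊗ y) ρ = ≈-trans (⊠-hom (norm x) (norm y) ρ) (*-cong (correct x ρ) (correct y ρ))
    correct (⊝ x)   ρ = ≈-trans (⊟-hom (norm x) ρ) (-‿cong (correct x ρ))
    correct (x ⊛ i) ρ = ≈-trans (⊡-hom (norm x) i ρ) (^-congˡ i (correct x ρ))

  open import Relation.Binary.Reflection setoid Ι ⟦_⟧ ⟦_⇓⟧ correct public using (solve)

  Term : ℕ → Set
  Term n = Expr Diff n

  infix 4 _:=_
  _:=_ : ∀ {n} → Term n → Term n → Term n × Term n
  _:=_ = _,_

  :0 :1 : ∀ {n} → Term n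
  :0 = Κ (0 , 0)
  :1 = Κ (1 , 0)

-- Finite fields

-- The parameter q only selects the instance PG F q whose pow is used.
module Fields (F : FiniteField) (q : ℕ) where

  open FiniteField F public
  open PG F q using (pow) public

  commutativeRing : CommutativeRing 0ℓ 0ℓ
  commutativeRing = record { isCommutativeRing = isCommutativeRing }

  open CommutativeRing commutativeRing public
    using ( +-comm; +-assoc; +-identityˡ; +-identityʳ; -‿inverseʳ; *-comm; *-assoc; *-identityˡ; *-identityʳ
          ; zeroˡ; zeroʳ; semiring; commutativeSemiring; +-commutativeMonoid; *-commutativeMonoid)
  open IntSolver commutativeRing public

  1≢0 : 1# ≢ 0#
  1≢0 = 0≢1 ∘ sym

  infixl 6 _-_
  _-_ : Carrier → Carrier → Carrier
  x - y = x + - y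

  -≡0⇒≡ : ∀ {x y} → x - y ≡ 0# → x ≡ y
  -≡0⇒≡ {x} {y} e = trans (solve 2 (λ x y → x := (x ⊕ ⊝ y) ⊕ y) refl x y) (trans (cong (_+ y) e) (+-identityˡ y))

  ≡⇒-≡0 : ∀ {x y} → x ≡ y → x - y ≡ 0#
  ≡⇒-≡0 {x} refl = -‿inverseʳ x

  -- Made total by the default value 0 at 0. With it `inv` is multiplicative, involutive and
  -- commutes with Frobenius everywhere, so the laws of `dual` carry no side conditions.
  inv : Carrier → Carrier
  inv x with x ≟ 0#
  ... | yes _  = 0#
  ... | no x≢0 = proj₁ (inverse x x≢0)

  inv-0 : ∀ {x} → x ≡ 0# → inv x ≡ 0#
  inv-0 {x} x≡0 with x ≟ 0#
  ... | yes _  = refl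
  ... | no x≢0 = contradiction x≡0 x≢0

  *-inverseʳ : ∀ {x} → x ≢ 0# → x * inv x ≡ 1#
  *-inverseʳ {x} x≢0 with x ≟ 0#
  ... | yes x≡0 = contradiction x≡0 x≢0
  ... | no x≢0  = proj₂ (inverse x x≢0)

  *-inverseˡ : ∀ {x} → x ≢ 0# → inv x * x ≡ 1#
  *-inverseˡ x≢0 = trans (*-comm _ _) (*-inverseʳ x≢0)

  *-cancelˡ : ∀ {x y z} → x ≢ 0# → x * y ≡ x * z → y ≡ z
  *-cancelˡ {x} {y} {z} x≢0 e = begin
    y                ≡⟨ *-identityˡ y ⟨
    1# * y           ≡⟨ cong (_* y) (*-inverseˡ x≢0) ⟨
    inv x * x * y    ≡⟨ *-assoc _ _ _ ⟩
    inv x * (x * y)  ≡⟨ cong (inv x *_) e ⟩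
    inv x * (x * z)  ≡⟨ *-assoc _ _ _ ⟨
    inv x * x * z    ≡⟨ cong (_* z) (*-inverseˡ x≢0) ⟩
    1# * z           ≡⟨ *-identityˡ z ⟩
    z                ∎
    where open ≡-Reasoning

  *-cancelʳ : ∀ {x y z} → x ≢ 0# → y * x ≡ z * x → y ≡ z
  *-cancelʳ x≢0 e = *-cancelˡ x≢0 (trans (*-comm _ _) (trans e (*-comm _ _)))

  *≡0 : ∀ {x y} → x * y ≡ 0# → x ≡ 0# ⊎ y ≡ 0#
  *≡0 {x} {y} e with x ≟ 0#
  ... | yes x≡0 = inj₁ x≡0
  ... | no x≢0  = inj₂ (*-cancelˡ x≢0 (trans e (sym (zeroʳ x))))

  *≢0 : ∀ {x y} → x ≢ 0# → y ≢ 0# → x * y ≢ 0#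
  *≢0 x≢0 y≢0 e with *≡0 e
  ... | inj₁ x≡0 = x≢0 x≡0
  ... | inj₂ y≡0 = y≢0 y≡0

  *≢0⇒ˡ : ∀ {x y} → x * y ≢ 0# → x ≢ 0#
  *≢0⇒ˡ xy≢0 refl = xy≢0 (zeroˡ _)

  *≢0⇒ʳ : ∀ {x y} → x * y ≢ 0# → y ≢ 0#
  *≢0⇒ʳ xy≢0 refl = xy≢0 (zeroʳ _)

  inv-≢0 : ∀ {x} → x ≢ 0# → inv x ≢ 0#
  inv-≢0 x≢0 = *≢0⇒ʳ (λ e → 1≢0 (trans (sym (*-inverseʳ x≢0)) e))

  inv-unique : ∀ {x y} → x * y ≡ 1# → y ≡ inv x
  inv-unique {x} {y} xy≡1 = *-cancelˡ x≢0 (trans xy≡1 (sym (*-inverseʳ x≢0)))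
    where
    x≢0 : x ≢ 0#
    x≢0 = *≢0⇒ˡ (λ e → 1≢0 (trans (sym xy≡1) e))

  inv-involutive : ∀ x → inv (inv x) ≡ x
  inv-involutive x with x ≟ 0#
  ... | yes refl = inv-0 refl
  ... | no x≢0   = sym (inv-unique (trans (*-comm _ _) (proj₂ (inverse x x≢0))))

  inv-distrib-* : ∀ x y → inv (x * y) ≡ inv x * inv y
  inv-distrib-* x y with x ≟ 0# | y ≟ 0#
  ... | yes refl | _ = trans (inv-0 (zeroˡ y)) (sym (zeroˡ _))
  ... | no _ | yes refl = trans (inv-0 (zeroʳ x)) (sym (zeroʳ _))
  ... | no x≢0 | no y≢0 with x⁻¹ , xx⁻¹ ← inverse x x≢0 | y⁻¹ , yy⁻¹ ← inverse y y≢0 = sym (inv-unique (begin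
    x * y * (x⁻¹ * y⁻¹)    ≡⟨ solve 4 (λ x y x' y' → x ⊗ y ⊗ (x' ⊗ y') := x ⊗ x' ⊗ (y ⊗ y')) refl x y x⁻¹ y⁻¹ ⟩
    x * x⁻¹ * (y * y⁻¹)    ≡⟨ cong₂ _*_ xx⁻¹ yy⁻¹ ⟩
    1# * 1#                ≡⟨ *-identityˡ 1# ⟩
    1#                     ∎))
    where open ≡-Reasoning

  pow-distrib-* : ∀ n x y → pow (x * y) n ≡ pow x n * pow y n
  pow-distrib-* zero x y = sym (*-identityˡ 1#)
  pow-distrib-* (suc n) x y = trans (cong (x * y *_) (pow-distrib-* n x y))
    (solve 4 (λ x y a b → x ⊗ y ⊗ (a ⊗ b) := x ⊗ a ⊗ (y ⊗ b)) refl x y _ _)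

  pow-+ : ∀ x m n → pow x (m ℕ.+ n) ≡ pow x m * pow x n
  pow-+ x zero n = sym (*-identityˡ _)
  pow-+ x (suc m) n = trans (cong (x *_) (pow-+ x m n)) (sym (*-assoc _ _ _))

  pow-1 : ∀ n → pow 1# n ≡ 1#
  pow-1 zero = refl
  pow-1 (suc n) = trans (*-identityˡ _) (pow-1 n)

  pow-* : ∀ x m n → pow x (m ℕ.* n) ≡ pow (pow x m) n
  pow-* x zero n = sym (pow-1 n)
  pow-* x (suc m) n = begin
    pow x (n ℕ.+ m ℕ.* n)      ≡⟨ pow-+ x n (m ℕ.* n) ⟩
    pow x n * pow x (m ℕ.* n)  ≡⟨ cong (pow x n *_) (pow-* x m n) ⟩
    pow x n * pow (pow x m) n  ≡⟨ pow-distrib-* n x (pow x m) ⟨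
    pow (x * pow x m) n        ∎
    where open ≡-Reasoning

  pow-≢0 : ∀ {x} n → x ≢ 0# → pow x n ≢ 0#
  pow-≢0 zero _ = 1≢0
  pow-≢0 (suc n) x≢0 = *≢0 x≢0 (pow-≢0 n x≢0)

  count-elements : Count {Carrier} _≡_ order (λ _ → 0# ≡ 0#)
  count-elements = elements , refl , All.universal (λ _ → refl) elements , distinct , λ x _ → Any.map sym (complete x)

  -- f is a polynomial function of degree at most n whose coefficient of degree n is a,
  -- expressed through its divided differences.
  Poly : ℕ → Carrier → (Carrier → Carrier) → Set
  Poly zero    a f = ∀ x → f x ≡ a
  Poly (suc n) a f = ∀ r → ∃ λ g → Poly n a g × ∀ x → f x ≡ f r + (x - r) * g x

  poly-ext : ∀ n {a f h} → (∀ x → f x ≡ h x) → Poly n a f → Poly n a h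
  poly-ext zero    f≗h p x = trans (sym (f≗h x)) (p x)
  poly-ext (suc n) f≗h p r with g , pg , e ← p r =
    g , pg , λ x → trans (sym (f≗h x)) (trans (e x) (cong (_+ _) (f≗h r)))

  poly-coeff : ∀ n {a b f} → a ≡ b → Poly n a f → Poly n b f
  poly-coeff n refl p = p

  poly-raise : ∀ n {a f} → Poly n a f → Poly (suc n) 0# f
  poly-raise zero {a} {f} p r = (λ _ → 0#) , (λ _ → refl) , λ x →
    trans (p x) (trans (sym (p r)) (solve 2 (λ y z → y := y ⊕ z ⊗ :0) refl (f r) (x - r)))
  poly-raise (suc n) p r with g , pg , e ← p r = g , poly-raise n pg , e

  poly-raise-< : ∀ {m n a f} → m ℕ.< n → Poly m a f → Poly n 0# f
  poly-raise-< {m} m<n p = go (ℕₚ.≤⇒≤′ m<n)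
    where
    go : ∀ {n} → suc m ℕ.≤′ n → Poly n 0# _
    go ℕ.≤′-refl = poly-raise m p
    go (ℕ.≤′-step {n} le) = poly-raise n (go le)

  poly-+ : ∀ n {a b f g} → Poly n a f → Poly n b g → Poly n (a + b) (λ x → f x + g x)
  poly-+ zero p r x = cong₂ _+_ (p x) (r x)
  poly-+ (suc n) {f = f} {g} p r z with f′ , pf , ef ← p z | g′ , pg , eg ← r z =
    (λ x → f′ x + g′ x) , poly-+ n pf pg , λ x → trans (cong₂ _+_ (ef x) (eg x))
      (solve 5 (λ a b d u v → (a ⊕ d ⊗ u) ⊕ (b ⊕ d ⊗ v) := (a ⊕ b) ⊕ d ⊗ (u ⊕ v)) refl (f z) (g z) (x - z) (f′ x) (g′ x))

  poly-scale : ∀ n c {a f} → Poly n a f → Poly n (c * a) (λ x → c * f x)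
  poly-scale zero c p x = cong (c *_) (p x)
  poly-scale (suc n) c {f = f} p z with f′ , pf , ef ← p z =
    (λ x → c * f′ x) , poly-scale n c pf , λ x → trans (cong (c *_) (ef x))
      (solve 4 (λ c a d u → c ⊗ (a ⊕ d ⊗ u) := c ⊗ a ⊕ d ⊗ (c ⊗ u)) refl c (f z) (x - z) (f′ x))

  poly-const : ∀ c → Poly 0 c (λ _ → c)
  poly-const c _ = refl

  poly-*x : ∀ n {a f} → Poly n a f → Poly (suc n) a (λ x → x * f x)
  poly-*x zero {a} {f} p r = f , p , λ x → begin
    x * f x                   ≡⟨ solve 3 (λ x r y → x ⊗ y := r ⊗ y ⊕ (x ⊕ ⊝ r) ⊗ y) refl x r (f x) ⟩
    r * f x + (x - r) * f x   ≡⟨ cong (λ y → r * y + (x - r) * f x) (trans (p x) (sym (p r))) ⟩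
    r * f r + (x - r) * f x   ∎
    where open ≡-Reasoning
  poly-*x (suc n) {a} {f} p r with g , pg , e ← p r =
      (λ x → f x + r * g x)
    , poly-coeff (suc n) (+-identityʳ a)
        (poly-+ (suc n) p (poly-raise n (poly-scale n r pg)))
    , λ x → begin
        x * f x
          ≡⟨ solve 3 (λ x r y → x ⊗ y := r ⊗ y ⊕ (x ⊕ ⊝ r) ⊗ y) refl x r (f x) ⟩
        r * f x + (x - r) * f x
          ≡⟨ cong (λ y → r * y + (x - r) * f x) (e x) ⟩
        r * (f r + (x - r) * g x) + (x - r) * f x
          ≡⟨ solve 5 (λ r d z u y → r ⊗ (z ⊕ d ⊗ u) ⊕ d ⊗ y := r ⊗ z ⊕ d ⊗ (y ⊕ r ⊗ u)) refl r (x - r) (f r) (g x) (f x) ⟩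
        r * f r + (x - r) * (f x + r * g x) ∎
    where open ≡-Reasoning

  poly-pow : ∀ n → Poly n 1# (λ x → pow x n)
  poly-pow zero _ = refl
  poly-pow (suc n) = poly-*x n (poly-pow n)

  -- At a root r the divided difference gives f x = (x - r) g x, so the other roots of f are roots
  -- of g. The quotient g has the same leading coefficient, which is why `a ≢ 0#` survives the
  -- induction.
  roots-≤ : ∀ n {a f} → a ≢ 0# → Poly n a f → ∀ xs → Unique xs → All (λ x → f x ≡ 0#) xs → length xs ℕ.≤ n
  roots-≤ _ _ _ [] _ _ = z≤n
  roots-≤ zero a≢0 p (x ∷ _) _ (fx≡0 ∷ _) = contradiction (trans (sym (p x)) fx≡0) a≢0
  roots-≤ (suc n) {f = f} a≢0 p (r ∷ xs) (r# ∷ xs#) (fr≡0 ∷ f≡0) with g , pg , e ← p r =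
    s≤s (roots-≤ n a≢0 pg xs xs# (All.zipWith quotient-root (r# , f≡0)))
    where
    quotient-root : ∀ {x} → r ≢ x × f x ≡ 0# → g x ≡ 0#
    quotient-root {x} (r≢x , fx≡0) with *≡0 {x - r} {g x}
      (trans (sym (+-identityˡ _)) (trans (cong (_+ _) (sym fr≡0)) (trans (sym (e x)) fx≡0)))
    ... | inj₁ x-r≡0 = contradiction (sym (-≡0⇒≡ x-r≡0)) r≢x
    ... | inj₂ gx≡0  = gx≡0

  non-root : ∀ n {a f} → a ≢ 0# → Poly n a f → n ℕ.< order → ∃ λ x → f x ≢ 0#
  non-root n {f = f} a≢0 p n<order with Any.any? (λ x → ¬? (f x ≟ 0#)) elements
  ... | yes ∃x = Any.satisfied ∃x
  ... | no ∄x  = contradiction (roots-≤ n a≢0 p elements distinct (All.tabulate vanish)) (ℕₚ.<⇒≱ n<order)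
    where
    vanish : ∀ {x} → x ∈ elements → f x ≡ 0#
    vanish {x} x∈ with f x ≟ 0#
    ... | yes fx≡0 = fx≡0
    ... | no fx≢0 = contradiction (Any.map (λ { refl → fx≢0 }) x∈) ∄x

  -- Sums and products over all elements: `order` times 1 is zero, and x to the power `order` is x

  module Translation {_∙_ : Carrier → Carrier → Carrier} {ε : Carrier}
                     (isCM : IsCommutativeMonoid _≡_ _∙_ ε) where

    private
      M : CommutativeMonoid 0ℓ 0ℓ
      M = record { isCommutativeMonoid = isCM }
    open CommutativeMonoid M using (identityˡ; rawMonoid)
    open import Algebra.Definitions.RawMonoid rawMonoid public using () renaming (_×_ to _·_)
    open import Algebra.Properties.CommutativeSemigroup (CommutativeMonoid.commutativeSemigroup M) using (interchange; x∙yz≈y∙xz)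

    fold : List Carrier → Carrier
    fold = foldr _∙_ ε

    fold-↭ : ∀ {xs ys} → xs ↭ ys → fold xs ≡ fold ys
    fold-↭ _↭_.refl = refl
    fold-↭ (_↭_.prep x p) = cong (x ∙_) (fold-↭ p)
    fold-↭ (_↭_.swap x y p) = trans (x∙yz≈y∙xz x y _) (cong (λ z → y ∙ (x ∙ z)) (fold-↭ p))
    fold-↭ (_↭_.trans p r) = trans (fold-↭ p) (fold-↭ r)

    fold-map : ∀ a xs → fold (map (a ∙_) xs) ≡ ((length xs · a) ∙ fold xs)
    fold-map a [] = sym (identityˡ ε)
    fold-map a (x ∷ xs) = trans (cong ((a ∙ x) ∙_) (fold-map a xs)) (interchange a x (length xs · a) (fold xs))

    -- Translation by `a` permutes `xs`, so the fold is unchanged, while each of the factors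
    -- contributes one extra `a`. Additively on all elements this annihilates `order` times 1;
    -- multiplicatively on the nonzero elements it is Fermat's theorem.
    fold-translate : ∀ a {xs} → Unique xs → (∀ {x y} → (a ∙ x) ≡ (a ∙ y) → x ≡ y) →
                     (∀ {x} → x ∈ xs → (a ∙ x) ∈ xs) → (∀ {x} → x ∈ xs → x ∈ map (a ∙_) xs) →
                     fold xs ≡ ((length xs · a) ∙ fold xs)
    fold-translate a {xs} xs# cancel closed onto =
      trans (sym (fold-↭ (∼bag⇒↭ (∈-WithK.unique∧set⇒bag (Uniqueₚ.map⁺ cancel xs#) xs# (mk⇔ to onto))))) (fold-map a xs)
      where
      to : ∀ {x} → x ∈ map (a ∙_) xs → x ∈ xs
      to x∈ with y , y∈ , refl ← ∈-map⁻ (a ∙_) x∈ = closed y∈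

  private
    module + = Translation (CommutativeMonoid.isCommutativeMonoid +-commutativeMonoid)
    module * = Translation (CommutativeMonoid.isCommutativeMonoid *-commutativeMonoid)

  order·1≡0 : order +.· 1# ≡ 0#
  order·1≡0 = trans (solve 2 (λ a b → a := (a ⊕ b) ⊕ ⊝ b) refl _ (+.fold elements))
    (≡⇒-≡0 (sym (+.fold-translate 1# distinct
      (λ {x} {y} e → trans (cancel x) (trans (cong (_- 1#) e) (sym (cancel y))))
      (λ {x} _ → complete (1# + x))
      (λ {x} _ → subst (_∈ map (1# +_) elements) (back x) (∈-map⁺ (1# +_) (complete (x - 1#)))))))
    where
    cancel : ∀ x → x ≡ (1# + x) - 1#
    cancel x = solve 1 (λ x → x := (:1 ⊕ x) ⊕ ⊝ :1) refl x
    back : ∀ x → 1# + (x - 1#) ≡ x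
    back x = solve 1 (λ x → :1 ⊕ (x ⊕ ⊝ :1) := x) refl x

  count-≢0 : ∃ λ n → Count {Carrier} _≡_ n (_≢ 0#) × order ≡ suc n
  count-≢0 with n , #D , e ← count-∖ sym trans {S = λ _ → 0# ≡ 0#} {T = _≡ 0#} (_≟ 0#) (λ { refl t → t }) (λ _ → refl)
                               count-elements (count-singleton 0# refl sym)
    = n , count-resp proj₂ (refl ,_) #D , e

  pow-order : ∀ x → pow x order ≡ x
  pow-order x with n , (xs , refl , xs≢0 , xs# , xs∋) , order≡ ← count-≢0 | x ≟ 0#
  ... | yes refl = trans (cong (pow 0#) order≡) (zeroˡ _)
  ... | no x≢0 = begin
    pow x order              ≡⟨ cong (pow x) order≡ ⟩
    x * pow x (length xs)    ≡⟨ cong (x *_) (trans (pow≡· x (length xs)) period) ⟩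
    x * 1#                   ≡⟨ *-identityʳ x ⟩
    x                        ∎
    where
    open ≡-Reasoning
    pow≡· : ∀ x n → pow x n ≡ n *.· x
    pow≡· x zero = refl
    pow≡· x (suc n) = cong (x *_) (pow≡· x n)
    ∋xs : ∀ {y} → y ≢ 0# → y ∈ xs
    ∋xs y≢0 = Any.map sym (xs∋ _ y≢0)
    fold-≢0 : ∀ {ys} → All (_≢ 0#) ys → *.fold ys ≢ 0#
    fold-≢0 [] = 1≢0
    fold-≢0 (y≢0 ∷ ys≢0) = *≢0 y≢0 (fold-≢0 ys≢0)
    onto : ∀ {y} → y ∈ xs → y ∈ map (x *_) xs
    onto {y} y∈ = subst (_∈ map (x *_) xs)
      (trans (sym (*-assoc _ _ _)) (trans (cong (_* y) (*-inverseʳ x≢0)) (*-identityˡ y)))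
      (∈-map⁺ (x *_) (∋xs (*≢0 (inv-≢0 x≢0) (All.lookup xs≢0 y∈))))
    period : length xs *.· x ≡ 1#
    period = *-cancelʳ (fold-≢0 xs≢0) (trans
      (sym (*.fold-translate x xs# (*-cancelˡ x≢0) (λ y∈ → ∋xs (*≢0 x≢0 (All.lookup xs≢0 y∈))) onto))
      (sym (*-identityˡ _)))

-- Binomial coefficients and additivity of prime power Frobenius maps

module Frobenius (F : FiniteField) (q : ℕ) where

  open import Data.Nat.Combinatorics using (_C_; nCn≡1; nCk+nC[k+1]≡[n+1]C[k+1])
  open import Data.Nat.Divisibility using (_∣_; divides; m∣m*n; ∣⇒≤)
  open import Data.Nat.Primality using (Prime; euclidsLemma; ¬prime[0]; prime⇒nonZero; prime⇒nonTrivial)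
  open import Data.Fin as Fin using (Fin; toℕ; inject₁; fromℕ)
  import Data.Fin.Properties as Finₚ
  open Fields F q
  open import Algebra.Properties.Semiring.Mult semiring using (×-assoc-*; ×1-homo-*; ×-homo-1) renaming (_×_ to _·_)
  open import Algebra.Properties.CommutativeSemiring.Binomial commutativeSemiring using (binomialTerm; theorem)
  open import Algebra.Properties.Semiring.Exp semiring using () renaming (_^_ to _^ᶠ_)
  open import Algebra.Properties.Monoid.Sum (CommutativeMonoid.monoid +-commutativeMonoid)
    using (sum; sum-init-last; sum-cong-≗; sum-replicate-zero)

  absorption : ∀ n k → suc k ℕ.* (suc n C suc k) ≡ suc n ℕ.* (n C k)
  absorption zero    zero    = refl
  absorption zero    (suc k) = ℕₚ.*-zeroʳ k
  absorption (suc n) k = begin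
    suc k ℕ.* (suc (suc n) C suc k)
      ≡⟨ cong (suc k ℕ.*_) (nCk+nC[k+1]≡[n+1]C[k+1] (suc n) k) ⟨
    suc k ℕ.* (suc n C k ℕ.+ suc n C suc k)
      ≡⟨ ℕₚ.*-distribˡ-+ (suc k) (suc n C k) (suc n C suc k) ⟩
    suc k ℕ.* (suc n C k) ℕ.+ suc k ℕ.* (suc n C suc k)
      ≡⟨ cong (suc k ℕ.* (suc n C k) ℕ.+_) (absorption n k) ⟩
    (suc n C k ℕ.+ k ℕ.* (suc n C k)) ℕ.+ suc n ℕ.* (n C k)
      ≡⟨ ℕₚ.+-assoc (suc n C k) _ _ ⟩
    suc n C k ℕ.+ (k ℕ.* (suc n C k) ℕ.+ suc n ℕ.* (n C k))
      ≡⟨ cong (suc n C k ℕ.+_) (lower k) ⟩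
    suc n C k ℕ.+ suc n ℕ.* (suc n C k)
      ∎
    where
    open ≡-Reasoning
    lower : ∀ k → k ℕ.* (suc n C k) ℕ.+ suc n ℕ.* (n C k) ≡ suc n ℕ.* (suc n C k)
    lower zero = refl
    lower (suc k) = begin
      suc k ℕ.* (suc n C suc k) ℕ.+ suc n ℕ.* (n C suc k)
        ≡⟨ cong (ℕ._+ suc n ℕ.* (n C suc k)) (absorption n k) ⟩
      suc n ℕ.* (n C k) ℕ.+ suc n ℕ.* (n C suc k)
        ≡⟨ ℕₚ.*-distribˡ-+ (suc n) (n C k) (n C suc k) ⟨
      suc n ℕ.* (n C k ℕ.+ n C suc k)
        ≡⟨ cong (suc n ℕ.*_) (nCk+nC[k+1]≡[n+1]C[k+1] n k) ⟩
      suc n ℕ.* (suc n C suc k) ∎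

  -- By `absorption` the prime divides (j + 1) times the binomial coefficient. It is larger than j +
  -- 1, so Euclid's lemma leaves only the second factor.
  prime∣C : ∀ {n} → Prime (suc n) → (j : Fin n) → suc n ∣ (suc n C suc (toℕ j))
  prime∣C {n} p j with euclidsLemma (suc (toℕ j)) (suc n C suc (toℕ j)) p
                         (subst (suc n ∣_) (sym (absorption n (toℕ j))) (m∣m*n (n C toℕ j)))
  ... | inj₁ p∣j = contradiction (∣⇒≤ p∣j) (ℕₚ.<⇒≱ (s≤s (Finₚ.toℕ<n j)))
  ... | inj₂ p∣C = p∣C

  pow≡^ : ∀ x n → pow x n ≡ x ^ᶠ n
  pow≡^ x zero = refl
  pow≡^ x (suc n) = cong (x *_) (pow≡^ x n)

  p∣⇒·≡0 : ∀ {p m} → p · 1# ≡ 0# → p ∣ m → ∀ x → m · x ≡ 0#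
  p∣⇒·≡0 {p} p·1≡0 (divides k refl) x = begin
    (k ℕ.* p) · x           ≡⟨ cong ((k ℕ.* p) ·_) (*-identityˡ x) ⟨
    (k ℕ.* p) · (1# * x)    ≡⟨ ×-assoc-* (k ℕ.* p) 1# x ⟨
    ((k ℕ.* p) · 1#) * x    ≡⟨ cong (_* x) (×1-homo-* k p) ⟩
    (k · 1#) * (p · 1#) * x ≡⟨ cong (λ z → (k · 1#) * z * x) p·1≡0 ⟩
    (k · 1#) * 0# * x       ≡⟨ solve 2 (λ y x → y ⊗ :0 ⊗ x := :0) refl (k · 1#) x ⟩
    0#                      ∎
    where open ≡-Reasoning

  pow-prime-+ : ∀ {p} → Prime p → p · 1# ≡ 0# → ∀ x y → pow (x + y) p ≡ pow x p + pow y p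
  pow-prime-+ {zero}  p-prime _ x y = contradiction p-prime ¬prime[0]
  pow-prime-+ {suc n} p-prime p·1≡0 x y = begin
    pow (x + y) (suc n)
      ≡⟨ pow≡^ (x + y) (suc n) ⟩
    (x + y) ^ᶠ suc n
      ≡⟨ theorem (suc n) x y ⟩
    t Fin.zero + sum (t ∘ Fin.suc)
      ≡⟨ cong (t Fin.zero +_) (sum-init-last (t ∘ Fin.suc)) ⟩
    t Fin.zero + (sum (t ∘ Fin.suc ∘ inject₁) + t (Fin.suc (fromℕ n)))
      ≡⟨ cong (λ z → t Fin.zero + (z + t (Fin.suc (fromℕ n)))) (trans (sum-cong-≗ middle≡0) (sum-replicate-zero n)) ⟩
    t Fin.zero + (0# + t (Fin.suc (fromℕ n)))
      ≡⟨ cong₂ (λ a b → a + (0# + b)) first≡ last≡ ⟩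
    pow y (suc n) + (0# + pow x (suc n))
      ≡⟨ solve 2 (λ x y → y ⊕ (:0 ⊕ x) := x ⊕ y) refl _ _ ⟩
    pow x (suc n) + pow y (suc n) ∎
    where
    open ≡-Reasoning
    t : Fin (suc (suc n)) → Carrier
    t = binomialTerm x y (suc n)
    middle≡0 : ∀ j → t (Fin.suc (inject₁ j)) ≡ 0#
    middle≡0 j = p∣⇒·≡0 p·1≡0 (subst (λ i → suc n ∣ (suc n C suc i)) (sym (Finₚ.toℕ-inject₁ j)) (prime∣C p-prime j)) _
    first≡ : t Fin.zero ≡ pow y (suc n)
    first≡ = trans (×-homo-1 _) (trans (*-identityˡ _) (sym (pow≡^ y (suc n))))
    last≡ : t (Fin.suc (fromℕ n)) ≡ pow x (suc n)
    last≡ = begin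
      (suc n C suc (toℕ (fromℕ n))) · (x ^ᶠ suc (toℕ (fromℕ n)) * y ^ᶠ (suc n ℕ.∸ suc (toℕ (fromℕ n))))
        ≡⟨ cong (λ i → (suc n C suc i) · (x ^ᶠ suc i * y ^ᶠ (suc n ℕ.∸ suc i))) (Finₚ.toℕ-fromℕ n) ⟩
      (suc n C suc n) · (x ^ᶠ suc n * y ^ᶠ (n ℕ.∸ n))
        ≡⟨ cong₂ (λ c d → c · (x ^ᶠ suc n * y ^ᶠ d)) (nCn≡1 (suc n)) (ℕₚ.n∸n≡0 n) ⟩
      1 · (x ^ᶠ suc n * 1#)
        ≡⟨ trans (×-homo-1 _) (*-identityʳ _) ⟩
      x ^ᶠ suc n
        ≡⟨ pow≡^ x (suc n) ⟨
      pow x (suc n) ∎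

  pow-primePower-+ : ∀ {p} → Prime p → p · 1# ≡ 0# → ∀ n x y → pow (x + y) (p ℕ.^ n) ≡ pow x (p ℕ.^ n) + pow y (p ℕ.^ n)
  pow-primePower-+ _ _ zero x y = solve 2 (λ x y → (x ⊕ y) ⊗ :1 := x ⊗ :1 ⊕ y ⊗ :1) refl x y
  pow-primePower-+ {p} p-prime p·1≡0 (suc n) x y = begin
    pow (x + y) (p ℕ.* p ℕ.^ n)
      ≡⟨ pow-* (x + y) p (p ℕ.^ n) ⟩
    pow (pow (x + y) p) (p ℕ.^ n)
      ≡⟨ cong (λ z → pow z (p ℕ.^ n)) (pow-prime-+ p-prime p·1≡0 x y) ⟩
    pow (pow x p + pow y p) (p ℕ.^ n)
      ≡⟨ pow-primePower-+ p-prime p·1≡0 n (pow x p) (pow y p) ⟩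
    pow (pow x p) (p ℕ.^ n) + pow (pow y p) (p ℕ.^ n)
      ≡⟨ cong₂ _+_ (pow-* x p (p ℕ.^ n)) (pow-* y p (p ℕ.^ n)) ⟨
    pow x (p ℕ.* p ℕ.^ n) + pow y (p ℕ.* p ℕ.^ n) ∎
    where open ≡-Reasoning

  -- The element `order` times 1 is zero and equals the k-th power of p times 1; a field has no
  -- nonzero nilpotent elements.
  characteristic : ∀ p k → order ≡ p ℕ.^ k → p · 1# ≡ 0#
  characteristic p k order≡ with (p · 1#) ≟ 0#
  ... | yes p·1≡0 = p·1≡0
  ... | no p·1≢0 = contradiction (trans (sym (·1-^ k)) (trans (cong (_· 1#) (sym order≡)) order·1≡0)) (pow-≢0 k p·1≢0)
    where
    ·1-^ : ∀ k → (p ℕ.^ k) · 1# ≡ pow (p · 1#) k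
    ·1-^ zero = +-identityʳ 1#
    ·1-^ (suc k) = trans (×1-homo-* p (p ℕ.^ k)) (cong ((p · 1#) *_) (·1-^ k))

  primePower-≥2 : ∀ {n} → IsPrimePower n → 2 ℕ.≤ n
  primePower-≥2 (p , suc n , p-prime , _ , refl) =
    ℕₚ.≤-trans (ℕ.nonTrivial⇒n>1 p {{prime⇒nonTrivial p-prime}})
               (ℕₚ.m≤m*n p (p ℕ.^ n) {{ℕₚ.m^n≢0 p n {{prime⇒nonZero p-prime}}}})

  primePower-fr-+ : ∀ {n} → IsPrimePower n → order ≡ n ℕ.^ 3 → ∀ x y → pow (x + y) n ≡ pow x n + pow y n
  primePower-fr-+ (p , n , p-prime , _ , refl) order≡ =
    pow-primePower-+ p-prime (characteristic p (n ℕ.* 3) (trans order≡ (ℕₚ.^-*-assoc p n 3))) n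

module Orbits (F : FiniteField) (q : ℕ) (q-primePower : IsPrimePower q) (order≡q³ : FiniteField.order F ≡ q ℕ.^ 3) where

  open Fields F q
  open Frobenius F q
  open PG F q hiding (pow)

  -- Frobenius, norm and Hilbert 90

  fr-+ : ∀ x y → fr (x + y) ≡ fr x + fr y
  fr-+ = primePower-fr-+ q-primePower order≡q³

  fr-* : ∀ x y → fr (x * y) ≡ fr x * fr y
  fr-* = pow-distrib-* q

  fr-1 : fr 1# ≡ 1#
  fr-1 = pow-1 q

  fr³ : ∀ x → fr (fr (fr x)) ≡ x
  fr³ x = trans (sym (begin
    pow x (q ℕ.* (q ℕ.* (q ℕ.* 1)))   ≡⟨ pow-* x q _ ⟩
    pow (fr x) (q ℕ.* (q ℕ.* 1))      ≡⟨ pow-* (fr x) q _ ⟩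
    pow (fr (fr x)) (q ℕ.* 1)         ≡⟨ cong (pow (fr (fr x))) (ℕₚ.*-identityʳ q) ⟩
    fr (fr (fr x))                    ∎)) (trans (cong (pow x) (sym order≡q³)) (pow-order x))
    where open ≡-Reasoning

  fr-0 : fr 0# ≡ 0#
  fr-0 = begin
    fr 0#                     ≡⟨ solve 1 (λ x → x := (x ⊕ x) ⊕ ⊝ x) refl (fr 0#) ⟩
    fr 0# + fr 0# - fr 0#     ≡⟨ cong (_- fr 0#) (fr-+ 0# 0#) ⟨
    fr (0# + 0#) - fr 0#      ≡⟨ ≡⇒-≡0 (cong fr (+-identityˡ 0#)) ⟩
    0#                        ∎
    where open ≡-Reasoning

  fr-neg : ∀ x → fr (- x) ≡ - fr x
  fr-neg x = begin
    fr (- x)                   ≡⟨ solve 2 (λ x y → x := (y ⊕ x) ⊕ ⊝ y) refl (fr (- x)) (fr x) ⟩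
    fr x + fr (- x) - fr x     ≡⟨ cong (_- fr x) (trans (sym (fr-+ x (- x))) (trans (cong fr (-‿inverseʳ x)) fr-0)) ⟩
    0# - fr x                  ≡⟨ +-identityˡ _ ⟩
    - fr x                     ∎
    where open ≡-Reasoning

  fr-- : ∀ x y → fr (x - y) ≡ fr x - fr y
  fr-- x y = trans (fr-+ x (- y)) (cong (fr x +_) (fr-neg y))

  fr-≢0 : ∀ {x} → x ≢ 0# → fr x ≢ 0#
  fr-≢0 = pow-≢0 q

  fr-inv : ∀ x → fr (inv x) ≡ inv (fr x)
  fr-inv x = by-cases (x ≟ 0#)
    where
    by-cases : Dec (x ≡ 0#) → fr (inv x) ≡ inv (fr x)
    by-cases (yes refl) = trans (cong fr (inv-0 refl)) (trans fr-0 (sym (inv-0 fr-0)))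
    by-cases (no x≢0) = inv-unique (trans (sym (fr-* x (inv x))) (trans (cong fr (*-inverseʳ x≢0)) fr-1))

  norm trace : Carrier → Carrier
  norm x = x * fr x * fr (fr x)
  trace x = x + fr x + fr (fr x)

  norm-* : ∀ x y → norm (x * y) ≡ norm x * norm y
  norm-* x y rewrite fr-* x y | fr-* (fr x) (fr y) =
    solve 6 (λ a a' a'' b b' b'' → (a ⊗ b) ⊗ (a' ⊗ b') ⊗ (a'' ⊗ b'') := (a ⊗ a' ⊗ a'') ⊗ (b ⊗ b' ⊗ b''))
      refl x (fr x) (fr (fr x)) y (fr y) (fr (fr y))

  norm-fr : ∀ x → norm (fr x) ≡ norm x
  norm-fr x rewrite fr³ x = solve 3 (λ a b c → b ⊗ c ⊗ a := a ⊗ b ⊗ c) refl x (fr x) (fr (fr x))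

  fr-norm : ∀ x → fr (norm x) ≡ norm x
  fr-norm x rewrite fr-* (x * fr x) (fr (fr x)) | fr-* x (fr x) = norm-fr x

  norm-≢0 : ∀ {x} → x ≢ 0# → norm x ≢ 0#
  norm-≢0 x≢0 = *≢0 (*≢0 x≢0 (fr-≢0 x≢0)) (fr-≢0 (fr-≢0 x≢0))

  norm-1 : norm 1# ≡ 1#
  norm-1 rewrite fr-1 | fr-1 = solve 0 (:1 ⊗ :1 ⊗ :1 := :1) refl

  norm-inv : ∀ {x} → x ≢ 0# → norm x * norm (inv x) ≡ 1#
  norm-inv x≢0 = trans (sym (norm-* _ _)) (trans (cong norm (*-inverseʳ x≢0)) norm-1)

  2≤q : 2 ℕ.≤ q
  2≤q = primePower-≥2 q-primePower

  q-1 : ℕ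
  q-1 = ℕ.pred q

  q≡ : q ≡ suc q-1
  q≡ = sym (ℕₚ.suc-pred q {{ℕ.>-nonZero (ℕₚ.≤-trans (s≤s z≤n) 2≤q)}})

  order≡ : order ≡ suc (q-1 ℕ.* suc (q ℕ.+ q ℕ.* q))
  order≡ = trans order≡q³ (subst (λ n → n ℕ.^ 3 ≡ suc (q-1 ℕ.* suc (n ℕ.+ n ℕ.* n))) (sym q≡)
    (ℕ-Solver.+-*-Solver.solve 1 (λ r → let n = con 1 :+ r in n :* (n :* (n :* con 1)) :≡ con 1 :+ r :* (con 1 :+ (n :+ n :* n))) refl q-1))
    where open ℕ-Solver.+-*-Solver using (_:+_; _:*_; con) renaming (_:=_ to _:≡_)

  q²<order : q ℕ.* q ℕ.< order
  q²<order = subst (q ℕ.* q ℕ.<_) (sym (trans order≡q³ (cong (λ n → q ℕ.* (q ℕ.* n)) (ℕₚ.*-identityʳ q)))) (begin-strict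
    q ℕ.* q              ≡⟨ ℕₚ.*-identityˡ _ ⟨
    1 ℕ.* (q ℕ.* q)      <⟨ ℕₚ.*-monoˡ-< (q ℕ.* q) {{ℕₚ.m*n≢0 q q {{q≢0}} {{q≢0}}}} 2≤q ⟩
    q ℕ.* (q ℕ.* q)      ∎)
    where
    open ℕₚ.≤-Reasoning
    q≢0 : ℕ.NonZero q
    q≢0 = ℕ.>-nonZero (ℕₚ.≤-trans (s≤s z≤n) 2≤q)

  q<q² : q ℕ.< q ℕ.* q
  q<q² = begin-strict
    q          ≡⟨ ℕₚ.*-identityˡ q ⟨
    1 ℕ.* q    <⟨ ℕₚ.*-monoˡ-< q {{ℕ.>-nonZero (ℕₚ.≤-trans (s≤s z≤n) 2≤q)}} 2≤q ⟩
    q ℕ.* q    ∎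
    where open ℕₚ.≤-Reasoning

  poly-id : Poly 1 1# (λ x → x)
  poly-id = poly-ext 1 *-identityʳ (poly-pow 1)

  poly-fr : Poly q 1# fr
  poly-fr = poly-pow q

  poly-fr² : Poly (q ℕ.* q) 1# (λ x → fr (fr x))
  poly-fr² = poly-ext (q ℕ.* q) (λ x → pow-* x q q) (poly-pow (q ℕ.* q))

  poly-linearised : ∀ a b c → Poly (q ℕ.* q) a (λ x → a * fr (fr x) + b * fr x + c * x)
  poly-linearised a b c = poly-coeff (q ℕ.* q)
    (solve 1 (λ a → a ⊗ :1 ⊕ :0 ⊕ :0 := a) refl a)
    (poly-+ (q ℕ.* q) (poly-+ (q ℕ.* q)
      (poly-scale (q ℕ.* q) a poly-fr²)
      (poly-raise-< q<q² (poly-scale q b poly-fr)))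
      (poly-raise-< (ℕₚ.<-trans 2≤q q<q²) (poly-scale 1 c poly-id)))

  -- Degree q² is too small to vanish on all q³ elements. Three choices rest on this: a nonzero
  -- resolvent for Hilbert 90, a second independent element of trace zero, and the third element of
  -- a basis over F_q.
  linearised-non-root : ∀ {a} b c → a ≢ 0# → ∃ λ x → a * fr (fr x) + b * fr x + c * x ≢ 0#
  linearised-non-root b c a≢0 = non-root (q ℕ.* q) a≢0 (poly-linearised _ b c) q²<order

  poly-fr-x : Poly q 1# (λ x → fr x - x)
  poly-fr-x = poly-ext q (λ x → solve 2 (λ a x → a ⊕ (⊝ :1) ⊗ x := a ⊕ ⊝ x) refl (fr x) x)
    (poly-coeff q (+-identityʳ 1#)
      (poly-+ q poly-fr (poly-raise-< 2≤q (poly-scale 1 (- 1#) poly-id))))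

  norm-fibre-≤ : ∀ c xs → Unique xs → All (λ x → norm x ≡ c) xs → length xs ℕ.≤ suc (q ℕ.+ q ℕ.* q)
  norm-fibre-≤ c xs xs# norm≡c = roots-≤ (suc (q ℕ.+ q ℕ.* q)) 1≢0 poly xs xs# (All.map ≡⇒-≡0 norm≡c)
    where
    expand : ∀ x → pow x (suc (q ℕ.+ q ℕ.* q)) + - c ≡ norm x - c
    expand x = cong (_- c) (trans (cong (x *_) (trans (pow-+ x q (q ℕ.* q)) (cong (fr x *_) (pow-* x q q)))) (sym (*-assoc _ _ _)))
    poly : Poly (suc (q ℕ.+ q ℕ.* q)) 1# (λ x → norm x - c)
    poly = poly-ext (suc (q ℕ.+ q ℕ.* q)) expand (poly-coeff (suc (q ℕ.+ q ℕ.* q)) (+-identityʳ 1#)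
      (poly-+ (suc (q ℕ.+ q ℕ.* q)) (poly-pow (suc (q ℕ.+ q ℕ.* q))) (poly-raise-< (s≤s z≤n) (poly-const (- c)))))

  Fixed Fixed* : Carrier → Set
  Fixed x = fr x ≡ x
  Fixed* x = Fixed x × x ≢ 0#

  private
    -- The (q - 1)(q² + q + 1) nonzero elements fall into fibres of `norm` of size at most q² + q +
    -- 1, so any set that contains all the values has at least q - 1 elements.
    q-1-≤-values : ∀ {k S} → Count {Carrier} _≡_ k S → (∀ {x} → x ≢ 0# → S (norm x)) → q-1 ℕ.≤ k
    q-1-≤-values (cs , refl , _ , _ , cs∋) norm∈ = bound count-≢0
      where
      bound : (∃ λ n → Count {Carrier} _≡_ n (_≢ 0#) × order ≡ suc n) → q-1 ℕ.≤ length cs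
      bound (_ , (xs , refl , xs≢0 , xs# , _) , e) =
        ℕₚ.*-cancelʳ-≤ q-1 (length cs) (suc (q ℕ.+ q ℕ.* q))
          (subst (ℕ._≤ length cs ℕ.* suc (q ℕ.+ q ℕ.* q)) (ℕₚ.suc-injective (trans (sym e) order≡))
            (length-≤-fibres _≟_ norm (suc (q ℕ.+ q ℕ.* q)) norm-fibre-≤ xs cs xs#
              (All.map (λ x≢0 → Any.map sym (cs∋ _ (norm∈ x≢0))) xs≢0)))

    -- Fixed elements are roots of x^q - x, so there are at most q of them. The nonzero ones contain
    -- all norms, so there are at least q - 1 of those. The two bounds meet.
    fixed-counts : Count {Carrier} _≡_ q-1 Fixed* × Count {Carrier} _≡_ q Fixed
    fixed-counts = split (count-filter {R = _≡_} {T = Fixed} (λ x → fr x ≟ x) (λ { refl t → t }) count-elements)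
      where
      q-1≡ : ∀ {l} → Count {Carrier} _≡_ (suc l) Fixed → Count {Carrier} _≡_ l Fixed* → l ≡ q-1
      q-1≡ (xs , e , xs∈ , xs# , _) #Fixed* =
        ℕₚ.≤-antisym (ℕₚ.≤-pred (subst₂ ℕ._≤_ e q≡ (roots-≤ q 1≢0 poly-fr-x xs xs# (All.map ≡⇒-≡0 xs∈))))
                     (q-1-≤-values #Fixed* (λ x≢0 → fr-norm _ , norm-≢0 x≢0))
      conclude : ∀ {k l} → Count {Carrier} _≡_ k Fixed → Count {Carrier} _≡_ l Fixed* → k ≡ 1 ℕ.+ l →
                 Count {Carrier} _≡_ q-1 Fixed* × Count {Carrier} _≡_ q Fixed
      conclude #Fixed #Fixed* refl with refl ← q-1≡ #Fixed #Fixed* =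
        #Fixed* , subst (λ k → Count _≡_ k Fixed) (sym q≡) #Fixed
      split : (∃ λ k → Count {Carrier} _≡_ k (λ x → 0# ≡ 0# × Fixed x)) →
              Count {Carrier} _≡_ q-1 Fixed* × Count {Carrier} _≡_ q Fixed
      split (k , #S) = conclude #Fixed (proj₁ (proj₂ removed)) (proj₂ (proj₂ removed))
        where
        #Fixed : Count {Carrier} _≡_ k Fixed
        #Fixed = count-resp {T = Fixed} proj₂ (refl ,_) #S
        removed = count-∖ sym trans {S = Fixed} {T = _≡ 0#} (_≟ 0#) (λ { refl t → t }) (λ { refl → fr-0 })
                          #Fixed (count-singleton 0# refl sym)

  count-Fixed* : Count {Carrier} _≡_ q-1 Fixed*
  count-Fixed* = proj₁ fixed-counts

  count-Fixed : Count {Carrier} _≡_ q Fixed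
  count-Fixed = proj₂ fixed-counts

  -- If `c` were missed, the remaining q - 2 nonzero fixed elements would contain every norm,
  -- against the lower bound q - 1.
  norm-surjective : ∀ {c} → Fixed* c → ∃ λ x → norm x ≡ c
  norm-surjective {c} c∈ = by-cases (Any.any? (λ x → norm x ≟ c) elements)
    where
    by-cases : Dec (Any (λ x → norm x ≡ c) elements) → ∃ λ x → norm x ≡ c
    by-cases (yes ∃x) = Any.satisfied ∃x
    by-cases (no ∄x) = impossible (count-∖ sym trans {S = Fixed*} {T = _≡ c} (_≟ c) (λ { refl t → t }) (λ { refl → c∈ })
                                     count-Fixed* (count-singleton c refl sym))
      where
      missed : ∀ {x} → x ≢ 0# → Fixed* (norm x) × norm x ≢ c
      missed {x} x≢0 = (fr-norm x , norm-≢0 x≢0) , λ e → ∄x (Any.map (λ { refl → e }) (complete x))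
      impossible : (∃ λ m → Count {Carrier} _≡_ m (λ x → Fixed* x × x ≢ c) × q-1 ≡ 1 ℕ.+ m) → ∃ λ x → norm x ≡ c
      impossible (m , #D , e) = contradiction (q-1-≤-values #D missed) (ℕₚ.<⇒≱ (ℕₚ.≤-reflexive (sym e)))

  -- With z = 1/y, the resolvent s = c + z c^q + z z^q c^(q²) satisfies s^q = y s, because norm 1
  -- means z^q z^(q²) = y. A suitable c makes s nonzero.
  hilbert90 : ∀ {y} → norm y ≡ 1# → ∃ λ s → s ≢ 0# × fr s ≡ y * s
  hilbert90 {y} norm≡1 = s , s≢0 , (begin
    fr s
      ≡⟨ trans (fr-+ _ _) (cong (_+ fr c) (fr-+ _ _)) ⟩
    fr (z * fr z * fr (fr c)) + fr (z * fr c) + fr c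
      ≡⟨ cong₂ (λ a b → a + b + fr c) (trans (fr-* _ _) (cong₂ _*_ (fr-* _ _) (fr³ c))) (fr-* _ _) ⟩
    fr z * fr (fr z) * c + fr z * fr (fr c) + fr c
      ≡⟨ cong (λ w → w * c + fr z * fr (fr c) + fr c) z′z″≡y ⟩
    y * c + fr z * fr (fr c) + fr c
      ≡⟨ solve 4 (λ a b d e → a ⊕ b ⊗ d ⊕ e := :1 ⊗ b ⊗ d ⊕ :1 ⊗ e ⊕ a) refl (y * c) (fr z) (fr (fr c)) (fr c) ⟩
    1# * fr z * fr (fr c) + 1# * fr c + y * c
      ≡⟨ cong (λ w → w * fr z * fr (fr c) + w * fr c + y * c) (*-inverseʳ y≢0) ⟨
    y * z * fr z * fr (fr c) + y * z * fr c + y * c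
      ≡⟨ solve 6 (λ y z z' c'' c' c → y ⊗ z ⊗ z' ⊗ c'' ⊕ y ⊗ z ⊗ c' ⊕ y ⊗ c := y ⊗ (z ⊗ z' ⊗ c'' ⊕ z ⊗ c' ⊕ :1 ⊗ c)) refl y z (fr z) (fr (fr c)) (fr c) c ⟩
    y * (z * fr z * fr (fr c) + z * fr c + 1# * c)
      ≡⟨ cong (λ w → y * (z * fr z * fr (fr c) + z * fr c + w)) (*-identityˡ c) ⟩
    y * s ∎)
    where
    open ≡-Reasoning
    y≢0 : y ≢ 0#
    y≢0 refl = 1≢0 (trans (sym norm≡1) (trans (cong (_* fr (fr 0#)) (zeroˡ _)) (zeroˡ _)))
    z = inv y
    z≢0 : z ≢ 0#
    z≢0 = inv-≢0 y≢0
    norm-z≡1 : norm z ≡ 1#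
    norm-z≡1 = trans (sym (*-identityˡ _)) (trans (cong (_* norm z) (sym norm≡1)) (norm-inv y≢0))
    z′z″≡y : fr z * fr (fr z) ≡ y
    z′z″≡y = *-cancelˡ z≢0 (trans (sym (*-assoc _ _ _)) (trans norm-z≡1 (sym (*-inverseˡ y≢0))))
    c = proj₁ (linearised-non-root z 1# (*≢0 z≢0 (fr-≢0 z≢0)))
    s = z * fr z * fr (fr c) + z * fr c + c
    s≢0 : s ≢ 0#
    s≢0 e = proj₂ (linearised-non-root z 1# (*≢0 z≢0 (fr-≢0 z≢0)))
      (trans (cong (λ w → z * fr z * fr (fr c) + z * fr c + w) (*-identityˡ c)) e)

  -- Trace

  trace-+ : ∀ x y → trace (x + y) ≡ trace x + trace y
  trace-+ x y rewrite fr-+ x y | fr-+ (fr x) (fr y) =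
    solve 6 (λ a a' a'' b b' b'' → (a ⊕ b) ⊕ (a' ⊕ b') ⊕ (a'' ⊕ b'') := (a ⊕ a' ⊕ a'') ⊕ (b ⊕ b' ⊕ b''))
      refl x (fr x) (fr (fr x)) y (fr y) (fr (fr y))

  trace-Fixed-* : ∀ {c} → Fixed c → ∀ x → trace (c * x) ≡ c * trace x
  trace-Fixed-* {c} c′≡c x rewrite fr-* c x | c′≡c | fr-* c (fr x) | c′≡c =
    solve 4 (λ c a a' a'' → c ⊗ a ⊕ c ⊗ a' ⊕ c ⊗ a'' := c ⊗ (a ⊕ a' ⊕ a'')) refl c x (fr x) (fr (fr x))

  trace-x-frx : ∀ x → trace (x - fr x) ≡ 0#
  trace-x-frx x rewrite fr-- x (fr x) | fr-- (fr x) (fr (fr x)) | fr³ x =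
    solve 3 (λ a b c → (a ⊕ ⊝ b) ⊕ (b ⊕ ⊝ c) ⊕ (c ⊕ ⊝ a) := :0) refl x (fr x) (fr (fr x))

  trace≡0⇒fr² : ∀ {x} → trace x ≡ 0# → fr (fr x) ≡ - (x + fr x)
  trace≡0⇒fr² {x} e = trans (solve 3 (λ a b c → c := (a ⊕ b ⊕ c) ⊕ ⊝ (a ⊕ b)) refl x (fr x) (fr (fr x)))
    (trans (cong (_- (x + fr x)) e) (+-identityˡ _))

  -- The Moore determinant: it vanishes iff s and t are dependent over the subfield of order q.
  moore : Carrier → Carrier → Carrier
  moore s t = s * fr t - fr s * t

  Dependent : Carrier → Carrier → Set
  Dependent s t = moore s t ≡ 0#

  moore-self : ∀ s → moore s s ≡ 0#
  moore-self s = solve 2 (λ a b → a ⊗ b ⊕ ⊝ (b ⊗ a) := :0) refl s (fr s)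

  moore-≢0ˡ : ∀ {s t} → moore s t ≢ 0# → s ≢ 0#
  moore-≢0ˡ {s} {t} m≢0 refl = m≢0 (trans (cong (λ z → 0# * fr t - z * t) fr-0)
    (solve 2 (λ a b → :0 ⊗ a ⊕ ⊝ (:0 ⊗ b) := :0) refl (fr t) t))

  moore-≢0ʳ : ∀ {s t} → moore s t ≢ 0# → t ≢ 0#
  moore-≢0ʳ {s} {t} m≢0 refl = m≢0 (trans (cong (λ z → s * z - fr s * 0#) fr-0)
    (solve 2 (λ a b → a ⊗ :0 ⊕ ⊝ (b ⊗ :0) := :0) refl s (fr s)))

  fr-moore : ∀ s t → fr (moore s t) ≡ fr s * fr (fr t) - fr (fr s) * fr t
  fr-moore s t = trans (fr-- _ _) (cong₂ _-_ (fr-* _ _) (fr-* _ _))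

  -- For trace zero, s^(q²) = -(s + s^q). Substituting this into the Frobenius image of `moore s t`
  -- returns `moore s t`, so on trace-zero elements `moore` takes values in F_q.
  moore-Fixed : ∀ {s t} → trace s ≡ 0# → trace t ≡ 0# → Fixed (moore s t)
  moore-Fixed {s} {t} es et rewrite fr-moore s t | trace≡0⇒fr² es | trace≡0⇒fr² et =
    solve 4 (λ s s' t t' → s' ⊗ ⊝ (t ⊕ t') ⊕ ⊝ (⊝ (s ⊕ s') ⊗ t') := s ⊗ t' ⊕ ⊝ (s' ⊗ t)) refl s (fr s) t (fr t)

  private
    fr-Fixed-combination : ∀ {c} → Fixed c → ∀ a b → fr (a + c * b) ≡ fr a + c * fr b
    fr-Fixed-combination {c} c′≡c a b = trans (fr-+ _ _) (cong (fr a +_) (trans (fr-* c b) (cong (_* fr b) c′≡c)))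

  moore-combinationˡ : ∀ {c} → Fixed c → ∀ a b t → moore (a + c * b) t ≡ moore a t + c * moore b t
  moore-combinationˡ {c} c′≡c a b t rewrite fr-Fixed-combination c′≡c a b =
    solve 7 (λ a a' b b' c t t' → (a ⊕ c ⊗ b) ⊗ t' ⊕ ⊝ ((a' ⊕ c ⊗ b') ⊗ t) :=
        (a ⊗ t' ⊕ ⊝ (a' ⊗ t)) ⊕ c ⊗ (b ⊗ t' ⊕ ⊝ (b' ⊗ t)))
      refl a (fr a) b (fr b) c t (fr t)

  -- Every a - a^q has trace zero, and it is nonzero once a lies outside F_q. For fixed s₁, the
  -- Moore determinant of s₁ and b - b^q is a q-polynomial in b with leading coefficient -s₁, so
  -- some b makes it nonzero.
  trace0-independent : ∃ λ s₁ → ∃ λ s₂ → trace s₁ ≡ 0# × trace s₂ ≡ 0# × moore s₁ s₂ ≢ 0#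
  trace0-independent with a , a′-a≢0 ← non-root q 1≢0 poly-fr-x (ℕₚ.<-trans q<q² q²<order)
               with s₁≢0 ← (λ (e : a - fr a ≡ 0#) → a′-a≢0 (≡⇒-≡0 (sym (-≡0⇒≡ e)))) = from-non-root
    (linearised-non-root {a = - s₁} (s₁ + fr s₁) (- fr s₁)
       (λ e → s₁≢0 (trans (solve 1 (λ x → x := ⊝ (⊝ x)) refl s₁) (trans (cong -_ e) (solve 0 (⊝ :0 := :0) refl)))))
    where
    s₁ = a - fr a
    from-non-root : (∃ λ b → (- s₁) * fr (fr b) + (s₁ + fr s₁) * fr b + (- fr s₁) * b ≢ 0#) →
                    ∃ λ s₁ → ∃ λ s₂ → trace s₁ ≡ 0# × trace s₂ ≡ 0# × moore s₁ s₂ ≢ 0#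
    from-non-root (b , ≢0) = s₁ , b - fr b , trace-x-frx a , trace-x-frx b , λ e → ≢0 (trans expand e)
      where
      expand : (- s₁) * fr (fr b) + (s₁ + fr s₁) * fr b + (- fr s₁) * b ≡ moore s₁ (b - fr b)
      expand rewrite fr-- b (fr b) =
        solve 5 (λ s s' b b' b'' → ⊝ s ⊗ b'' ⊕ (s ⊕ s') ⊗ b' ⊕ ⊝ s' ⊗ b := s ⊗ (b' ⊕ ⊝ b'') ⊕ ⊝ (s' ⊗ (b ⊕ ⊝ b')))
          refl s₁ (fr s₁) b (fr b) (fr (fr b))

  Trace0* : Carrier → Set
  Trace0* s = s ≢ 0# × trace s ≡ 0#

  -- The trace-zero elements form a plane over F_q, whose q + 1 one-dimensional subspaces are
  -- spanned by s₂ and by s₁ + c s₂ with c in F_q. This is the source of every q + 1 below: the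
  -- points on a line of a subplane and the solutions of `Bad`.
  count-Trace0* : Count Dependent (suc q) Trace0*
  count-Trace0* = classes count-Fixed trace0-independent
    where
    classes : Count {Carrier} _≡_ q Fixed → (∃ λ s₁ → ∃ λ s₂ → trace s₁ ≡ 0# × trace s₂ ≡ 0# × moore s₁ s₂ ≢ 0#) →
              Count Dependent (suc q) Trace0*
    classes (cs , refl , cs∈ , cs# , cs∋) (s₁ , s₂ , e₁ , e₂ , V≢0) =
        s₂ ∷ map combination cs
      , cong suc (length-map combination cs)
      , (moore-≢0ʳ V≢0 , e₂) ∷ Allₚ.map⁺ (All.map (λ c∈ → moore-≢0ˡ (≢0-with-s₂ c∈) , trace0 c∈) cs∈)
      , Allₚ.map⁺ (All.map (λ c∈ e → ≢0-with-s₂ c∈ (dep-sym e)) cs∈) ∷ AllPairsₚ.map⁺ (apart cs∈ cs#)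
      , covers
      where
      V = moore s₁ s₂
      combination : Carrier → Carrier
      combination c = s₁ + c * s₂
      moore-anti : ∀ s t → moore s t ≡ - moore t s
      moore-anti s t = solve 4 (λ s s' t t' → s ⊗ t' ⊕ ⊝ (s' ⊗ t) := ⊝ (t ⊗ s' ⊕ ⊝ (t' ⊗ s))) refl s (fr s) t (fr t)
      dep-sym : ∀ {s t} → Dependent s t → Dependent t s
      dep-sym {s} {t} e = trans (moore-anti t s) (trans (cong -_ e) (solve 0 (⊝ :0 := :0) refl))
      trace0 : ∀ {c} → Fixed c → trace (combination c) ≡ 0#
      trace0 {c} c∈ = trans (trace-+ s₁ (c * s₂)) (trans (cong₂ _+_ e₁ (trans (trace-Fixed-* c∈ s₂) (cong (c *_) e₂)))
        (solve 1 (λ c → :0 ⊕ c ⊗ :0 := :0) refl c))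
      ≢0-with-s₂ : ∀ {c} → Fixed c → moore (combination c) s₂ ≢ 0#
      ≢0-with-s₂ {c} c∈ e = V≢0 (trans (solve 2 (λ v c → v := v ⊕ c ⊗ :0) refl V c)
        (trans (cong (λ z → V + c * z) (sym (moore-self s₂))) (trans (sym (moore-combinationˡ c∈ s₁ s₂ s₂)) e)))
      difference : ∀ {c d} → Fixed c → Fixed d → moore (combination c) (combination d) ≡ (d - c) * V
      difference {c} {d} c∈ d∈ rewrite fr-Fixed-combination c∈ s₁ s₂ | fr-Fixed-combination d∈ s₁ s₂ =
        solve 6 (λ c d a a' b b' → (a ⊕ c ⊗ b) ⊗ (a' ⊕ d ⊗ b') ⊕ ⊝ ((a' ⊕ c ⊗ b') ⊗ (a ⊕ d ⊗ b)) :=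
          (d ⊕ ⊝ c) ⊗ (a ⊗ b' ⊕ ⊝ (a' ⊗ b))) refl c d s₁ (fr s₁) s₂ (fr s₂)
      apart : ∀ {ds} → All Fixed ds → AllPairs _≢_ ds →
              AllPairs (λ c d → ¬ Dependent (combination c) (combination d)) ds
      apart [] [] = []
      apart (c∈ ∷ ds∈) (c# ∷ ds#) = All.zipWith independent (ds∈ , c#) ∷ apart ds∈ ds#
        where
        independent : ∀ {d} → Fixed d × _ ≢ d → ¬ Dependent (combination _) (combination d)
        independent (d∈ , c≢d) e = *≢0 (λ d-c≡0 → c≢d (sym (-≡0⇒≡ d-c≡0))) V≢0 (trans (sym (difference c∈ d∈)) e)
      covers : ∀ s → Trace0* s → Any (λ r → Dependent r s) (s₂ ∷ map combination cs)
      covers s (s≢0 , e) with moore s s₂ ≟ 0#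
      ... | yes ss₂≡0 = here (dep-sym ss₂≡0)
      ... | no α≢0 = there (Anyₚ.map⁺ (Any.map (λ { refl → dependent }) (cs∋ c c∈)))
        where
        α = moore s s₂
        β = moore s s₁
        -- The solution c of moore s₁ s + c · moore s₂ s = 0. It lies in F_q because both Moore
        -- determinants do.
        c = - (β * inv α)
        c∈ : Fixed c
        c∈ = trans (fr-neg _) (cong -_ (trans (fr-* β (inv α)) (cong₂ _*_ (moore-Fixed e e₁)
               (trans (fr-inv α) (cong inv (moore-Fixed e e₂))))))
        dependent : Dependent (combination c) s
        dependent = begin
          moore (s₁ + c * s₂) s                  ≡⟨ moore-combinationˡ c∈ s₁ s₂ s ⟩
          moore s₁ s + c * moore s₂ s            ≡⟨ cong₂ (λ a b → a + c * b) (moore-anti s₁ s) (moore-anti s₂ s) ⟩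
          - β + - (β * inv α) * - α              ≡⟨ solve 3 (λ a b i → ⊝ b ⊕ ⊝ (b ⊗ i) ⊗ ⊝ a := ⊝ b ⊕ b ⊗ (a ⊗ i)) refl α β (inv α) ⟩
          - β + β * (α * inv α)                  ≡⟨ cong (λ z → - β + β * z) (*-inverseʳ α≢0) ⟩
          - β + β * 1#                           ≡⟨ solve 1 (λ b → ⊝ b ⊕ b ⊗ :1 := :0) refl β ⟩
          0#                                     ∎
          where open ≡-Reasoning

  -- Points, their types and duality

  triple-≡ : ∀ {x y z x′ y′ z′ : Carrier} → x ≡ x′ → y ≡ y′ → z ≡ z′ → (x , y , z) ≡ (x′ , y′ , z′)
  triple-≡ refl refl refl = refl

  scale-1 : ∀ P → scale 1# P ≡ P
  scale-1 (x , y , z) = triple-≡ (*-identityˡ x) (*-identityˡ y) (*-identityˡ z)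

  scale-scale : ∀ l m P → scale l (scale m P) ≡ scale (l * m) P
  scale-scale l m (x , y , z) = sym (triple-≡ (*-assoc l m x) (*-assoc l m y) (*-assoc l m z))

  scale-inv : ∀ {l} → l ≢ 0# → ∀ P → scale (inv l) (scale l P) ≡ P
  scale-inv l≢0 P = trans (scale-scale _ _ P) (trans (cong (λ m → scale m P) (*-inverseˡ l≢0)) (scale-1 P))

  ∼-refl : ∀ {P} → P ∼ P
  ∼-refl = 1# , 1≢0 , sym (scale-1 _)

  ∼-reflexive : ∀ {P Q} → P ≡ Q → P ∼ Q
  ∼-reflexive refl = ∼-refl

  ∼-sym : ∀ {P Q} → P ∼ Q → Q ∼ P
  ∼-sym (l , l≢0 , refl) = inv l , inv-≢0 l≢0 , sym (scale-inv l≢0 _)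

  ∼-trans : ∀ {P Q R} → P ∼ Q → Q ∼ R → P ∼ R
  ∼-trans (l , l≢0 , refl) (m , m≢0 , refl) = m * l , *≢0 m≢0 l≢0 , scale-scale m l _

  φ-scale : ∀ l P → φ (scale l P) ≡ scale (fr l) (φ P)
  φ-scale l (x , y , z) = triple-≡ (fr-* l z) (fr-* l x) (fr-* l y)

  φ-∼ : ∀ {P Q} → P ∼ Q → φ P ∼ φ Q
  φ-∼ (l , l≢0 , refl) = fr l , fr-≢0 l≢0 , φ-scale l _

  ψ-scale : ∀ t l P → ψ t (scale l P) ≡ scale l (ψ t P)
  ψ-scale t l (x , y , z) = triple-≡ (swap t x) (swap (fr t) y) (swap (fr (fr t)) z)
    where
    swap : ∀ t x → t * (l * x) ≡ l * (t * x)
    swap t x = solve 3 (λ t l x → t ⊗ (l ⊗ x) := l ⊗ (t ⊗ x)) refl t l x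

  ψ-∼ : ∀ t {P Q} → P ∼ Q → ψ t P ∼ ψ t Q
  ψ-∼ t (l , l≢0 , refl) = l , l≢0 , ψ-scale t l _

  ψ-1 : ∀ P → ψ 1# P ≡ P
  ψ-1 (x , y , z) = triple-≡ (*-identityˡ x) (trans (cong (_* y) fr-1) (*-identityˡ y))
    (trans (cong (_* z) (trans (cong fr fr-1) fr-1)) (*-identityˡ z))

  ψ-ψ : ∀ s t P → ψ s (ψ t P) ≡ ψ (s * t) P
  ψ-ψ s t (x , y , z) = triple-≡ (sym (*-assoc s t x))
    (trans (sym (*-assoc _ _ y)) (cong (_* y) (sym (fr-* s t))))
    (trans (sym (*-assoc _ _ z)) (cong (_* z) (sym (trans (cong fr (fr-* s t)) (fr-* _ _)))))

  -- Rests on t^(q³) = t. This commutation is the reason why the type of a point is constant on each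
  -- orbit.
  φ-ψ : ∀ t P → φ (ψ t P) ≡ ψ t (φ P)
  φ-ψ t (x , y , z) = triple-≡ (trans (fr-* _ z) (cong (_* fr z) (fr³ t))) (fr-* t x) (fr-* _ y)

  Orb-refl : ∀ {P} → Orb P P
  Orb-refl = 1# , 1≢0 , ∼-reflexive (sym (ψ-1 _))

  Orb-sym : ∀ {P Q} → Orb P Q → Orb Q P
  Orb-sym {P} {Q} (t , t≢0 , Q∼) = inv t , inv-≢0 t≢0 , ∼-sym (∼-trans (ψ-∼ (inv t) Q∼)
    (∼-reflexive (trans (ψ-ψ _ t P) (trans (cong (λ u → ψ u P) (*-inverseˡ t≢0)) (ψ-1 P)))))

  Orb-trans : ∀ {P Q R} → Orb P Q → Orb Q R → Orb P R
  Orb-trans {P} (s , s≢0 , Q∼) (t , t≢0 , R∼) =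
    t * s , *≢0 t≢0 s≢0 , ∼-trans R∼ (∼-trans (ψ-∼ t Q∼) (∼-reflexive (ψ-ψ t s P)))

  ∼⇒Orb : ∀ {P Q} → Q ∼ P → Orb P Q
  ∼⇒Orb Q∼P = 1# , 1≢0 , ∼-trans Q∼P (∼-reflexive (sym (ψ-1 _)))

  ψ-Orb : ∀ {t} → t ≢ 0# → ∀ P → Orb P (ψ t P)
  ψ-Orb t≢0 P = _ , t≢0 , ∼-refl

  :det : ∀ {n} → (a b c d e f g h i : Term n) → Term n
  :det a b c d e f g h i = a ⊗ (e ⊗ i ⊕ ⊝ (f ⊗ h)) ⊕ ⊝ (b ⊗ (d ⊗ i ⊕ ⊝ (f ⊗ g))) ⊕ c ⊗ (d ⊗ h ⊕ ⊝ (e ⊗ g))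

  det-scale : ∀ l m n P Q R → det (scale l P) (scale m Q) (scale n R) ≡ l * m * n * det P Q R
  det-scale l m n (a , b , c) (d , e , f) (g , h , i) = solve 12 (λ l m n a b c d e f g h i →
      :det (l ⊗ a) (l ⊗ b) (l ⊗ c) (m ⊗ d) (m ⊗ e) (m ⊗ f) (n ⊗ g) (n ⊗ h) (n ⊗ i) := l ⊗ m ⊗ n ⊗ :det a b c d e f g h i)
    refl l m n a b c d e f g h i

  det-ψ : ∀ t P Q R → det (ψ t P) (ψ t Q) (ψ t R) ≡ norm t * det P Q R
  det-ψ t (a , b , c) (d , e , f) (g , h , i) = solve 12 (λ l m n a b c d e f g h i →
      :det (l ⊗ a) (m ⊗ b) (n ⊗ c) (l ⊗ d) (m ⊗ e) (n ⊗ f) (l ⊗ g) (m ⊗ h) (n ⊗ i) := l ⊗ m ⊗ n ⊗ :det a b c d e f g h i)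
    refl t (fr t) (fr (fr t)) a b c d e f g h i

  det-proportional : ∀ l Q R → det (scale l Q) Q R ≡ 0#
  det-proportional l (a , b , c) (g , h , i) = solve 7 (λ l a b c g h i →
      :det (l ⊗ a) (l ⊗ b) (l ⊗ c) a b c g h i := :0)
    refl l a b c g h i

  D : Triple → Carrier
  D P = det P (φ P) (φ (φ P))

  D-scale : ∀ l P → D (scale l P) ≡ norm l * D P
  D-scale l P = trans
    (cong₂ (det (scale l P)) (φ-scale l P) (trans (cong φ (φ-scale l P)) (φ-scale (fr l) (φ P))))
    (det-scale l (fr l) (fr (fr l)) P (φ P) (φ (φ P)))

  D-ψ : ∀ t P → D (ψ t P) ≡ norm t * D P
  D-ψ t P = trans
    (cong₂ (det (ψ t P)) (φ-ψ t P) (trans (cong φ (φ-ψ t P)) (φ-ψ t (φ P))))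
    (det-ψ t P (φ P) (φ (φ P)))

  D≡0-Orb : ∀ {P Q} → Orb P Q → D P ≡ 0# → D Q ≡ 0#
  D≡0-Orb {P} {Q} (t , _ , l , l≢0 , e) DP≡0 = *-cancelˡ (norm-≢0 l≢0) (begin
    norm l * D Q     ≡⟨ D-scale l Q ⟨
    D (scale l Q)    ≡⟨ cong D e ⟨
    D (ψ t P)        ≡⟨ D-ψ t P ⟩
    norm t * D P     ≡⟨ cong (norm t *_) DP≡0 ⟩
    norm t * 0#      ≡⟨ trans (zeroʳ _) (sym (zeroʳ _)) ⟩
    norm l * 0#      ∎)
    where open ≡-Reasoning

  typeI-Orb : ∀ {P Q} → Orb P Q → PointTypeI P → PointTypeI Q
  typeI-Orb {P} (t , _ , Q∼) φP∼P =
    ∼-trans (φ-∼ Q∼) (∼-trans (∼-reflexive (φ-ψ t P)) (∼-trans (ψ-∼ t φP∼P) (∼-sym Q∼)))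

  typeII-Orb : ∀ {P Q} → Orb P Q → PointTypeII P → PointTypeII Q
  typeII-Orb o (¬I , DP≡0) = (λ I → ¬I (typeI-Orb (Orb-sym o) I)) , D≡0-Orb o DP≡0

  typeIII-Orb : ∀ {P Q} → Orb P Q → PointTypeIII P → PointTypeIII Q
  typeIII-Orb o DP≢0 DQ≡0 = DP≢0 (D≡0-Orb (Orb-sym o) DQ≡0)

  typeI⇒D≡0 : ∀ {P} → PointTypeI P → D P ≡ 0#
  typeI⇒D≡0 {P} (l , _ , e) = trans (cong (λ R → det R (φ P) (φ (φ P))) e) (det-proportional l (φ P) (φ (φ P)))

  -- Invariance under φ ties each coordinate to the Frobenius image of another in a 3-cycle, so one
  -- zero coordinate forces all three to vanish.
  coordinates-≢0 : ∀ {x y z} → PointTypeI (x , y , z) → NonZeroT (x , y , z) → OffTriangle (x , y , z)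
  coordinates-≢0 {x} {y} {z} (l , l≢0 , e) P≢0 = x≢0 , y≢0 , z≢0
    where
    x≡ : x ≡ l * fr z
    x≡ = cong proj₁ e
    y≡ : y ≡ l * fr x
    y≡ = cong (proj₁ ∘ proj₂) e
    z≡ : z ≡ l * fr y
    z≡ = cong (proj₂ ∘ proj₂) e
    vanish : ∀ {u v} → v ≡ l * fr u → u ≡ 0# → v ≡ 0#
    vanish v≡ u≡0 = trans v≡ (trans (cong (l *_) (trans (cong fr u≡0) fr-0)) (zeroʳ l))
    x≢0 : x ≢ 0#
    x≢0 x≡0 = P≢0 (x≡0 , vanish y≡ x≡0 , vanish z≡ (vanish y≡ x≡0))
    y≢0 : y ≢ 0#
    y≢0 y≡0 = x≢0 (vanish x≡ (vanish z≡ y≡0))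
    z≢0 : z ≢ 0#
    z≢0 z≡0 = x≢0 (vanish x≡ z≡0)

  -- Going once round the cycle x = l z^q, z = l y^q, y = l x^q gives norm 1 for l. Hilbert 90 then
  -- yields s with s^q = l s, and multiplying the point by s absorbs l.
  typeI⇒P2q : ∀ {P} → NonZeroT P → PointTypeI P → P2q P
  typeI⇒P2q {x , y , z} P≢0 I@(l , l≢0 , e) = from-hilbert90 (hilbert90 norm-l≡1)
    where
    open ≡-Reasoning
    x≢0 : x ≢ 0#
    x≢0 = proj₁ (coordinates-≢0 I P≢0)
    x≡ : x ≡ l * fr z
    x≡ = cong proj₁ e
    y≡ : y ≡ l * fr x
    y≡ = cong (proj₁ ∘ proj₂) e
    z≡ : z ≡ l * fr y
    z≡ = cong (proj₂ ∘ proj₂) e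
    norm-l≡1 : norm l ≡ 1#
    norm-l≡1 = *-cancelʳ x≢0 (sym (begin
      1# * x                                       ≡⟨ *-identityˡ x ⟩
      x                                            ≡⟨ x≡ ⟩
      l * fr z                                     ≡⟨ cong (λ v → l * fr v) z≡ ⟩
      l * fr (l * fr y)                            ≡⟨ cong (l *_) (fr-* _ _) ⟩
      l * (fr l * fr (fr y))                       ≡⟨ cong (λ v → l * (fr l * fr (fr v))) y≡ ⟩
      l * (fr l * fr (fr (l * fr x)))              ≡⟨ cong (λ v → l * (fr l * v)) (trans (cong fr (fr-* _ _)) (fr-* _ _)) ⟩
      l * (fr l * (fr (fr l) * fr (fr (fr x))))    ≡⟨ cong (λ v → l * (fr l * (fr (fr l) * v))) (fr³ x) ⟩
      l * (fr l * (fr (fr l) * x))                 ≡⟨ solve 4 (λ a b c d → a ⊗ (b ⊗ (c ⊗ d)) := a ⊗ b ⊗ c ⊗ d) refl _ _ _ _ ⟩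
      norm l * x                                   ∎))
    from-hilbert90 : (∃ λ s → s ≢ 0# × fr s ≡ l * s) → P2q (x , y , z)
    from-hilbert90 (s , s≢0 , s′≡) = s * x , *≢0 s≢0 x≢0 , s , s≢0 , triple-≡ refl (shift y≡) (trans (cong fr (shift y≡)) (shift z≡))
      where
      shift : ∀ {u v} → v ≡ l * fr u → fr (s * u) ≡ s * v
      shift {u} refl = trans (fr-* s u) (trans (cong (_* fr u) s′≡) (solve 3 (λ l s u → l ⊗ s ⊗ u := s ⊗ (l ⊗ u)) refl l s (fr u)))

  vieta : ∀ {a b c u v w} → a + b + c ≡ u + v + w → a * b + b * c + c * a ≡ u * v + v * w + w * u →
          a * b * c ≡ u * v * w → ∀ t → (t - a) * (t - b) * (t - c) ≡ (t - u) * (t - v) * (t - w)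
  vieta {a} {b} {c} {u} {v} {w} e₁ e₂ e₃ t = begin
    (t - a) * (t - b) * (t - c)
      ≡⟨ expand a b c ⟩
    t * t * t - (a + b + c) * (t * t) + (a * b + b * c + c * a) * t - a * b * c
      ≡⟨ cong₂ _-_ (cong₂ (λ x y → t * t * t - x * (t * t) + y * t) e₁ e₂) e₃ ⟩
    t * t * t - (u + v + w) * (t * t) + (u * v + v * w + w * u) * t - u * v * w
      ≡⟨ expand u v w ⟨
    (t - u) * (t - v) * (t - w) ∎
    where
    open ≡-Reasoning
    expand : ∀ a b c → (t - a) * (t - b) * (t - c) ≡ t * t * t - (a + b + c) * (t * t) + (a * b + b * c + c * a) * t - a * b * c
    expand a b c = solve 4 (λ t a b c → (t ⊕ ⊝ a) ⊗ (t ⊕ ⊝ b) ⊗ (t ⊕ ⊝ c) :=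
      t ⊗ t ⊗ t ⊕ ⊝ ((a ⊕ b ⊕ c) ⊗ (t ⊗ t)) ⊕ (a ⊗ b ⊕ b ⊗ c ⊕ c ⊗ a) ⊗ t ⊕ ⊝ (a ⊗ b ⊗ c)) refl t a b c

  dual : Triple → Triple
  dual (x , y , z) = inv x , inv y , inv z

  dual-involutive : ∀ P → dual (dual P) ≡ P
  dual-involutive (x , y , z) = triple-≡ (inv-involutive x) (inv-involutive y) (inv-involutive z)

  dual-off : ∀ {P} → OffTriangle P → OffTriangle (dual P)
  dual-off (x≢0 , y≢0 , z≢0) = inv-≢0 x≢0 , inv-≢0 y≢0 , inv-≢0 z≢0

  dual-scale : ∀ l P → dual (scale l P) ≡ scale (inv l) (dual P)
  dual-scale l (x , y , z) = triple-≡ (inv-distrib-* l x) (inv-distrib-* l y) (inv-distrib-* l z)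

  dual-∼ : ∀ {P Q} → P ∼ Q → dual P ∼ dual Q
  dual-∼ (l , l≢0 , refl) = inv l , inv-≢0 l≢0 , dual-scale l _

  dual-φ : ∀ P → dual (φ P) ≡ φ (dual P)
  dual-φ (x , y , z) = triple-≡ (sym (fr-inv z)) (sym (fr-inv x)) (sym (fr-inv y))

  dual-ψ : ∀ t P → dual (ψ t P) ≡ ψ (inv t) (dual P)
  dual-ψ t (x , y , z) = triple-≡ (inv-distrib-* t x)
    (trans (inv-distrib-* _ y) (cong (_* inv y) (sym (fr-inv t))))
    (trans (inv-distrib-* _ z) (cong (_* inv z) (sym (trans (cong fr (fr-inv t)) (fr-inv (fr t))))))

  dual-Orb : ∀ {P Q} → Orb P Q → Orb (dual P) (dual Q)
  dual-Orb {P} (t , t≢0 , Q∼) = inv t , inv-≢0 t≢0 , ∼-trans (dual-∼ Q∼) (∼-reflexive (dual-ψ t P))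

  dual-typeI : ∀ {P} → PointTypeI P → PointTypeI (dual P)
  dual-typeI {P} I = ∼-trans (∼-reflexive (sym (dual-φ P))) (dual-∼ I)

  mixed : Triple → Carrier
  mixed (x , y , z) = x * fr y * fr (fr z)

  fr-mixed : ∀ x y z → fr (mixed (x , y , z)) ≡ fr x * fr (fr y) * z
  fr-mixed x y z = trans (fr-* _ _) (cong₂ _*_ (fr-* _ _) (fr³ z))

  fr²-mixed : ∀ x y z → fr (fr (mixed (x , y , z))) ≡ fr (fr x) * y * fr z
  fr²-mixed x y z = trans (cong fr (fr-mixed x y z)) (trans (fr-* _ _) (cong (_* fr z) (trans (fr-* _ _) (cong (fr (fr x) *_) (fr³ y)))))

  D-expand : ∀ x y z → D (x , y , z) ≡ norm x + norm y + norm z - trace (mixed (x , y , z))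
  D-expand x y z rewrite fr-mixed x y z | fr-* (fr x * fr (fr y)) z | fr-* (fr x) (fr (fr y)) | fr³ y =
    solve 9 (λ x x' x'' y y' y'' z z' z'' → :det x y z z' x' y' y'' z'' x'' :=
        x ⊗ x' ⊗ x'' ⊕ y ⊗ y' ⊗ y'' ⊕ z ⊗ z' ⊗ z'' ⊕ ⊝ (x ⊗ y' ⊗ z'' ⊕ x' ⊗ y'' ⊗ z ⊕ x'' ⊗ y ⊗ z'))
      refl x (fr x) (fr (fr x)) y (fr y) (fr (fr y)) z (fr z) (fr (fr z))

  norm-mixed : ∀ x y z → norm (mixed (x , y , z)) ≡ norm x * norm y * norm z
  norm-mixed x y z = trans (norm-* _ _) (cong₂ _*_ (trans (norm-* _ _) (cong (norm x *_) (norm-fr y)))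
    (trans (norm-fr (fr z)) (norm-fr z)))

  mixed-dual : ∀ {x y z} → OffTriangle (x , y , z) → mixed (x , y , z) * mixed (dual (x , y , z)) ≡ 1#
  mixed-dual {x} {y} {z} (x≢0 , y≢0 , z≢0) = begin
    x * fr y * fr (fr z) * (inv x * fr (inv y) * fr (fr (inv z)))
      ≡⟨ solve 6 (λ x y z a b c → x ⊗ y ⊗ z ⊗ (a ⊗ b ⊗ c) := x ⊗ a ⊗ (y ⊗ b) ⊗ (z ⊗ c)) refl x (fr y) (fr (fr z)) _ _ _ ⟩
    x * inv x * (fr y * fr (inv y)) * (fr (fr z) * fr (fr (inv z)))
      ≡⟨ cong₂ _*_ (cong₂ _*_ (*-inverseʳ x≢0) (fr-unit y≢0)) (trans (sym (fr-* _ _)) (trans (cong fr (fr-unit z≢0)) fr-1)) ⟩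
    1# * 1# * 1#
      ≡⟨ solve 0 (:1 ⊗ :1 ⊗ :1 := :1) refl ⟩
    1# ∎
    where
    open ≡-Reasoning
    fr-unit : ∀ {y} → y ≢ 0# → fr y * fr (inv y) ≡ 1#
    fr-unit y≢0 = trans (sym (fr-* _ _)) (trans (cong fr (*-inverseʳ y≢0)) fr-1)

  -- With w = x y^q z^(q²), the two hypotheses say that w and its conjugates have the same
  -- elementary symmetric functions as N(x), N(y), N(z); hence w is one of these norms, so
  -- it is fixed by Frobenius, and then all of them are equal to w.
  D≡0⇒typeI : ∀ {P} → OffTriangle P → D P ≡ 0# → D (dual P) ≡ 0# → PointTypeI P
  D≡0⇒typeI {x , y , z} off@(x≢0 , y≢0 , z≢0) DP≡0 DP*≡0 =
    l , *≢0 x≢0 (inv-≢0 (fr-≢0 z≢0)) , triple-≡ x≡ y≡ z≡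
    where
    open ≡-Reasoning
    w = mixed (x , y , z)
    W = mixed (dual (x , y , z))
    a = norm x
    b = norm y
    c = norm z
    e₁ : a + b + c ≡ w + fr w + fr (fr w)
    e₁ = -≡0⇒≡ (trans (sym (D-expand x y z)) DP≡0)
    E₁ : norm (inv x) + norm (inv y) + norm (inv z) ≡ W + fr W + fr (fr W)
    E₁ = -≡0⇒≡ (trans (sym (D-expand (inv x) (inv y) (inv z))) DP*≡0)
    e₃ : a * b * c ≡ w * fr w * fr (fr w)
    e₃ = sym (norm-mixed x y z)
    wW : w * W ≡ 1#
    wW = mixed-dual off
    wW′ : fr w * fr W ≡ 1#
    wW′ = trans (sym (fr-* _ _)) (trans (cong fr wW) fr-1)
    wW″ : fr (fr w) * fr (fr W) ≡ 1#
    wW″ = trans (sym (fr-* _ _)) (trans (cong fr wW′) fr-1)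
    -- The second elementary symmetric function is the third times the first of the reciprocals. In
    -- this way the hypothesis on `dual` supplies the middle coefficient of the cubic.
    clear : ∀ {a b c A B C} → a * A ≡ 1# → b * B ≡ 1# → c * C ≡ 1# → a * b + b * c + c * a ≡ a * b * c * (A + B + C)
    clear {a} {b} {c} {A} {B} {C} aA bB cC = begin
      a * b + b * c + c * a
        ≡⟨ solve 3 (λ a b c → a ⊗ b ⊕ b ⊗ c ⊕ c ⊗ a := a ⊗ b ⊗ :1 ⊕ b ⊗ c ⊗ :1 ⊕ c ⊗ a ⊗ :1) refl a b c ⟩
      a * b * 1# + b * c * 1# + c * a * 1#
        ≡⟨ cong₂ _+_ (cong₂ _+_ (cong (a * b *_) cC) (cong (b * c *_) aA)) (cong (c * a *_) bB) ⟨
      a * b * (c * C) + b * c * (a * A) + c * a * (b * B)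
        ≡⟨ solve 6 (λ a b c A B C → a ⊗ b ⊗ (c ⊗ C) ⊕ b ⊗ c ⊗ (a ⊗ A) ⊕ c ⊗ a ⊗ (b ⊗ B) := a ⊗ b ⊗ c ⊗ (A ⊕ B ⊕ C)) refl a b c A B C ⟩
      a * b * c * (A + B + C) ∎
    e₂ : a * b + b * c + c * a ≡ w * fr w + fr w * fr (fr w) + fr (fr w) * w
    e₂ = begin
      a * b + b * c + c * a
        ≡⟨ clear (norm-inv x≢0) (norm-inv y≢0) (norm-inv z≢0) ⟩
      a * b * c * (norm (inv x) + norm (inv y) + norm (inv z))
        ≡⟨ cong₂ _*_ e₃ E₁ ⟩
      w * fr w * fr (fr w) * (W + fr W + fr (fr W))
        ≡⟨ clear wW wW′ wW″ ⟨
      w * fr w + fr w * fr (fr w) + fr (fr w) * w ∎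
    same-roots : ∀ t → (t - a) * (t - b) * (t - c) ≡ (t - w) * (t - fr w) * (t - fr (fr w))
    same-roots = vieta e₁ e₂ e₃
    w-root : (w - a) * (w - b) * (w - c) ≡ 0#
    w-root = trans (same-roots w) (solve 3 (λ w w' w'' → (w ⊕ ⊝ w) ⊗ (w ⊕ ⊝ w') ⊗ (w ⊕ ⊝ w'') := :0) refl w (fr w) (fr (fr w)))
    norm-fixed : ∀ {v} u → v - norm u ≡ 0# → Fixed v
    norm-fixed u e = subst Fixed (sym (-≡0⇒≡ e)) (fr-norm u)
    w-fixed : Fixed w
    w-fixed = [ [ norm-fixed x , norm-fixed y ]′ ∘ *≡0 , norm-fixed z ]′ (*≡0 w-root)
    root⇒≡w : ∀ t → (t - a) * (t - b) * (t - c) ≡ 0# → t ≡ w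
    root⇒≡w t e = [ [ -≡0⇒≡ , (λ t≡w′ → trans (-≡0⇒≡ t≡w′) w-fixed) ]′ ∘ *≡0
                  , (λ t≡w″ → trans (-≡0⇒≡ t≡w″) (trans (cong fr w-fixed) w-fixed)) ]′
                  (*≡0 (trans (sym (same-roots t)) e))
    a≡w : a ≡ w
    a≡w = root⇒≡w a (solve 3 (λ a b c → (a ⊕ ⊝ a) ⊗ (a ⊕ ⊝ b) ⊗ (a ⊕ ⊝ c) := :0) refl a b c)
    c≡w : c ≡ w
    c≡w = root⇒≡w c (solve 3 (λ a b c → (c ⊕ ⊝ a) ⊗ (c ⊕ ⊝ b) ⊗ (c ⊕ ⊝ c) := :0) refl a b c)
    -- Cancelling a common factor from N(x) = w^(q²) here and from N(z) = w below gives x x^q = y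
    -- z^q and z z^q = x y^q. Together they say that (x, y, z) is proportional to (z^q, x^q, y^q),
    -- with factor x / z^q.
    xx′≡yz′ : x * fr x ≡ y * fr z
    xx′≡yz′ = *-cancelʳ (fr-≢0 (fr-≢0 x≢0)) (begin
      x * fr x * fr (fr x)    ≡⟨ a≡w ⟩
      w                       ≡⟨ trans (cong fr w-fixed) w-fixed ⟨
      fr (fr w)               ≡⟨ fr²-mixed x y z ⟩
      fr (fr x) * y * fr z    ≡⟨ solve 3 (λ a b c → a ⊗ b ⊗ c := b ⊗ c ⊗ a) refl _ _ _ ⟩
      y * fr z * fr (fr x)    ∎)
    zz′≡xy′ : z * fr z ≡ x * fr y
    zz′≡xy′ = *-cancelʳ (fr-≢0 (fr-≢0 z≢0)) c≡w
    l = x * inv (fr z)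
    divide : ∀ {u v} → u * fr z ≡ v → u ≡ v * inv (fr z)
    divide {u} refl = sym (trans (*-assoc _ _ _) (trans (cong (u *_) (*-inverseʳ (fr-≢0 z≢0))) (*-identityʳ u)))
    x≡ : x ≡ l * fr z
    x≡ = trans (divide refl) (solve 3 (λ x z i → x ⊗ z ⊗ i := x ⊗ i ⊗ z) refl x (fr z) (inv (fr z)))
    y≡ : y ≡ l * fr x
    y≡ = trans (divide (sym xx′≡yz′)) (solve 3 (λ x z i → x ⊗ z ⊗ i := x ⊗ i ⊗ z) refl x (fr x) (inv (fr z)))
    z≡ : z ≡ l * fr y
    z≡ = trans (divide zz′≡xy′) (solve 3 (λ x z i → x ⊗ z ⊗ i := x ⊗ i ⊗ z) refl x (fr y) (inv (fr z)))

  -- Orbits off the triangle are subplanes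

  -- Dependence is s t^q = s^q t, which says that the quotient t/s is fixed by Frobenius. The two
  -- sides are compared after multiplication by `s * fr s`.
  dependent⇒multiple : ∀ {s t} → s ≢ 0# → Dependent s t → ∃ λ c → Fixed c × t ≡ c * s
  dependent⇒multiple {s} {t} s≢0 dep = t * inv s , fixed , (begin
      t                  ≡⟨ *-identityʳ t ⟨
      t * 1#             ≡⟨ cong (t *_) (*-inverseˡ s≢0) ⟨
      t * (inv s * s)    ≡⟨ *-assoc t _ s ⟨
      t * inv s * s      ∎)
    where
    open ≡-Reasoning
    fixed : fr (t * inv s) ≡ t * inv s
    fixed = *-cancelʳ (*≢0 s≢0 (fr-≢0 s≢0)) (begin
      fr (t * inv s) * (s * fr s)       ≡⟨ solve 3 (λ a s s' → a ⊗ (s ⊗ s') := s ⊗ (a ⊗ s')) refl _ s (fr s) ⟩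
      s * (fr (t * inv s) * fr s)       ≡⟨ cong (s *_) (fr-* _ _) ⟨
      s * fr (t * inv s * s)            ≡⟨ cong (λ v → s * fr v) (trans (*-assoc _ _ _) (trans (cong (t *_) (*-inverseˡ s≢0)) (*-identityʳ t))) ⟩
      s * fr t                          ≡⟨ -≡0⇒≡ dep ⟩
      fr s * t                          ≡⟨ solve 2 (λ a b → a ⊗ b := b ⊗ :1 ⊗ a) refl (fr s) t ⟩
      t * 1# * fr s                     ≡⟨ cong (λ v → t * v * fr s) (*-inverseˡ s≢0) ⟨
      t * (inv s * s) * fr s            ≡⟨ solve 4 (λ t i s s' → t ⊗ (i ⊗ s) ⊗ s' := t ⊗ i ⊗ (s ⊗ s')) refl t (inv s) s (fr s) ⟩
      t * inv s * (s * fr s)            ∎)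

  -- For c in F_q* the map ψ c is scaling by c, so the point ψ t P depends only on t modulo F_q*.
  -- With the converse `dependent-ψ`, these classes parametrise an orbit off the triangle.
  ψ-dependent : ∀ {s t} → s ≢ 0# → t ≢ 0# → Dependent s t → ∀ P → ψ s P ∼ ψ t P
  ψ-dependent {s} {t} s≢0 t≢0 dep P@(x , y , z) = multiple (dependent⇒multiple s≢0 dep)
    where
    multiple : (∃ λ c → Fixed c × t ≡ c * s) → ψ s P ∼ ψ t P
    multiple (c , c′≡c , t≡cs) = c , *≢0⇒ˡ (λ cs≡0 → t≢0 (trans t≡cs cs≡0)) , triple-≡
        (times t≡cs) (times fr-t) (times (trans (cong fr fr-t) (trans (fr-* c _) (cong (_* fr (fr s)) c′≡c))))
      where
      times : ∀ {t s x} → t ≡ c * s → t * x ≡ c * (s * x)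
      times {x = x} e = trans (cong (_* x) e) (*-assoc c _ x)
      fr-t : fr t ≡ c * fr s
      fr-t = trans (cong fr t≡cs) (trans (fr-* c s) (cong (_* fr s) c′≡c))

  dependent-ψ : ∀ {s t P} → OffTriangle P → ψ s P ∼ ψ t P → Dependent s t
  dependent-ψ {s} {t} {x , y , z} (x≢0 , y≢0 , _) (l , _ , e) = begin
    s * fr t - fr s * t                ≡⟨ cong₂ (λ a b → s * a - fr s * b) (component y≢0 (cong (proj₁ ∘ proj₂) e)) (component x≢0 (cong proj₁ e)) ⟩
    s * (l * fr s) - fr s * (l * s)    ≡⟨ solve 3 (λ s s' l → s ⊗ (l ⊗ s') ⊕ ⊝ (s' ⊗ (l ⊗ s)) := :0) refl s (fr s) l ⟩
    0#                                 ∎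
    where
    open ≡-Reasoning
    component : ∀ {s t x} → x ≢ 0# → t * x ≡ l * (s * x) → t ≡ l * s
    component x≢0 e = *-cancelʳ x≢0 (trans e (sym (*-assoc l _ _)))

  moore-scale : ∀ w s t → moore (s * w) (t * w) ≡ (w * fr w) * moore s t
  moore-scale w s t = trans (cong₂ (λ a b → s * w * a - b * (t * w)) (fr-* t w) (fr-* s w))
    (solve 6 (λ w w' s s' t t' → s ⊗ w ⊗ (t' ⊗ w') ⊕ ⊝ (s' ⊗ w' ⊗ (t ⊗ w)) := w ⊗ w' ⊗ (s ⊗ t' ⊕ ⊝ (s' ⊗ t)))
      refl w (fr w) s (fr s) t (fr t))

  offTriangle⇒nonZero : ∀ {P} → OffTriangle P → NonZeroT P
  offTriangle⇒nonZero (x≢0 , _) (x≡0 , _) = x≢0 x≡0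

  ψ-off : ∀ {t P} → t ≢ 0# → OffTriangle P → OffTriangle (ψ t P)
  ψ-off t≢0 (x≢0 , y≢0 , z≢0) = *≢0 t≢0 x≢0 , *≢0 (fr-≢0 t≢0) y≢0 , *≢0 (fr-≢0 (fr-≢0 t≢0)) z≢0

  -- The right side is the 3 by 3 Moore determinant of a, u, v expanded along the row of a. Being
  -- alternating, it vanishes for a = u and a = v; it also computes collinearity inside an orbit.
  trace-fr-moore : ∀ a u v → trace (a * fr (moore u v)) ≡ a * (fr u * fr (fr v) - fr (fr u) * fr v)
                   + fr a * (fr (fr u) * v - u * fr (fr v)) + fr (fr a) * (u * fr v - fr u * v)
  trace-fr-moore a u v = cong₂ _+_ (cong₂ _+_ (cong (a *_) (fr-moore u v)) (trans (fr-* _ _) (cong (fr a *_) fr²-moore)))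
      (trans (cong fr (fr-* _ _)) (trans (fr-* _ _) (cong (fr (fr a) *_) (fr³ (moore u v)))))
    where
    fr²-moore : fr (fr (moore u v)) ≡ fr (fr u) * v - u * fr (fr v)
    fr²-moore = trans (cong fr (fr-moore u v)) (trans (fr-- _ _) (cong₂ _-_
      (trans (fr-* _ _) (cong (fr (fr u) *_) (fr³ v))) (trans (fr-* _ _) (cong (_* fr (fr v)) (fr³ u)))))

  pairing : Triple → Triple → Carrier
  pairing (x , y , z) (a , b , c) = a * x + b * y + c * z

  pairing-scale : ∀ l m P Q → pairing (scale l P) (scale m Q) ≡ l * m * pairing P Q
  pairing-scale l m (x , y , z) (a , b , c) = solve 8 (λ l m x y z a b c →
      m ⊗ a ⊗ (l ⊗ x) ⊕ m ⊗ b ⊗ (l ⊗ y) ⊕ m ⊗ c ⊗ (l ⊗ z) := l ⊗ m ⊗ (a ⊗ x ⊕ b ⊗ y ⊕ c ⊗ z))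
    refl l m x y z a b c

  -- The coordinates of `P` cancel against those of `dual P`, and what remains is the trace form.
  -- Hence all orbits off the triangle carry the same incidence structure.
  pairing-ψ : ∀ {P} → OffTriangle P → ∀ t u → pairing (ψ t P) (ψ u (dual P)) ≡ trace (u * t)
  pairing-ψ {x , y , z} (x≢0 , y≢0 , z≢0) t u = cong₂ _+_ (cong₂ _+_ (cancel x≢0) (trans (cancel y≢0) (sym (fr-* u t))))
      (trans (cancel z≢0) (sym (trans (cong fr (fr-* u t)) (fr-* _ _))))
    where
    cancel : ∀ {x u t} → x ≢ 0# → u * inv x * (t * x) ≡ u * t
    cancel {x} {u} {t} x≢0 = trans (solve 4 (λ u i t x → u ⊗ i ⊗ (t ⊗ x) := u ⊗ t ⊗ (i ⊗ x)) refl u (inv x) t x)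
      (trans (cong (u * t *_) (*-inverseˡ x≢0)) (*-identityʳ _))

  module _ {P : Triple} (off : OffTriangle P) where

    -- The point ψ t P lies on the line ψ u P* iff u t has trace zero.
    Inc⇒trace : ∀ {t u Q ℓ} → Q ∼ ψ t P → ℓ ∼ ψ u (dual P) → Inc Q ℓ → trace (u * t) ≡ 0#
    Inc⇒trace {t} {u} {Q} {ℓ} (l , _ , e) (m , _ , e′) inc = begin
      trace (u * t)                        ≡⟨ pairing-ψ off t u ⟨
      pairing (ψ t P) (ψ u (dual P))       ≡⟨ cong₂ pairing e e′ ⟩
      pairing (scale l Q) (scale m ℓ)      ≡⟨ pairing-scale l m Q ℓ ⟩
      l * m * pairing Q ℓ                  ≡⟨ cong (l * m *_) inc ⟩
      l * m * 0#                           ≡⟨ zeroʳ _ ⟩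
      0#                                   ∎
      where open ≡-Reasoning

    trace⇒Inc : ∀ {t u Q ℓ} → Q ∼ ψ t P → ℓ ∼ ψ u (dual P) → trace (u * t) ≡ 0# → Inc Q ℓ
    trace⇒Inc {t} {u} {Q} {ℓ} (l , l≢0 , e) (m , m≢0 , e′) tr = *-cancelˡ (*≢0 l≢0 m≢0) (begin
      l * m * pairing Q ℓ                  ≡⟨ pairing-scale l m Q ℓ ⟨
      pairing (scale l Q) (scale m ℓ)      ≡⟨ cong₂ pairing e e′ ⟨
      pairing (ψ t P) (ψ u (dual P))       ≡⟨ pairing-ψ off t u ⟩
      trace (u * t)                        ≡⟨ tr ⟩
      0#                                   ≡⟨ zeroʳ _ ⟨
      l * m * 0#                           ∎)
      where open ≡-Reasoning

    -- With the coordinates of `P` absorbed into (A, B, C), the line is orthogonal to (t, t^q,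
    -- t^(q²)) and (s, s^q, s^(q²)). The cross product of these is (v^q, v^(q²), v) for v = moore t
    -- s, which is the triple of conjugates of v^q; eliminating A or B between the two incidences
    -- gives the proportionality.
    lineOf⇒Orb-dual : ∀ {ℓ} → LineOf (Orb P) ℓ → Orb (dual P) ℓ
    lineOf⇒Orb-dual {ℓ@(a , b , c)} (ℓ≢0 , Q , R , _ , _ , (t , t≢0 , Q∼) , (s , s≢0 , R∼) , Q≁R , Qℓ , Rℓ) =
      fr v , fr-≢0 v≢0 , v * inv C , *≢0 v≢0 (inv-≢0 C≢0) , triple-≡ (coordinate x≢0 kA) (coordinate y≢0 kB) (coordinate z≢0 kC)
      where
      open ≡-Reasoning
      x = proj₁ P
      y = proj₁ (proj₂ P)
      z = proj₂ (proj₂ P)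
      x≢0 = proj₁ off
      y≢0 = proj₁ (proj₂ off)
      z≢0 = proj₂ (proj₂ off)
      A = a * x
      B = b * y
      C = c * z
      v = moore t s
      v≢0 : v ≢ 0#
      v≢0 dep = Q≁R (∼-trans Q∼ (∼-trans (ψ-dependent t≢0 s≢0 dep P) (∼-sym R∼)))
      incidence : ∀ {Q t} → Q ∼ ψ t P → Inc Q ℓ → A * t + B * fr t + C * fr (fr t) ≡ 0#
      incidence {Q} {t} (l , _ , e) inc = begin
        A * t + B * fr t + C * fr (fr t)
          ≡⟨ solve 9 (λ a b c x y z t t' t'' → a ⊗ x ⊗ t ⊕ b ⊗ y ⊗ t' ⊕ c ⊗ z ⊗ t'' := a ⊗ (t ⊗ x) ⊕ b ⊗ (t' ⊗ y) ⊕ c ⊗ (t'' ⊗ z))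
               refl a b c x y z t (fr t) (fr (fr t)) ⟩
        pairing (ψ t P) ℓ                  ≡⟨ cong₂ pairing e (sym (scale-1 ℓ)) ⟩
        pairing (scale l Q) (scale 1# ℓ)   ≡⟨ pairing-scale l 1# Q ℓ ⟩
        l * 1# * pairing Q ℓ               ≡⟨ trans (cong (l * 1# *_) inc) (zeroʳ _) ⟩
        0#                                 ∎
      et = incidence Q∼ Qℓ
      es = incidence R∼ Rℓ
      v″≡ : fr (fr v) ≡ fr (fr t) * s - t * fr (fr s)
      v″≡ = trans (cong fr (fr-moore t s)) (trans (fr-- _ _) (cong₂ _-_
        (trans (fr-* _ _) (cong (fr (fr t) *_) (fr³ s))) (trans (fr-* _ _) (cong (_* fr (fr s)) (fr³ t)))))
      eliminate : ∀ α β {γ δ} → γ ≡ 0# → δ ≡ 0# → α * γ - β * δ ≡ 0#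
      eliminate α β refl refl = solve 2 (λ α β → α ⊗ :0 ⊕ ⊝ (β ⊗ :0) := :0) refl α β
      Bv : B * v ≡ C * fr (fr v)
      Bv = trans (-≡0⇒≡ (trans (solve 9 (λ A B C t t' t'' s s' s'' →
          B ⊗ (t ⊗ s' ⊕ ⊝ (t' ⊗ s)) ⊕ ⊝ (C ⊗ (t'' ⊗ s ⊕ ⊝ (t ⊗ s''))) :=
          t ⊗ (A ⊗ s ⊕ B ⊗ s' ⊕ C ⊗ s'') ⊕ ⊝ (s ⊗ (A ⊗ t ⊕ B ⊗ t' ⊕ C ⊗ t'')))
        refl A B C t (fr t) (fr (fr t)) s (fr s) (fr (fr s))) (eliminate t s es et))) (cong (C *_) (sym v″≡))
      Av : A * v ≡ C * fr v
      Av = trans (-≡0⇒≡ (trans (solve 9 (λ A B C t t' t'' s s' s'' →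
          A ⊗ (t ⊗ s' ⊕ ⊝ (t' ⊗ s)) ⊕ ⊝ (C ⊗ (t' ⊗ s'' ⊕ ⊝ (t'' ⊗ s'))) :=
          s' ⊗ (A ⊗ t ⊕ B ⊗ t' ⊕ C ⊗ t'') ⊕ ⊝ (t' ⊗ (A ⊗ s ⊕ B ⊗ s' ⊕ C ⊗ s'')))
        refl A B C t (fr t) (fr (fr t)) s (fr s) (fr (fr s))) (eliminate (fr s) (fr t) et es))) (cong (C *_) (sym (fr-moore t s)))
      factor-0 : ∀ {a x} → x ≢ 0# → a * x ≡ 0# → a ≡ 0#
      factor-0 x≢0 e = *-cancelʳ x≢0 (trans e (sym (zeroˡ _)))
      C≢0 : C ≢ 0#
      C≢0 C≡0 = ℓ≢0 ( factor-0 x≢0 (factor-0 v≢0 (trans Av (trans (cong (_* fr v) C≡0) (zeroˡ _))))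
                    , factor-0 y≢0 (factor-0 v≢0 (trans Bv (trans (cong (_* fr (fr v)) C≡0) (zeroˡ _))))
                    , factor-0 z≢0 C≡0)
      quotient : ∀ {A w} → A * v ≡ C * w → v * inv C * A ≡ w
      quotient {A} {w} e = begin
        v * inv C * A    ≡⟨ solve 3 (λ v i a → v ⊗ i ⊗ a := i ⊗ (a ⊗ v)) refl v (inv C) A ⟩
        inv C * (A * v)  ≡⟨ cong (inv C *_) e ⟩
        inv C * (C * w)  ≡⟨ *-assoc _ _ _ ⟨
        inv C * C * w    ≡⟨ cong (_* w) (*-inverseˡ C≢0) ⟩
        1# * w           ≡⟨ *-identityˡ w ⟩
        w                ∎
      kA : v * inv C * A ≡ fr v
      kA = quotient Av
      kB : v * inv C * B ≡ fr (fr v)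
      kB = quotient Bv
      kC : v * inv C * C ≡ fr (fr (fr v))
      kC = trans (quotient refl) (sym (fr³ v))
      coordinate : ∀ {x a w} → x ≢ 0# → v * inv C * (a * x) ≡ w → w * inv x ≡ v * inv C * a
      coordinate {x} {a} {w} x≢0 e = *-cancelʳ x≢0 (begin
        w * inv x * x           ≡⟨ *-assoc _ _ _ ⟩
        w * (inv x * x)         ≡⟨ trans (cong (w *_) (*-inverseˡ x≢0)) (*-identityʳ w) ⟩
        w                       ≡⟨ e ⟨
        v * inv C * (a * x)     ≡⟨ *-assoc _ _ _ ⟨
        v * inv C * a * x       ∎)

    -- A witness that the orbit has this line, through two points given by independent trace-zero
    -- elements. It allows a statement about all lines of the orbit to be evaluated at `dual P`.
    lineOf-dual : LineOf (Orb P) (dual P)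
    lineOf-dual = from-independent trace0-independent
      where
      from-independent : (∃ λ s₁ → ∃ λ s₂ → trace s₁ ≡ 0# × trace s₂ ≡ 0# × moore s₁ s₂ ≢ 0#) → LineOf (Orb P) (dual P)
      from-independent (s₁ , s₂ , e₁ , e₂ , m≢0) =
          offTriangle⇒nonZero (dual-off off) , ψ s₁ P , ψ s₂ P
        , offTriangle⇒nonZero (ψ-off (moore-≢0ˡ m≢0) off) , offTriangle⇒nonZero (ψ-off (moore-≢0ʳ m≢0) off)
        , ψ-Orb (moore-≢0ˡ m≢0) P , ψ-Orb (moore-≢0ʳ m≢0) P , (λ s₁∼s₂ → m≢0 (dependent-ψ off s₁∼s₂))
        , on-line e₁ , on-line e₂
        where
        on-line : ∀ {s} → trace s ≡ 0# → Inc (ψ s P) (dual P)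
        on-line {s} e = trace⇒Inc {u = 1#} ∼-refl (∼-reflexive (sym (ψ-1 _))) (trans (cong trace (*-identityˡ s)) e)

    private
      OnLine : Triple → Triple → Set
      OnLine ℓ Q = NonZeroT Q × Orb P Q × Inc Q ℓ

      -- The points of the orbit on the line ψ u P* are ψ (s/u) P with s of trace zero, so they
      -- correspond to the classes counted by `count-Trace0*`.
      lineSize : ∀ {ℓ} → Orb (dual P) ℓ → Exactly _∼_ (suc q) (OnLine ℓ)
      lineSize {ℓ} (u , u≢0 , ℓ∼) = count-map point point∈
          (λ _ _ r → unscale (dependent-ψ off r)) covers count-Trace0*
        where
        w = inv u
        w≢0 = inv-≢0 u≢0
        point : Carrier → Triple
        point s = ψ (s * w) P
        uw : ∀ s → u * (s * w) ≡ s
        uw s = trans (solve 3 (λ u s w → u ⊗ (s ⊗ w) := s ⊗ (u ⊗ w)) refl u s w) (trans (cong (s *_) (*-inverseʳ u≢0)) (*-identityʳ s))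
        uw′ : ∀ t → u * t * w ≡ t
        uw′ t = trans (*-assoc u t w) (uw t)
        point∈ : ∀ {s} → Trace0* s → OnLine ℓ (point s)
        point∈ {s} (s≢0 , tr) = offTriangle⇒nonZero (ψ-off (*≢0 s≢0 w≢0) off) , ψ-Orb (*≢0 s≢0 w≢0) P
          , trace⇒Inc ∼-refl ℓ∼ (trans (cong trace (uw s)) tr)
        unscale : ∀ {s t} → Dependent (s * w) (t * w) → Dependent s t
        unscale {s} {t} e = *-cancelˡ (*≢0 w≢0 (fr-≢0 w≢0)) (trans (sym (moore-scale w s t)) (trans e (sym (zeroʳ _))))
        covers : ∀ {Q} → OnLine ℓ Q → ∃ λ s → Trace0* s × (∀ {r} → Trace0* r → Dependent r s → point r ∼ Q)
        covers {Q} (_ , (t , t≢0 , Q∼) , inc) = u * t , (*≢0 u≢0 t≢0 , Inc⇒trace Q∼ ℓ∼ inc) , λ {r} (r≢0 , _) dep →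
          ∼-trans (ψ-dependent (*≢0 r≢0 w≢0) t≢0 (subst (Dependent (r * w)) (uw′ t)
            (trans (moore-scale w r (u * t)) (trans (cong (w * fr w *_) dep) (zeroʳ _)))) P) (∼-sym Q∼)

      -- For independent u and v, the element t = (moore u v)^q has trace zero against both, by the
      -- alternating form of `trace-fr-moore`. For dependent u and v the two lines coincide, and any
      -- orbit point on the first one serves.
      linesMeet : ∀ {ℓ m} → Orb (dual P) ℓ → Orb (dual P) m → ∃ λ Q → NonZeroT Q × Orb P Q × Inc Q ℓ × Inc Q m
      linesMeet {ℓ} {m} (u , u≢0 , ℓ∼) (v , v≢0 , m∼) = by-cases (moore u v ≟ 0#)
        where
        meet-at : ∀ {t} → t ≢ 0# → trace (u * t) ≡ 0# → trace (v * t) ≡ 0# → ∃ λ Q → NonZeroT Q × Orb P Q × Inc Q ℓ × Inc Q m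
        meet-at {t} t≢0 eu ev = ψ t P , offTriangle⇒nonZero (ψ-off t≢0 off) , ψ-Orb t≢0 P , trace⇒Inc ∼-refl ℓ∼ eu , trace⇒Inc ∼-refl m∼ ev
        by-cases : Dec (moore u v ≡ 0#) → ∃ λ Q → NonZeroT Q × Orb P Q × Inc Q ℓ × Inc Q m
        by-cases (no m≢0) = meet-at (fr-≢0 m≢0)
            (trans (trace-expand u) (solve 6 (λ u u' u'' v v' v'' →
               u ⊗ (u' ⊗ v'' ⊕ ⊝ (u'' ⊗ v')) ⊕ u' ⊗ (u'' ⊗ v ⊕ ⊝ (u ⊗ v'')) ⊕ u'' ⊗ (u ⊗ v' ⊕ ⊝ (u' ⊗ v)) := :0)
               refl u (fr u) (fr (fr u)) v (fr v) (fr (fr v))))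
            (trans (trace-expand v) (solve 6 (λ u u' u'' v v' v'' →
               v ⊗ (u' ⊗ v'' ⊕ ⊝ (u'' ⊗ v')) ⊕ v' ⊗ (u'' ⊗ v ⊕ ⊝ (u ⊗ v'')) ⊕ v'' ⊗ (u ⊗ v' ⊕ ⊝ (u' ⊗ v)) := :0)
               refl u (fr u) (fr (fr u)) v (fr v) (fr (fr v))))
          where
          trace-expand : ∀ a → trace (a * fr (moore u v)) ≡ a * (fr u * fr (fr v) - fr (fr u) * fr v)
                         + fr a * (fr (fr u) * v - u * fr (fr v)) + fr (fr a) * (u * fr v - fr u * v)
          trace-expand a = trace-fr-moore a u v
        by-cases (yes dep) = common (dependent⇒multiple u≢0 dep) trace0-independent
          where
          common : (∃ λ c → Fixed c × v ≡ c * u) → (∃ λ s₁ → ∃ λ s₂ → trace s₁ ≡ 0# × trace s₂ ≡ 0# × moore s₁ s₂ ≢ 0#) →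
                   ∃ λ Q → NonZeroT Q × Orb P Q × Inc Q ℓ × Inc Q m
          common (c , c′≡c , refl) (s , _ , tr , _ , m≢0) = meet-at (*≢0 (moore-≢0ˡ m≢0) (inv-≢0 u≢0))
            (trans (cong trace us) tr)
            (trans (cong trace (trans (*-assoc c u _) (cong (c *_) us))) (trans (trace-Fixed-* c′≡c s) (trans (cong (c *_) tr) (zeroʳ c))))
            where
            us : u * (s * inv u) ≡ s
            us = trans (solve 3 (λ u s w → u ⊗ (s ⊗ w) := s ⊗ (u ⊗ w)) refl u s (inv u)) (trans (cong (s *_) (*-inverseʳ u≢0)) (*-identityʳ s))

      det-orbit : ∀ r s t → det (ψ r P) (ψ s P) (ψ t P) ≡
                  proj₁ P * proj₁ (proj₂ P) * proj₂ (proj₂ P) * trace (t * fr (moore r s))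
      det-orbit r s t = trans
        (solve 12 (λ x y z r r' r'' s s' s'' t t' t'' →
          :det (r ⊗ x) (r' ⊗ y) (r'' ⊗ z) (s ⊗ x) (s' ⊗ y) (s'' ⊗ z) (t ⊗ x) (t' ⊗ y) (t'' ⊗ z) :=
          x ⊗ y ⊗ z ⊗ (t ⊗ (r' ⊗ s'' ⊕ ⊝ (r'' ⊗ s')) ⊕ t' ⊗ (r'' ⊗ s ⊕ ⊝ (r ⊗ s'')) ⊕ t'' ⊗ (r ⊗ s' ⊕ ⊝ (r' ⊗ s))))
          refl (proj₁ P) (proj₁ (proj₂ P)) (proj₂ (proj₂ P)) r (fr r) (fr (fr r)) s (fr s) (fr (fr s)) t (fr t) (fr (fr t)))
        (cong (proj₁ P * proj₁ (proj₂ P) * proj₂ (proj₂ P) *_) (sym (trace-fr-moore t r s)))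

      Quadrangle : Set
      Quadrangle = ∃ λ A → ∃ λ B → ∃ λ C → ∃ λ E →
          NonZeroT A × NonZeroT B × NonZeroT C × NonZeroT E
        × Orb P A × Orb P B × Orb P C × Orb P E
        × ¬ Collinear A B C × ¬ Collinear A B E × ¬ Collinear A C E × ¬ Collinear B C E

      -- For a basis a, b, c over F_q and e = a + b + c, the triple products of any three of the
      -- four elements are, up to sign, that of the basis. This is the standard frame carried into
      -- the orbit.
      quadrangle : Quadrangle
      quadrangle = from-independent trace0-independent
        where
        from-independent : (∃ λ s₁ → ∃ λ s₂ → trace s₁ ≡ 0# × trace s₂ ≡ 0# × moore s₁ s₂ ≢ 0#) → Quadrangle
        -- The q-polynomial in c is trace (c v^q) written out, with leading coefficient v = moore a
        -- b. A non-root therefore completes a, b to a basis.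
        from-independent (a , b , _ , _ , m≢0) = from-basis (linearised-non-root {a = v} (fr (fr v)) (fr v) m≢0)
          where
          v = moore a b
          triple-product : Carrier → Carrier → Carrier → Carrier
          triple-product r s t = trace (t * fr (moore r s))
          from-basis : (∃ λ c → v * fr (fr c) + fr (fr v) * fr c + fr v * c ≢ 0#) → Quadrangle
          from-basis (c , c≢) =
              ψ a P , ψ b P , ψ c P , ψ e P
            , non-zero (moore-≢0ˡ m≢0) , non-zero (moore-≢0ʳ m≢0) , non-zero c≢0 , non-zero e≢0
            , ψ-Orb (moore-≢0ˡ m≢0) P , ψ-Orb (moore-≢0ʳ m≢0) P , ψ-Orb c≢0 P , ψ-Orb e≢0 P
            , independent abc≢0 , independent abe≢0 , independent ace≢0 , independent bce≢0
            where
            e = a + b + c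
            fr-e : fr e ≡ fr a + fr b + fr c
            fr-e = trans (fr-+ _ c) (cong (_+ fr c) (fr-+ a b))
            fr²-e : fr (fr e) ≡ fr (fr a) + fr (fr b) + fr (fr c)
            fr²-e = trans (cong fr fr-e) (trans (fr-+ _ _) (cong (_+ fr (fr c)) (fr-+ _ _)))
            expand-e : ∀ r s → triple-product r s e ≡ (a + b + c) * (fr r * fr (fr s) - fr (fr r) * fr s)
                       + (fr a + fr b + fr c) * (fr (fr r) * s - r * fr (fr s)) + (fr (fr a) + fr (fr b) + fr (fr c)) * (r * fr s - fr r * s)
            expand-e r s = trans (trace-fr-moore e r s) (cong₂ (λ e′ e″ → e * (fr r * fr (fr s) - fr (fr r) * fr s)
                       + e′ * (fr (fr r) * s - r * fr (fr s)) + e″ * (r * fr s - fr r * s)) fr-e fr²-e)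
            :τ : ∀ {n} → (r r' r'' s s' s'' t t' t'' : Term n) → Term n
            :τ r r' r'' s s' s'' t t' t'' = t ⊗ (r' ⊗ s'' ⊕ ⊝ (r'' ⊗ s')) ⊕ t' ⊗ (r'' ⊗ s ⊕ ⊝ (r ⊗ s'')) ⊕ t'' ⊗ (r ⊗ s' ⊕ ⊝ (r' ⊗ s))
            abe : triple-product a b e ≡ triple-product a b c
            abe = trans (expand-e a b) (trans (solve 9 (λ a a' a'' b b' b'' c c' c'' →
              :τ a a' a'' b b' b'' (a ⊕ b ⊕ c) (a' ⊕ b' ⊕ c') (a'' ⊕ b'' ⊕ c'') := :τ a a' a'' b b' b'' c c' c'')
              refl a (fr a) (fr (fr a)) b (fr b) (fr (fr b)) c (fr c) (fr (fr c))) (sym (trace-fr-moore c a b)))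
            ace : triple-product a c e ≡ - triple-product a b c
            ace = trans (expand-e a c) (trans (solve 9 (λ a a' a'' b b' b'' c c' c'' →
              :τ a a' a'' c c' c'' (a ⊕ b ⊕ c) (a' ⊕ b' ⊕ c') (a'' ⊕ b'' ⊕ c'') := ⊝ :τ a a' a'' b b' b'' c c' c'')
              refl a (fr a) (fr (fr a)) b (fr b) (fr (fr b)) c (fr c) (fr (fr c))) (cong -_ (sym (trace-fr-moore c a b))))
            bce : triple-product b c e ≡ triple-product a b c
            bce = trans (expand-e b c) (trans (solve 9 (λ a a' a'' b b' b'' c c' c'' →
              :τ b b' b'' c c' c'' (a ⊕ b ⊕ c) (a' ⊕ b' ⊕ c') (a'' ⊕ b'' ⊕ c'') := :τ a a' a'' b b' b'' c c' c'')
              refl a (fr a) (fr (fr a)) b (fr b) (fr (fr b)) c (fr c) (fr (fr c))) (sym (trace-fr-moore c a b)))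
            abc≢0 : triple-product a b c ≢ 0#
            abc≢0 z = c≢ (trans (solve 6 (λ c c' c'' v v' v'' → v ⊗ c'' ⊕ v'' ⊗ c' ⊕ v' ⊗ c := c ⊗ v' ⊕ c' ⊗ v'' ⊕ c'' ⊗ v)
                refl c (fr c) (fr (fr c)) v (fr v) (fr (fr v)))
              (trans (cong₂ _+_ (cong (c * fr v +_) (sym (fr-* c (fr v))))
                (sym (trans (cong fr (fr-* c (fr v))) (trans (fr-* _ _) (cong (fr (fr c) *_) (fr³ v)))))) z))
            abe≢0 : triple-product a b e ≢ 0#
            abe≢0 z = abc≢0 (trans (sym abe) z)
            ace≢0 : triple-product a c e ≢ 0#
            ace≢0 z = abc≢0 (trans (solve 1 (λ x → x := ⊝ ⊝ x) refl _) (trans (cong -_ (trans (sym ace) z)) (solve 0 (⊝ :0 := :0) refl)))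
            bce≢0 : triple-product b c e ≢ 0#
            bce≢0 z = abc≢0 (trans (sym bce) z)
            trace-0 : ∀ {t w} → t ≡ 0# → trace (t * w) ≡ 0#
            trace-0 {t} {w} refl = trans (cong trace (zeroˡ w)) (trans (cong₂ (λ x y → 0# + x + y) fr-0 (trans (cong fr fr-0) fr-0))
              (solve 0 (:0 ⊕ :0 ⊕ :0 := :0) refl))
            c≢0 : c ≢ 0#
            c≢0 c≡0 = abc≢0 (trace-0 c≡0)
            e≢0 : e ≢ 0#
            e≢0 e≡0 = abe≢0 (trace-0 e≡0)
            non-zero : ∀ {t} → t ≢ 0# → NonZeroT (ψ t P)
            non-zero t≢0 = offTriangle⇒nonZero (ψ-off t≢0 off)
            independent : ∀ {r s t} → triple-product r s t ≢ 0# → ¬ Collinear (ψ r P) (ψ s P) (ψ t P)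
            independent {r} {s} {t} ≢0 z = *≢0 (*≢0 (*≢0 (proj₁ off) (proj₁ (proj₂ off))) (proj₂ (proj₂ off))) ≢0 (trans (sym (det-orbit r s t)) z)

    isFqPlane-Orb : IsFqPlane (Orb P)
    isFqPlane-Orb = record
      { lineSize   = λ ℓ L → lineSize (lineOf⇒Orb-dual L)
      ; linesMeet  = λ ℓ m L M → linesMeet (lineOf⇒Orb-dual L) (lineOf⇒Orb-dual M)
      ; quadrangle = quadrangle
      }

  isFqPlane-resp : ∀ {S S′ : PointSet} → (∀ {Q} → S Q → S′ Q) → (∀ {Q} → S′ Q → S Q) → IsFqPlane S → IsFqPlane S′
  isFqPlane-resp {S} {S′} to from plane = record
    { lineSize   = λ ℓ L → count-resp (λ (Q≢0 , s , inc) → Q≢0 , to s , inc) (λ (Q≢0 , s , inc) → Q≢0 , from s , inc)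
                                      (lineSize ℓ (lineOf L))
    ; linesMeet  = λ ℓ m L M → let Q , Q≢0 , s , incs = linesMeet ℓ m (lineOf L) (lineOf M) in Q , Q≢0 , to s , incs
    ; quadrangle = let A , B , C , E , A≢0 , B≢0 , C≢0 , E≢0 , a , b , c , e , independent = quadrangle
                   in A , B , C , E , A≢0 , B≢0 , C≢0 , E≢0 , to a , to b , to c , to e , independent
    }
    where
    open IsFqPlane plane
    lineOf : ∀ {ℓ} → LineOf S′ ℓ → LineOf S ℓ
    lineOf (ℓ≢0 , Q , R , Q≢0 , R≢0 , s , r , rest) = ℓ≢0 , Q , R , Q≢0 , R≢0 , from s , from r , rest

  -- Orbits on the sides of the triangle

  -- A choice of preimage under the norm; it is 0# (a junk value) on elements that are not norms.
  norm-section : Carrier → Carrier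
  norm-section c = choose (Any.any? (λ x → norm x ≟ c) elements)
    where
    choose : Dec (Any (λ x → norm x ≡ c) elements) → Carrier
    choose (yes ∃x) = proj₁ (Any.satisfied ∃x)
    choose (no _)   = 0#

  norm-norm-section : ∀ {c} → Fixed* c → norm (norm-section c) ≡ c
  norm-norm-section {c} c∈ with Any.any? (λ x → norm x ≟ c) elements
  ... | yes ∃x = proj₂ (Any.satisfied ∃x)
  ... | no ∄x  = let x , e = norm-surjective c∈ in contradiction (Any.map (λ { refl → e }) (complete x)) ∄x

  norm-≢0⁻ : ∀ {x} → norm x ≢ 0# → x ≢ 0#
  norm-≢0⁻ n≢0 = *≢0⇒ˡ (*≢0⇒ˡ n≢0)

  norm-section-≢0 : ∀ {c} → Fixed* c → norm-section c ≢ 0#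
  norm-section-≢0 c∈ = norm-≢0⁻ (λ e → proj₂ c∈ (trans (sym (norm-norm-section c∈)) e))

  norm-ratio : ∀ {x} y → x ≢ 0# → norm x * (norm y * inv (norm x)) ≡ norm y
  norm-ratio {x} y x≢0 = trans (solve 3 (λ a b i → a ⊗ (b ⊗ i) := b ⊗ (a ⊗ i)) refl (norm x) (norm y) (inv (norm x)))
    (trans (cong (norm y *_) (*-inverseʳ (norm-≢0 x≢0))) (*-identityʳ _))

  norm-ratio-Fixed* : ∀ {x y} → x ≢ 0# → y ≢ 0# → Fixed* (norm y * inv (norm x))
  norm-ratio-Fixed* {x} {y} x≢0 y≢0 =
      trans (fr-* _ _) (cong₂ _*_ (fr-norm y) (trans (fr-inv (norm x)) (cong inv (fr-norm x))))
    , *≢0 (norm-≢0 y≢0) (inv-≢0 (norm-≢0 x≢0))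

  -- By Hilbert 90 the norm of y / x is the only invariant of (x , y) under (x , y) ↦ (t x , t^q y) and scaling.
  match-ratio : ∀ {x y u v} → x ≢ 0# → y ≢ 0# → u ≢ 0# → v ≢ 0# → norm x * norm v ≡ norm u * norm y →
                ∃ λ s → ∃ λ t → s ≢ 0# × t ≢ 0# × t * x ≡ s * u × fr t * y ≡ s * v
  match-ratio {x} {y} {u} {v} x≢0 y≢0 u≢0 v≢0 norms = from-hilbert90 (hilbert90 norm-r≡1)
    where
    open ≡-Reasoning
    -- Eliminating t = s u / x from t^q y = s v leaves s^q = r s, an instance of Hilbert 90.
    r = (v * fr x) * inv (y * fr u)
    yu′≢0 : y * fr u ≢ 0#
    yu′≢0 = *≢0 y≢0 (fr-≢0 u≢0)
    norm-r≡1 : norm r ≡ 1#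
    norm-r≡1 = begin
      norm r
        ≡⟨ norm-* _ _ ⟩
      norm (v * fr x) * norm (inv (y * fr u))
        ≡⟨ cong (_* norm (inv (y * fr u))) (begin
             norm (v * fr x)      ≡⟨ trans (norm-* v _) (cong (norm v *_) (norm-fr x)) ⟩
             norm v * norm x      ≡⟨ trans (*-comm _ _) norms ⟩
             norm u * norm y      ≡⟨ *-comm _ _ ⟩
             norm y * norm u      ≡⟨ trans (norm-* y _) (cong (norm y *_) (norm-fr u)) ⟨
             norm (y * fr u)      ∎) ⟩
      norm (y * fr u) * norm (inv (y * fr u))
        ≡⟨ norm-inv yu′≢0 ⟩
      1# ∎
    from-hilbert90 : (∃ λ s → s ≢ 0# × fr s ≡ r * s) →
                     ∃ λ s → ∃ λ t → s ≢ 0# × t ≢ 0# × t * x ≡ s * u × fr t * y ≡ s * v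
    from-hilbert90 (s , s≢0 , s′≡rs) = s , t , s≢0 , t≢0 , tx≡ , *-cancelʳ (fr-≢0 x≢0) t′yx′≡
      where
      t = s * u * inv x
      t≢0 = *≢0 (*≢0 s≢0 u≢0) (inv-≢0 x≢0)
      tx≡ : t * x ≡ s * u
      tx≡ = trans (*-assoc _ _ x) (trans (cong (s * u *_) (*-inverseˡ x≢0)) (*-identityʳ _))
      t′yx′≡ : fr t * y * fr x ≡ s * v * fr x
      t′yx′≡ = begin
        fr t * y * fr x                ≡⟨ solve 3 (λ t y x → t ⊗ y ⊗ x := t ⊗ x ⊗ y) refl (fr t) y (fr x) ⟩
        fr t * fr x * y                ≡⟨ cong (_* y) (trans (sym (fr-* t x)) (trans (cong fr tx≡) (fr-* s u))) ⟩
        fr s * fr u * y                ≡⟨ cong (λ a → a * fr u * y) s′≡rs ⟩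
        r * s * fr u * y               ≡⟨ solve 6 (λ v x i s u y → v ⊗ x ⊗ i ⊗ s ⊗ u ⊗ y := s ⊗ v ⊗ x ⊗ (i ⊗ (y ⊗ u))) refl v (fr x) (inv (y * fr u)) s (fr u) y ⟩
        s * v * fr x * (inv (y * fr u) * (y * fr u)) ≡⟨ trans (cong (s * v * fr x *_) (*-inverseˡ yu′≢0)) (*-identityʳ _) ⟩
        s * v * fr x                   ∎

  norm-ratio-Orb : ∀ {x y z u v w} → Orb (x , y , z) (u , v , w) → norm x * norm v ≡ norm u * norm y
  norm-ratio-Orb {x} {y} {z} {u} {v} {w} (t , t≢0 , l , l≢0 , e) = *-cancelˡ (*≢0 (norm-≢0 t≢0) (norm-≢0 l≢0)) (begin
    norm t * norm l * (norm x * norm v)   ≡⟨ solve 4 (λ t l x v → t ⊗ l ⊗ (x ⊗ v) := (t ⊗ x) ⊗ (l ⊗ v)) refl (norm t) (norm l) (norm x) (norm v) ⟩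
    (norm t * norm x) * (norm l * norm v) ≡⟨ cong₂ _*_ first (sym second) ⟩
    (norm l * norm u) * (norm t * norm y) ≡⟨ solve 4 (λ t l x v → (l ⊗ x) ⊗ (t ⊗ v) := t ⊗ l ⊗ (x ⊗ v)) refl (norm t) (norm l) (norm u) (norm y) ⟩
    norm t * norm l * (norm u * norm y)   ∎)
    where
    open ≡-Reasoning
    first : norm t * norm x ≡ norm l * norm u
    first = trans (sym (norm-* t x)) (trans (cong norm (cong proj₁ e)) (norm-* l u))
    second : norm t * norm y ≡ norm l * norm v
    second = trans (cong (_* norm y) (sym (norm-fr t))) (trans (sym (norm-* _ y)) (trans (cong norm (cong (proj₁ ∘ proj₂) e)) (norm-* l v)))

  -- The linear part of φ. It permutes the sides cyclically and preserves both `Orb` and `D`, so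
  -- counting on the side opposite T is enough.
  rotate : Triple → Triple
  rotate (x , y , z) = z , x , y

  rotate-∼ : ∀ {P Q} → P ∼ Q → rotate P ∼ rotate Q
  rotate-∼ (l , l≢0 , e) = l , l≢0 , cong rotate e

  rotate-ψ : ∀ t P → rotate (ψ t P) ≡ ψ (fr (fr t)) (rotate P)
  rotate-ψ t (x , y , z) = triple-≡ refl (cong (_* x) (sym (fr³ t))) (cong (λ s → fr s * y) (sym (fr³ t)))

  rotate-Orb : ∀ {P Q} → Orb P Q → Orb (rotate P) (rotate Q)
  rotate-Orb {P} (t , t≢0 , Q∼) = fr (fr t) , fr-≢0 (fr-≢0 t≢0) , ∼-trans (rotate-∼ Q∼) (∼-reflexive (rotate-ψ t P))

  -- Three rotations are the identity by computation, so two further ones undo the first.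
  rotate-Orb⁻ : ∀ {P Q} → Orb (rotate P) (rotate Q) → Orb P Q
  rotate-Orb⁻ o = rotate-Orb (rotate-Orb o)

  D-rotate : ∀ P → D (rotate P) ≡ D P
  D-rotate P = det-rotate P (φ P) (φ (φ P))
    where
    det-rotate : ∀ P Q R → det (rotate P) (rotate Q) (rotate R) ≡ det P Q R
    det-rotate (a , b , c) (d , e , f) (g , h , i) = solve 9 (λ a b c d e f g h i → :det c a b f d e i g h := :det a b c d e f g h i)
      refl a b c d e f g h i

  next : Vertex → Vertex
  next vT   = vTφ
  next vTφ  = vTφ²
  next vTφ² = vT

  onSide-rotate : ∀ v {P} → OnSide v P → OnSide (next v) (rotate P)
  onSide-rotate vT   side = side
  onSide-rotate vTφ  side = side
  onSide-rotate vTφ² side = side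

  onSide⇒nonZero : ∀ v {P} → OnSide v P → NonZeroT P
  onSide⇒nonZero vT   (_ , x≢0 , _) (x≡0 , _)     = x≢0 x≡0
  onSide⇒nonZero vTφ  (_ , y≢0 , _) (_ , y≡0 , _) = y≢0 y≡0
  onSide⇒nonZero vTφ² (_ , z≢0 , _) (_ , _ , z≡0) = z≢0 z≡0

  onSide⇒¬typeI : ∀ v {P} → OnSide v P → ¬ PointTypeI P
  onSide⇒¬typeI vT   side@(z≡0 , _) I = proj₂ (proj₂ (coordinates-≢0 I (onSide⇒nonZero vT side))) z≡0
  onSide⇒¬typeI vTφ  side@(x≡0 , _) I = proj₁ (coordinates-≢0 I (onSide⇒nonZero vTφ side)) x≡0
  onSide⇒¬typeI vTφ² side@(y≡0 , _) I = proj₁ (proj₂ (coordinates-≢0 I (onSide⇒nonZero vTφ² side))) y≡0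

  count-sides : ∀ {k} {U : Triple → Set} → (∀ {P} → U P → U (rotate P)) →
                Count Orb k (λ P → OnSide vT P × U P) → ∀ v → Count Orb k (λ P → OnSide v P × U P)
  count-sides {k} {U} U-rotate #vT = sides
    where
    step : ∀ v → (∀ {P} → OnSide (next v) P → OnSide v (rotate (rotate P))) →
           Count Orb k (λ P → OnSide v P × U P) → Count Orb k (λ P → OnSide (next v) P × U P)
    step v back = count-map rotate (λ (side , u) → onSide-rotate v side , U-rotate u) (λ _ _ → rotate-Orb⁻)
      (λ {Q} (side , u) → rotate (rotate Q) , (back side , U-rotate (U-rotate u)) , λ _ → rotate-Orb)
    sides : ∀ v → Count Orb k (λ P → OnSide v P × U P)
    sides vT   = #vT
    sides vTφ  = step vT (λ side → side) #vT
    sides vTφ² = step vTφ (λ side → side) (step vT (λ side → side) #vT)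

  D-side : ∀ x y → D (x , y , 0#) ≡ norm x + norm y
  D-side x y = trans (D-expand x y 0#) (trans
    (cong₂ (λ a b → norm x + norm y + a - b) norm-0 (trans (cong trace mixed-0) trace-0))
    (solve 2 (λ a b → a ⊕ b ⊕ :0 ⊕ ⊝ :0 := a ⊕ b) refl (norm x) (norm y)))
    where
    norm-0 : norm 0# ≡ 0#
    norm-0 = trans (cong (_* fr (fr 0#)) (zeroˡ _)) (zeroˡ _)
    mixed-0 : mixed (x , y , 0#) ≡ 0#
    mixed-0 = trans (cong (x * fr y *_) (trans (cong fr fr-0) fr-0)) (zeroʳ _)
    trace-0 : trace 0# ≡ 0#
    trace-0 = trans (cong₂ (λ a b → 0# + a + b) fr-0 (trans (cong fr fr-0) fr-0)) (solve 0 (:0 ⊕ :0 ⊕ :0 := :0) refl)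

  side-Orb : ∀ {x y z u v w} → OnSide vT (x , y , z) → OnSide vT (u , v , w) → norm x * norm v ≡ norm u * norm y →
             Orb (x , y , z) (u , v , w)
  side-Orb {x} {y} {z} {u} {v} {w} (z≡0 , x≢0 , y≢0) (w≡0 , u≢0 , v≢0) norms = from-match (match-ratio x≢0 y≢0 u≢0 v≢0 norms)
    where
    from-match : (∃ λ s → ∃ λ t → s ≢ 0# × t ≢ 0# × t * x ≡ s * u × fr t * y ≡ s * v) → Orb (x , y , z) (u , v , w)
    from-match (s , t , s≢0 , t≢0 , e₁ , e₂) = t , t≢0 , s , s≢0 , triple-≡ e₁ e₂
      (trans (cong (fr (fr t) *_) z≡0) (trans (zeroʳ _) (sym (trans (cong (s *_) w≡0) (zeroʳ s)))))

  -1≢0 : - 1# ≢ 0#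
  -1≢0 e = 1≢0 (trans (solve 0 (:1 := ⊝ ⊝ :1) refl) (trans (cong -_ e) (solve 0 (⊝ :0 := :0) refl)))

  -1-Fixed* : Fixed* (- 1#)
  -1-Fixed* = trans (fr-neg 1#) (cong -_ fr-1) , -1≢0

  norm-ratio≡-1 : ∀ {x y} → x ≢ 0# → norm x + norm y ≡ 0# → norm y * inv (norm x) ≡ - 1#
  norm-ratio≡-1 {x} {y} x≢0 e = *-cancelˡ (norm-≢0 x≢0) (trans (norm-ratio y x≢0)
    (trans (solve 2 (λ a b → b := (a ⊕ b) ⊕ a ⊗ ⊝ :1) refl (norm x) (norm y)) (trans (cong (_+ norm x * - 1#) e) (+-identityˡ _))))

  sum≡0⇐ratio≡-1 : ∀ {x y} → x ≢ 0# → norm y * inv (norm x) ≡ - 1# → norm x + norm y ≡ 0#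
  sum≡0⇐ratio≡-1 {x} {y} x≢0 e = trans (cong (norm x +_) (trans (sym (norm-ratio y x≢0)) (cong (norm x *_) e)))
    (solve 1 (λ a → a ⊕ a ⊗ ⊝ :1 := :0) refl (norm x))

  private
    -- A representative of the orbits on z = 0 whose invariant N(y)/N(x) is c; by `match-ratio`
    -- these orbits are indexed by c in F_q*.
    sidePoint : Carrier → Triple
    sidePoint c = 1# , norm-section c , 0#

    sidePoint-onSide : ∀ {c} → Fixed* c → OnSide vT (sidePoint c)
    sidePoint-onSide c∈ = refl , 1≢0 , norm-section-≢0 c∈

    D-sidePoint : ∀ {c} → Fixed* c → D (sidePoint c) ≡ 1# + c
    D-sidePoint c∈ = trans (D-side _ _) (cong₂ _+_ norm-1 (norm-norm-section c∈))

    D-on-side : ∀ {x y z} → z ≡ 0# → D (x , y , z) ≡ norm x + norm y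
    D-on-side refl = D-side _ _

    sidePoint-Orb : ∀ {c x y z} → Fixed* c → OnSide vT (x , y , z) → c ≡ norm y * inv (norm x) → Orb (sidePoint c) (x , y , z)
    sidePoint-Orb {c} {x} {y} c∈ side c≡ = side-Orb (sidePoint-onSide c∈) side
      (trans (trans (cong (_* norm y) norm-1) (*-identityˡ _))
             (sym (trans (cong (norm x *_) (trans (norm-norm-section c∈) c≡)) (norm-ratio y (proj₁ (proj₂ side))))))

    sidePoint-injective : ∀ {c d} → Fixed* c → Fixed* d → Orb (sidePoint c) (sidePoint d) → c ≡ d
    sidePoint-injective c∈ d∈ o = sym (trans (sym (norm-norm-section d∈)) (trans
      (*-cancelˡ (norm-≢0 1≢0) (norm-ratio-Orb o)) (norm-norm-section c∈)))

  -- On z = 0 the determinant `D` is N(x) + N(y), so it vanishes precisely for the invariant -1.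
  -- That is one class out of q - 1, and the other q - 2 are of type III.
  count-side-II : ∀ v → Count Orb 1 (λ P → OnSide v P × D P ≡ 0#)
  count-side-II = count-sides (λ {P} → trans (D-rotate P)) (count-singleton (sidePoint (- 1#))
    (sidePoint-onSide -1-Fixed* , trans (D-sidePoint -1-Fixed*) (-‿inverseʳ 1#))
    (λ (side , D≡0) → sidePoint-Orb -1-Fixed* side (sym (norm-ratio≡-1 (proj₁ (proj₂ side)) (trans (sym (D-on-side (proj₁ side))) D≡0)))))

  count-side-III : ∀ v → Count Orb (q ℕ.∸ 2) (λ P → OnSide v P × D P ≢ 0#)
  count-side-III = count-sides (λ {P} D≢0 e → D≢0 (trans (sym (D-rotate P)) e)) (map-from
      (count-∖ sym trans (_≟ - 1#) (λ { refl t → t }) (λ { refl → -1-Fixed* }) count-Fixed* (count-singleton (- 1#) refl sym)))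
    where
    map-from : (∃ λ m → Count {Carrier} _≡_ m (λ c → Fixed* c × c ≢ - 1#) × q-1 ≡ 1 ℕ.+ m) →
               Count Orb (q ℕ.∸ 2) (λ P → OnSide vT P × D P ≢ 0#)
    map-from (m , #C , e) = subst (λ k → Count Orb k (λ P → OnSide vT P × D P ≢ 0#)) (sym (cong (ℕ._∸ 2) (trans q≡ (cong suc e))))
      (count-map sidePoint
        (λ (c∈ , c≢-1) → sidePoint-onSide c∈ , λ D≡0 → c≢-1 (trans (solve 1 (λ c → c := (:1 ⊕ c) ⊕ ⊝ :1) refl _)
           (trans (cong (_- 1#) (trans (sym (D-sidePoint c∈)) D≡0)) (+-identityˡ _))))
        (λ (c∈ , _) (d∈ , _) → sidePoint-injective c∈ d∈)
        (λ {P} (side@(z≡0 , x≢0 , y≢0) , D≢0) →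
            norm (proj₁ (proj₂ P)) * inv (norm (proj₁ P))
          , (norm-ratio-Fixed* x≢0 y≢0 , λ e′ → D≢0 (trans (D-on-side z≡0) (sum≡0⇐ratio≡-1 x≢0 e′)))
          , λ (c∈ , _) c≡ → sidePoint-Orb c∈ side c≡)
        #C)

  -- Orbits of type II points off the triangle

  cross : Triple → Triple → Triple
  cross (a , b , c) (x , y , z) = b * z - c * y , c * x - a * z , a * y - b * x

  private
    parallel₁ : ∀ {x y z u v w} → x ≢ 0# → NonZeroT (u , v , w) → x * v ≡ y * u → x * w ≡ z * u → (x , y , z) ∼ (u , v , w)
    parallel₁ {x} {y} {z} {u} {v} {w} x≢0 Q≢0 e₂ e₃ = l , l≢0 , triple-≡ u≡ (proportional e₂) (proportional e₃)
      where
      open ≡-Reasoning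
      l = u * inv x
      u≡ : u ≡ l * x
      u≡ = sym (trans (*-assoc _ _ _) (trans (cong (u *_) (*-inverseˡ x≢0)) (*-identityʳ u)))
      proportional : ∀ {v y} → x * v ≡ y * u → v ≡ l * y
      proportional {v} {y} e = *-cancelˡ x≢0 (begin
        x * v                ≡⟨ e ⟩
        y * u                ≡⟨ cong (y *_) u≡ ⟩
        y * (l * x)          ≡⟨ solve 3 (λ y l x → y ⊗ (l ⊗ x) := x ⊗ (l ⊗ y)) refl y l x ⟩
        x * (l * y)          ∎)
      l≢0 : l ≢ 0#
      l≢0 l≡0 = Q≢0 (vanish u≡ , vanish (proportional e₂) , vanish (proportional e₃))
        where
        vanish : ∀ {v y} → v ≡ l * y → v ≡ 0#
        vanish {v} {y} e = trans e (trans (cong (_* y) l≡0) (zeroˡ y))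

  parallel : ∀ {P Q} → NonZeroT P → NonZeroT Q → cross P Q ≡ (0# , 0# , 0#) → P ∼ Q
  parallel {x , y , z} {u , v , w} P≢0 Q≢0 e = by-cases (x ≟ 0#) (y ≟ 0#) (z ≟ 0#)
    where
    yw≡zv : y * w ≡ z * v
    yw≡zv = -≡0⇒≡ (cong proj₁ e)
    zu≡xw : z * u ≡ x * w
    zu≡xw = -≡0⇒≡ (cong (proj₁ ∘ proj₂) e)
    xv≡yu : x * v ≡ y * u
    xv≡yu = -≡0⇒≡ (cong (proj₂ ∘ proj₂) e)
    by-cases : Dec (x ≡ 0#) → Dec (y ≡ 0#) → Dec (z ≡ 0#) → (x , y , z) ∼ (u , v , w)
    by-cases (no x≢0) _ _ = parallel₁ x≢0 Q≢0 xv≡yu (sym zu≡xw)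
    by-cases _ (no y≢0) _ = rotate-∼ (parallel₁ y≢0 (λ (v≡0 , w≡0 , u≡0) → Q≢0 (u≡0 , v≡0 , w≡0)) yw≡zv (sym xv≡yu))
    by-cases _ _ (no z≢0) = rotate-∼ (rotate-∼ (parallel₁ z≢0 (λ (w≡0 , u≡0 , v≡0) → Q≢0 (u≡0 , v≡0 , w≡0)) zu≡xw (sym yw≡zv)))
    by-cases (yes x≡0) (yes y≡0) (yes z≡0) = contradiction (x≡0 , y≡0 , z≡0) P≢0

  φ-nonZero : ∀ {P} → NonZeroT P → NonZeroT (φ P)
  φ-nonZero {x , y , z} P≢0 (z′≡0 , x′≡0 , y′≡0) = P≢0 (back x′≡0 , back y′≡0 , back z′≡0)
    where
    back : ∀ {x} → fr x ≡ 0# → x ≡ 0#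
    back {x} x′≡0 with x ≟ 0#
    ... | yes x≡0 = x≡0
    ... | no x≢0  = contradiction x′≡0 (fr-≢0 x≢0)

  φ-cross : ∀ P Q → φ (cross P Q) ≡ cross (φ P) (φ Q)
  φ-cross (a , b , c) (x , y , z) = triple-≡ (minor a y b x) (minor b z c y) (minor c x a z)
    where
    minor : ∀ a y b x → fr (a * y - b * x) ≡ fr a * fr y - fr b * fr x
    minor a y b x = trans (fr-- _ _) (cong₂ _-_ (fr-* a y) (fr-* b x))

  -- The lines QR and PQ meet in Q, unless P, Q, R are collinear and the product vanishes. For P, φ
  -- P, φ² P the latter case shows that the line through P and φ P is mapped to itself by φ.
  cross-cross : ∀ P Q R → cross (cross Q R) (cross P Q) ≡ scale (- det P Q R) Q
  cross-cross (a , b , c) (d , e , f) (g , h , i) = triple-≡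
    (solve 9 (λ a b c d e f g h i →
        (f ⊗ g ⊕ ⊝ (d ⊗ i)) ⊗ (a ⊗ e ⊕ ⊝ (b ⊗ d)) ⊕ ⊝ ((d ⊗ h ⊕ ⊝ (e ⊗ g)) ⊗ (c ⊗ d ⊕ ⊝ (a ⊗ f)))
        := ⊝ :det a b c d e f g h i ⊗ d) refl a b c d e f g h i)
    (solve 9 (λ a b c d e f g h i →
        (d ⊗ h ⊕ ⊝ (e ⊗ g)) ⊗ (b ⊗ f ⊕ ⊝ (c ⊗ e)) ⊕ ⊝ ((e ⊗ i ⊕ ⊝ (f ⊗ h)) ⊗ (a ⊗ e ⊕ ⊝ (b ⊗ d)))
        := ⊝ :det a b c d e f g h i ⊗ e) refl a b c d e f g h i)
    (solve 9 (λ a b c d e f g h i →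
        (e ⊗ i ⊕ ⊝ (f ⊗ h)) ⊗ (c ⊗ d ⊕ ⊝ (a ⊗ f)) ⊕ ⊝ ((f ⊗ g ⊕ ⊝ (d ⊗ i)) ⊗ (b ⊗ f ⊕ ⊝ (c ⊗ e)))
        := ⊝ :det a b c d e f g h i ⊗ f) refl a b c d e f g h i)

  cross-incident : ∀ P Q → pairing P (cross P Q) ≡ 0#
  cross-incident (a , b , c) (x , y , z) = solve 6 (λ a b c x y z →
      (b ⊗ z ⊕ ⊝ (c ⊗ y)) ⊗ a ⊕ (c ⊗ x ⊕ ⊝ (a ⊗ z)) ⊗ b ⊕ (a ⊗ y ⊕ ⊝ (b ⊗ x)) ⊗ c := :0)
    refl a b c x y z

  -- The line joining P, φ P and φ² P is fixed by φ, hence is a line of P2q.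
  line-through-typeII : ∀ {P} → NonZeroT P → D P ≡ 0# → ¬ PointTypeI P →
                        ∃ λ u → u ≢ 0# × pairing P (u , fr u , fr (fr u)) ≡ 0#
  line-through-typeII {P} P≢0 D≡0 ¬I = from-P2q (typeI⇒P2q ℓ≢0 φℓ∼ℓ)
    where
    ℓ = cross P (φ P)
    ℓ≢0 : NonZeroT ℓ
    ℓ≢0 (e₁ , e₂ , e₃) = ¬I (∼-sym (parallel P≢0 (φ-nonZero P≢0) (triple-≡ e₁ e₂ e₃)))
    φℓ∼ℓ : φ ℓ ∼ ℓ
    φℓ∼ℓ = parallel (φ-nonZero ℓ≢0) ℓ≢0 (trans (cong (λ m → cross m ℓ) (φ-cross P (φ P)))
      (trans (cross-cross P (φ P) (φ (φ P))) (triple-≡ (vanish _) (vanish _) (vanish _))))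
      where
      vanish : ∀ x → - D P * x ≡ 0#
      vanish x = trans (cong (λ d → - d * x) D≡0) (solve 1 (λ x → ⊝ :0 ⊗ x := :0) refl x)
    from-P2q : P2q ℓ → ∃ λ u → u ≢ 0# × pairing P (u , fr u , fr (fr u)) ≡ 0#
    from-P2q (u , u≢0 , k , _ , e) = u , u≢0 , (begin
      pairing P (u , fr u , fr (fr u))        ≡⟨ cong₂ pairing (sym (scale-1 P)) e ⟩
      pairing (scale 1# P) (scale k ℓ)        ≡⟨ pairing-scale 1# k P ℓ ⟩
      1# * k * pairing P ℓ                    ≡⟨ trans (cong (1# * k *_) (cross-incident P (φ P))) (zeroʳ _) ⟩
      0#                                      ∎)
      where open ≡-Reasoning

  -- The points (1 , y , - (1 + y)) lie on the line [1,1,1] of P2q; those with Bad y are the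
  -- points of that line in P2q.
  Bad : Carrier → Set
  Bad y = 1# + y + y * fr y ≡ 0#

  onUnitLine : Carrier → Triple
  onUnitLine y = 1# , y , - (1# + y)

  -- With b = 1 + y + y^(q+1) one has N(y) - 1 = y b^q - b, and both b and b^q vanish.
  bad⇒norm≡1 : ∀ {y} → Bad y → norm y ≡ 1#
  bad⇒norm≡1 {y} bad = begin
    y * fr y * fr (fr y)
      ≡⟨ solve 3 (λ y y' y'' → y ⊗ y' ⊗ y'' := y ⊗ (:1 ⊕ y' ⊕ y' ⊗ y'') ⊕ ⊝ (:1 ⊕ y ⊕ y ⊗ y') ⊕ :1) refl y (fr y) (fr (fr y)) ⟩
    y * (1# + fr y + fr y * fr (fr y)) - (1# + y + y * fr y) + 1#
      ≡⟨ cong₂ (λ a b → y * a - b + 1#) bad′ bad ⟩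
    y * 0# - 0# + 1#
      ≡⟨ solve 1 (λ y → y ⊗ :0 ⊕ ⊝ :0 ⊕ :1 := :1) refl y ⟩
    1# ∎
    where
    open ≡-Reasoning
    bad′ : 1# + fr y + fr y * fr (fr y) ≡ 0#
    bad′ = trans (sym (trans (fr-+ _ _) (cong₂ _+_ (trans (fr-+ 1# y) (cong (_+ fr y) fr-1)) (fr-* y (fr y))))) (trans (cong fr bad) fr-0)

  -- The map s ↦ s^q / s induces a bijection from classes of trace-zero elements: if s^q = y s, then
  -- the trace of s is s (1 + y + y^(q+1)). Hilbert 90 provides s for every solution y.
  count-Bad : Count {Carrier} _≡_ (suc q) Bad
  count-Bad = count-map ratio ratio∈ injective covers count-Trace0*
    where
    open ≡-Reasoning
    ratio : Carrier → Carrier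
    ratio s = fr s * inv s
    ratio-* : ∀ {s} → s ≢ 0# → fr s ≡ ratio s * s
    ratio-* {s} s≢0 = sym (trans (*-assoc _ _ _) (trans (cong (fr s *_) (*-inverseˡ s≢0)) (*-identityʳ _)))
    trace-ratio : ∀ {s y} → fr s ≡ y * s → trace s ≡ s * (1# + y + y * fr y)
    trace-ratio {s} {y} e = begin
      s + fr s + fr (fr s)              ≡⟨ cong (λ a → s + a + fr a) e ⟩
      s + y * s + fr (y * s)            ≡⟨ cong (s + y * s +_) (trans (fr-* y s) (cong (fr y *_) e)) ⟩
      s + y * s + fr y * (y * s)        ≡⟨ solve 3 (λ s y y' → s ⊕ y ⊗ s ⊕ y' ⊗ (y ⊗ s) := s ⊗ (:1 ⊕ y ⊕ y ⊗ y')) refl s y (fr y) ⟩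
      s * (1# + y + y * fr y)           ∎
    ratio∈ : ∀ {s} → Trace0* s → Bad (ratio s)
    ratio∈ (s≢0 , tr) = *-cancelˡ s≢0 (trans (sym (trace-ratio (ratio-* s≢0))) (trans tr (sym (zeroʳ _))))
    injective : ∀ {s r} → Trace0* s → Trace0* r → ratio s ≡ ratio r → Dependent s r
    injective {s} {r} (s≢0 , _) (r≢0 , _) e = begin
      s * fr r - fr s * r                    ≡⟨ cong₂ (λ a b → s * a - b * r) (ratio-* r≢0) (trans (ratio-* s≢0) (cong (_* s) e)) ⟩
      s * (ratio r * r) - ratio r * s * r    ≡⟨ solve 3 (λ s y r → s ⊗ (y ⊗ r) ⊕ ⊝ (y ⊗ s ⊗ r) := :0) refl s (ratio r) r ⟩
      0#                                     ∎
    covers : ∀ {y} → Bad y → ∃ λ s → Trace0* s × (∀ {r} → Trace0* r → Dependent r s → ratio r ≡ y)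
    covers {y} bad = let s , s≢0 , s′≡ys = hilbert90 (bad⇒norm≡1 bad) in
      s , (s≢0 , trans (trace-ratio s′≡ys) (trans (cong (s *_) bad) (zeroʳ s))) , λ {r} (r≢0 , _) dep →
        *-cancelʳ r≢0 (*-cancelʳ s≢0 (begin
          ratio r * r * s    ≡⟨ cong (_* s) (ratio-* r≢0) ⟨
          fr r * s           ≡⟨ -≡0⇒≡ dep ⟨
          r * fr s           ≡⟨ cong (r *_) s′≡ys ⟩
          r * (y * s)        ≡⟨ solve 3 (λ r y s → r ⊗ (y ⊗ s) := y ⊗ r ⊗ s) refl r y s ⟩
          y * r * s          ∎))

  -- The values 0 and -1 give the points of [1,1,1] on two sides of the triangle. Its point (0, 1,
  -- -1) on the third side has no parameter y, so only two values are removed here besides the q + 1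
  -- bad ones.
  Good : Carrier → Set
  Good y = y ≢ 0# × 1# + y ≢ 0# × ¬ Bad y

  count-Good : ∃ λ m → Count {Carrier} _≡_ m Good × q ℕ.^ 3 ≡ 3 ℕ.+ q ℕ.+ m
  count-Good = remove-0 count-≢0
    where
    remove-0 : (∃ λ n → Count {Carrier} _≡_ n (_≢ 0#) × order ≡ suc n) → ∃ λ m → Count {Carrier} _≡_ m Good × q ℕ.^ 3 ≡ 3 ℕ.+ q ℕ.+ m
    remove-0 (n₁ , #≢0 , e₁) = remove-1 (count-∖ sym trans {T = λ y → 1# + y ≡ 0#} (λ y → (1# + y) ≟ 0#) (λ { refl t → t }) -1∈ #≢0
        (count-singleton (- 1#) (-‿inverseʳ 1#) λ {y} e → sym (trans (solve 1 (λ y → y := (:1 ⊕ y) ⊕ ⊝ :1) refl y) (trans (cong (_- 1#) e) (+-identityˡ _)))))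
      where
      -1∈ : ∀ {y} → 1# + y ≡ 0# → y ≢ 0#
      -1∈ e refl = 1≢0 (trans (sym (+-identityʳ 1#)) e)
      remove-1 : (∃ λ n → Count {Carrier} _≡_ n (λ y → y ≢ 0# × 1# + y ≢ 0#) × n₁ ≡ 1 ℕ.+ n) →
                 ∃ λ m → Count {Carrier} _≡_ m Good × q ℕ.^ 3 ≡ 3 ℕ.+ q ℕ.+ m
      remove-1 (n₂ , #₂ , e₂) = remove-Bad (count-∖ sym trans {T = Bad} (λ y → (1# + y + y * fr y) ≟ 0#) (λ { refl t → t }) bad∈ #₂ count-Bad)
        where
        bad∈ : ∀ {y} → Bad y → y ≢ 0# × 1# + y ≢ 0#
        bad∈ {y} bad = y≢0 , λ e → *≢0 y≢0 (fr-≢0 y≢0) (trans (solve 2 (λ a b → b := (a ⊕ b) ⊕ ⊝ a) refl (1# + y) (y * fr y))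
          (trans (cong₂ _-_ bad e) (solve 0 (:0 ⊕ ⊝ :0 := :0) refl)))
          where
          y≢0 : y ≢ 0#
          y≢0 = λ y≡0 → 1≢0 (trans (sym (bad⇒norm≡1 bad)) (trans (cong (λ a → a * fr y * fr (fr y)) y≡0) (trans (cong (_* fr (fr y)) (zeroˡ _)) (zeroˡ _))))
        remove-Bad : (∃ λ m → Count {Carrier} _≡_ m (λ y → (y ≢ 0# × 1# + y ≢ 0#) × ¬ Bad y) × n₂ ≡ suc q ℕ.+ m) →
                     ∃ λ m → Count {Carrier} _≡_ m Good × q ℕ.^ 3 ≡ 3 ℕ.+ q ℕ.+ m
        remove-Bad (m , #m , e₃) = m , count-resp (λ ((a , b) , c) → a , b , c) (λ (a , b , c) → (a , b) , c) #m
          , trans (sym order≡q³) (trans e₁ (cong suc (trans e₂ (cong suc e₃))))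

  private
    fr-third : ∀ y → fr (- (1# + y)) ≡ - (1# + fr y)
    fr-third y = trans (fr-neg _) (cong -_ (trans (fr-+ 1# y) (cong (_+ fr y) fr-1)))

    neg-≢0 : ∀ {x} → x ≢ 0# → - x ≢ 0#
    neg-≢0 {x} x≢0 e = x≢0 (trans (solve 1 (λ x → x := ⊝ ⊝ x) refl x) (trans (cong -_ e) (solve 0 (⊝ :0 := :0) refl)))

    neg-≢0⁻ : ∀ {x} → - x ≢ 0# → x ≢ 0#
    neg-≢0⁻ -x≢0 refl = -x≢0 (solve 0 (⊝ :0 := :0) refl)

  onUnitLine-D : ∀ y → D (onUnitLine y) ≡ 0#
  onUnitLine-D y = trans
    (cong₂ (det (onUnitLine y)) (triple-≡ (fr-third y) fr-1 refl)
      (triple-≡ refl (trans (cong fr (fr-third y)) (fr-third (fr y))) (trans (cong fr fr-1) fr-1)))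
    (solve 3 (λ y y' y'' → :det :1 y (⊝ (:1 ⊕ y)) (⊝ (:1 ⊕ y')) :1 y' y'' (⊝ (:1 ⊕ y'')) :1 := :0) refl y (fr y) (fr (fr y)))

  typeI⇒bad : ∀ {y} → PointTypeI (onUnitLine y) → Bad y
  typeI⇒bad {y} (l , _ , e) = begin
    1# + y + y * fr y        ≡⟨ solve 2 (λ y y' → :1 ⊕ y ⊕ y ⊗ y' := :1 ⊕ ⊝ (y ⊗ ⊝ (:1 ⊕ y'))) refl y (fr y) ⟩
    1# - y * - (1# + fr y)   ≡⟨ cong (λ a → 1# - a) (sym 1≡) ⟩
    1# - 1#                  ≡⟨ -‿inverseʳ 1# ⟩
    0#                       ∎
    where
    open ≡-Reasoning
    l≡y : l ≡ y
    l≡y = sym (trans (cong (proj₁ ∘ proj₂) e) (trans (cong (l *_) fr-1) (*-identityʳ l)))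
    1≡ : 1# ≡ y * - (1# + fr y)
    1≡ = trans (cong proj₁ e) (cong₂ _*_ l≡y (fr-third y))

  bad⇒typeI : ∀ {y} → y ≢ 0# → Bad y → PointTypeI (onUnitLine y)
  bad⇒typeI {y} y≢0 bad = y , y≢0 , triple-≡
    (sym (trans (cong (y *_) (fr-third y)) (trans (solve 2 (λ y y' → y ⊗ ⊝ (:1 ⊕ y') := :1 ⊕ ⊝ (:1 ⊕ y ⊕ y ⊗ y')) refl y (fr y))
      (trans (cong (λ a → 1# - a) bad) (solve 0 (:1 ⊕ ⊝ :0 := :1) refl)))))
    (sym (trans (cong (y *_) fr-1) (*-identityʳ y)))
    (sym (trans (solve 2 (λ y y' → y ⊗ y' := (:1 ⊕ y ⊕ y ⊗ y') ⊕ ⊝ (:1 ⊕ y)) refl y (fr y)) (trans (cong (_- (1# + y)) bad) (+-identityˡ _))))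

  off-Orb : ∀ {P Q} → Orb P Q → OffTriangle P → OffTriangle Q
  off-Orb (t , t≢0 , l , _ , e) off = let a , b , c = ψ-off t≢0 off in
      *≢0⇒ʳ (λ z → a (trans (cong proj₁ e) z)) , *≢0⇒ʳ (λ z → b (trans (cong (proj₁ ∘ proj₂) e) z))
    , *≢0⇒ʳ (λ z → c (trans (cong (proj₂ ∘ proj₂) e) z))

  TypeIIOff : Triple → Set
  TypeIIOff P = OffTriangle P × PointTypeII P

  private
    good⇒TypeIIOff : ∀ {y} → Good y → TypeIIOff (onUnitLine y)
    good⇒TypeIIOff {y} (y≢0 , 1+y≢0 , ¬bad) = (1≢0 , y≢0 , neg-≢0 1+y≢0) , (λ I → ¬bad (typeI⇒bad I)) , onUnitLine-D y

    -- A point of type II lies on only one line of P2q, so ψ t can map onUnitLine y to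
    -- another point of [1,1,1] only if it fixes that line.
    onUnitLine-injective : ∀ {y r} → Good y → Good r → Orb (onUnitLine y) (onUnitLine r) → y ≡ r
    onUnitLine-injective {y} {r} (_ , _ , ¬bad) _ (t , t≢0 , l , _ , e) = by-cases (fr t ≟ t)
      where
      open ≡-Reasoning
      t≡l : t ≡ l
      t≡l = trans (sym (*-identityʳ t)) (trans (cong proj₁ e) (*-identityʳ l))
      t′y≡lr : fr t * y ≡ l * r
      t′y≡lr = cong (proj₁ ∘ proj₂) e
      t″z≡lw : fr (fr t) * - (1# + y) ≡ l * - (1# + r)
      t″z≡lw = cong (proj₂ ∘ proj₂) e
      -- The point with parameter y lies on [1,1,1] and on [t, t^q, t^(q²)], whose cross product is
      -- (v^q, v^(q²), v). If v is nonzero the lines differ and the point is this one, which belongs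
      -- to P2q; the trace of v being zero then reads `Bad y`.
      v = fr t - t
      v′≡ : fr v ≡ fr (fr t) - fr t
      v′≡ = fr-- _ _
      v″≡ : fr (fr v) ≡ t - fr (fr t)
      v″≡ = trans (cong fr v′≡) (trans (fr-- _ _) (cong (_- fr (fr t)) (fr³ t)))
      incident : t + fr t * y + fr (fr t) * - (1# + y) ≡ 0#
      incident = trans (cong₂ _+_ (cong₂ _+_ t≡l t′y≡lr) t″z≡lw) (solve 2 (λ l r → l ⊕ l ⊗ r ⊕ l ⊗ ⊝ (:1 ⊕ r) := :0) refl l r)
      yv′≡v″ : y * fr v ≡ fr (fr v)
      yv′≡v″ = begin
        y * fr v                                                       ≡⟨ cong (y *_) v′≡ ⟩
        y * (fr (fr t) - fr t)
          ≡⟨ solve 4 (λ y t t' t'' → y ⊗ (t'' ⊕ ⊝ t') := (t ⊕ ⊝ t'') ⊕ ⊝ (t ⊕ t' ⊗ y ⊕ t'' ⊗ ⊝ (:1 ⊕ y))) refl y t (fr t) (fr (fr t)) ⟩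
        t - fr (fr t) - (t + fr t * y + fr (fr t) * - (1# + y))        ≡⟨ cong₂ _-_ (sym v″≡) incident ⟩
        fr (fr v) - 0#                                                 ≡⟨ solve 1 (λ v → v ⊕ ⊝ :0 := v) refl (fr (fr v)) ⟩
        fr (fr v)                                                      ∎
      y′v″≡v : fr y * fr (fr v) ≡ v
      y′v″≡v = trans (sym (fr-* _ _)) (trans (cong fr yv′≡v″) (fr³ v))
      by-cases : Dec (fr t ≡ t) → y ≡ r
      by-cases (yes t′≡t) = *-cancelˡ t≢0 (trans (cong (_* y) (sym t′≡t)) (trans t′y≡lr (cong (_* r) (sym t≡l))))
      by-cases (no t′≢t) = contradiction (*-cancelʳ (fr-≢0 (λ v≡0 → t′≢t (-≡0⇒≡ v≡0))) (begin
        (1# + y + y * fr y) * fr v            ≡⟨ solve 3 (λ y y' v' → (:1 ⊕ y ⊕ y ⊗ y') ⊗ v' := v' ⊕ y ⊗ v' ⊕ y' ⊗ (y ⊗ v')) refl y (fr y) (fr v) ⟩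
        fr v + y * fr v + fr y * (y * fr v)   ≡⟨ cong (λ a → fr v + a + fr y * a) yv′≡v″ ⟩
        fr v + fr (fr v) + fr y * fr (fr v)   ≡⟨ cong (fr v + fr (fr v) +_) y′v″≡v ⟩
        fr v + fr (fr v) + v                  ≡⟨ solve 3 (λ a b c → b ⊕ c ⊕ a := a ⊕ b ⊕ c) refl v (fr v) (fr (fr v)) ⟩
        trace v                               ≡⟨ trace-v ⟩
        0#                                    ≡⟨ zeroˡ _ ⟨
        0# * fr v                             ∎)) ¬bad
        where
        trace-v : trace v ≡ 0#
        trace-v = trans (cong₂ (λ a b → v + a + b) v′≡ v″≡)
          (solve 3 (λ t t' t'' → (t' ⊕ ⊝ t) ⊕ (t'' ⊕ ⊝ t') ⊕ (t ⊕ ⊝ t'') := :0) refl t (fr t) (fr (fr t)))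

    -- If [u, u^q, u^(q²)] is a line of P2q through P, then ψ u carries P to a point of [1,1,1],
    -- since the incidence equation is exactly that the coordinates of ψ u P sum to zero.
    toUnitLine : ∀ {P} → TypeIIOff P → ∃ λ y → Good y × Orb (onUnitLine y) P
    toUnitLine {P@(x , y , z)} (off , ¬I , D≡0) = from-line (line-through-typeII (offTriangle⇒nonZero off) D≡0 ¬I)
      where
      from-line : (∃ λ u → u ≢ 0# × pairing P (u , fr u , fr (fr u)) ≡ 0#) → ∃ λ y → Good y × Orb (onUnitLine y) P
      from-line (u , u≢0 , inc) = y₀ , (proj₁ (proj₂ off₀) , neg-≢0⁻ (proj₂ (proj₂ off₀)) , ¬bad) , Orb-sym o
        where
        open ≡-Reasoning
        a = u * x
        b = fr u * y
        c = fr (fr u) * z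
        a≢0 : a ≢ 0#
        a≢0 = *≢0 u≢0 (proj₁ off)
        y₀ = b * inv a
        a1 : a ≡ a * 1#
        a1 = sym (*-identityʳ a)
        ay₀ : b ≡ a * y₀
        ay₀ = sym (trans (solve 3 (λ a b i → a ⊗ (b ⊗ i) := b ⊗ (a ⊗ i)) refl a b (inv a)) (trans (cong (b *_) (*-inverseʳ a≢0)) (*-identityʳ b)))
        az₀ : c ≡ a * - (1# + y₀)
        az₀ = begin
          c                     ≡⟨ solve 3 (λ a b c → c := (a ⊕ b ⊕ c) ⊕ ⊝ (a ⊕ b)) refl a b c ⟩
          a + b + c - (a + b)   ≡⟨ cong₂ _-_ inc (cong (a +_) ay₀) ⟩
          0# - (a + a * y₀)     ≡⟨ solve 2 (λ a y → :0 ⊕ ⊝ (a ⊕ a ⊗ y) := a ⊗ ⊝ (:1 ⊕ y)) refl a y₀ ⟩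
          a * - (1# + y₀)       ∎
        o : Orb P (onUnitLine y₀)
        o = u , u≢0 , a , a≢0 , triple-≡ a1 ay₀ az₀
        off₀ : OffTriangle (onUnitLine y₀)
        off₀ = off-Orb o off
        ¬bad : ¬ Bad y₀
        ¬bad bad = ¬I (typeI-Orb (Orb-sym o) (bad⇒typeI (proj₁ (proj₂ off₀)) bad))

  count-TypeIIOff : ∃ λ m → Count Orb m TypeIIOff × q ℕ.^ 3 ≡ 3 ℕ.+ q ℕ.+ m
  count-TypeIIOff = let m , #Good , e = count-Good in
      m , count-map onUnitLine good⇒TypeIIOff onUnitLine-injective
            (λ ii → let y , good , o = toUnitLine ii in y , good , λ { _ refl → o }) #Good
    , e

  -- The classification

  unitPoint : Triple
  unitPoint = 1# , 1# , 1#

  unitPoint-off : OffTriangle unitPoint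
  unitPoint-off = 1≢0 , 1≢0 , 1≢0

  unitPoint-typeI : PointTypeI unitPoint
  unitPoint-typeI = ∼-reflexive (triple-≡ fr-1 fr-1 fr-1)

  ψ-unitPoint : ∀ t → ψ t unitPoint ≡ (t , fr t , fr (fr t))
  ψ-unitPoint t = triple-≡ (*-identityʳ _) (*-identityʳ _) (*-identityʳ _)

  Orb⇒P2q : ∀ {Q} → Orb unitPoint Q → P2q Q
  Orb⇒P2q (t , t≢0 , Q∼) = t , t≢0 , ∼-trans Q∼ (∼-reflexive (ψ-unitPoint t))

  P2q⇒Orb : ∀ {Q} → P2q Q → Orb unitPoint Q
  P2q⇒Orb (t , t≢0 , Q∼) = t , t≢0 , ∼-trans Q∼ (∼-reflexive (sym (ψ-unitPoint t)))

  P2q⇒typeI : ∀ {Q} → P2q Q → PointTypeI Q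
  P2q⇒typeI s = typeI-Orb (P2q⇒Orb s) unitPoint-typeI

  -- U and V are each the vanishing or the non-vanishing of D: U P fixes the type of the points
  -- of Orb P, and V (dual P) that of its lines.
  record Char (U V : Triple → Set) (P : Triple) : Set where
    constructor char
    field
      off    : OffTriangle P
      points : U P
      lines  : V (dual P)

  Flat Spanning : Triple → Set
  Flat P = D P ≡ 0#
  Spanning P = D P ≢ 0#

  flat-Orb : ∀ {P Q} → Orb P Q → Flat Q → Flat P
  flat-Orb o = D≡0-Orb (Orb-sym o)

  spanning-Orb : ∀ {P Q} → Orb P Q → Spanning Q → Spanning P
  spanning-Orb o D≢0 e = D≢0 (D≡0-Orb o e)

  off? : Decidable OffTriangle
  off? (x , y , z) = ¬? (x ≟ 0#) ×-dec ¬? (y ≟ 0#) ×-dec ¬? (z ≟ 0#)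

  flat? : Decidable Flat
  flat? P = D P ≟ 0#

  spanning? : Decidable Spanning
  spanning? P = ¬? (flat? P)

  char? : ∀ {U V} → Decidable U → Decidable V → Decidable (Char U V)
  char? U? V? P = map′ (λ (off , u , v) → char off u v) (λ (char off u v) → off , u , v)
    (off? P ×-dec U? P ×-dec V? (dual P))

  char-Orb : ∀ {U V} → (∀ {P Q} → Orb P Q → U Q → U P) → (∀ {P Q} → Orb P Q → V Q → V P) →
             ∀ {P Q} → Orb P Q → Char U V Q → Char U V P
  char-Orb U-Orb V-Orb o (char off u v) = char (off-Orb (Orb-sym o) off) (U-Orb o u) (V-Orb (dual-Orb o) v)

  dual-Orb⁻ : ∀ {P Q} → Orb (dual P) (dual Q) → Orb P Q
  dual-Orb⁻ {P} {Q} o = subst₂ Orb (dual-involutive P) (dual-involutive Q) (dual-Orb o)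

  TypeIIOff⇒char : ∀ {P} → TypeIIOff P → Char Flat Spanning P
  TypeIIOff⇒char (off , ¬I , D≡0) = char off D≡0 λ D*≡0 → ¬I (D≡0⇒typeI off D≡0 D*≡0)

  char⇒TypeIIOff : ∀ {P} → Char Flat Spanning P → TypeIIOff P
  char⇒TypeIIOff (char off D≡0 D*≢0) = off , (λ I → D*≢0 (typeI⇒D≡0 (dual-typeI I))) , D≡0

  dual-char : ∀ {U V P} → Char U V P → Char V U (dual P)
  dual-char {U} {P = P} (char off u v) = char (dual-off off) v (subst U (sym (dual-involutive P)) u)

  count-FlatSpanning : ∃ λ m → Count Orb m (Char Flat Spanning) × q ℕ.^ 3 ≡ 3 ℕ.+ q ℕ.+ m
  count-FlatSpanning = let m , #II , e = count-TypeIIOff in m , count-resp TypeIIOff⇒char char⇒TypeIIOff #II , e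

  count-dual : ∀ {U V k} → Count Orb k (Char U V) → Count Orb k (Char V U)
  count-dual {U} {V} = count-map dual dual-char (λ _ _ → dual-Orb⁻)
    (λ {Q} c → dual Q , dual-char c , λ {P} _ o → subst (Orb (dual P)) (dual-involutive Q) (dual-Orb o))

  count-FlatFlat : Count Orb 1 (Char Flat Flat)
  count-FlatFlat = count-singleton unitPoint
    (char unitPoint-off (typeI⇒D≡0 unitPoint-typeI) (typeI⇒D≡0 (dual-typeI unitPoint-typeI)))
    (λ (char off D≡0 D*≡0) → P2q⇒Orb (typeI⇒P2q (offTriangle⇒nonZero off) (D≡0⇒typeI off D≡0 D*≡0)))

  private
    -- Hilbert 90 fixes the first two coordinates up to the norm ratio c. The maps preserving them
    -- up to a scalar have t in F_q and are themselves scalars, so the third coordinate w is a free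
    -- invariant in F*; this gives (q - 1)(q³ - 1) orbits.
    normalForm : Carrier × Carrier → Triple
    normalForm (c , w) = 1# , norm-section c , w

    normalForm-injective : ∀ {c d w v} → Fixed* c → Fixed* d → Orb (normalForm (c , w)) (normalForm (d , v)) → (c , w) ≡ (d , v)
    normalForm-injective {c} {d} {w} {v} c∈ d∈ o@(t , t≢0 , l , _ , e) = cong₂ _,_ c≡d (*-cancelˡ t≢0 (begin
        t * w              ≡⟨ cong (_* w) t″≡t ⟨
        fr (fr t) * w      ≡⟨ cong (proj₂ ∘ proj₂) e ⟩
        l * v              ≡⟨ cong (_* v) t≡l ⟨
        t * v              ∎))
      where
      open ≡-Reasoning
      c≡d : c ≡ d
      c≡d = sym (trans (sym (norm-norm-section d∈)) (trans (*-cancelˡ (norm-≢0 1≢0) (norm-ratio-Orb o)) (norm-norm-section c∈)))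
      t≡l : t ≡ l
      t≡l = trans (sym (*-identityʳ t)) (trans (cong proj₁ e) (*-identityʳ l))
      t′≡t : fr t ≡ t
      t′≡t = *-cancelʳ (norm-section-≢0 d∈) (trans (cong (λ c → fr t * norm-section c) (sym c≡d))
        (trans (cong (proj₁ ∘ proj₂) e) (cong (_* norm-section d) (sym t≡l))))
      t″≡t : fr (fr t) ≡ t
      t″≡t = trans (cong fr t′≡t) t′≡t

    toNormalForm : ∀ {P} → OffTriangle P → ∃ λ (cw : Carrier × Carrier) → (Fixed* (proj₁ cw) × proj₂ cw ≢ 0#) × Orb (normalForm cw) P
    toNormalForm {x , y , z} (x≢0 , y≢0 , z≢0) = from-match (match-ratio 1≢0 (norm-section-≢0 c∈) x≢0 y≢0
        (trans (cong (_* norm y) norm-1) (trans (*-identityˡ _) (sym (trans (cong (norm x *_) (norm-norm-section c∈)) (norm-ratio y x≢0))))))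
      where
      c = norm y * inv (norm x)
      c∈ : Fixed* c
      c∈ = norm-ratio-Fixed* x≢0 y≢0
      from-match : (∃ λ s → ∃ λ t → s ≢ 0# × t ≢ 0# × t * 1# ≡ s * x × fr t * norm-section c ≡ s * y) →
                   ∃ λ (cw : Carrier × Carrier) → (Fixed* (proj₁ cw) × proj₂ cw ≢ 0#) × Orb (normalForm cw) (x , y , z)
      from-match (s , t , s≢0 , t≢0 , e₁ , e₂) = (c , w) , (c∈ , *≢0 (*≢0 s≢0 z≢0) (inv-≢0 t″≢0)) , t , t≢0 , s , s≢0 , triple-≡ e₁ e₂
          (trans (solve 3 (λ t a i → t ⊗ (a ⊗ i) := a ⊗ (t ⊗ i)) refl (fr (fr t)) (s * z) (inv (fr (fr t))))
            (trans (cong (s * z *_) (*-inverseʳ t″≢0)) (*-identityʳ _)))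
        where
        t″≢0 : fr (fr t) ≢ 0#
        t″≢0 = fr-≢0 (fr-≢0 t≢0)
        w = s * z * inv (fr (fr t))

  count-OffTriangle : ∀ {n} → order ≡ suc n → Count Orb (q-1 ℕ.* n) OffTriangle
  count-OffTriangle {n} order≡ = from-≢0 count-≢0
    where
    from-≢0 : (∃ λ n → Count {Carrier} _≡_ n (_≢ 0#) × order ≡ suc n) → Count Orb (q-1 ℕ.* n) OffTriangle
    from-≢0 (n′ , #≢0 , e) = subst (λ k → Count Orb (q-1 ℕ.* k) OffTriangle) (ℕₚ.suc-injective (trans (sym e) order≡))
      (count-map normalForm (λ (c∈ , w≢0) → 1≢0 , norm-section-≢0 c∈ , w≢0)
        (λ (c∈ , _) (d∈ , _) → normalForm-injective c∈ d∈)
        (λ off → let cw , cw∈ , o = toNormalForm off in cw , cw∈ , λ { _ refl → o })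
        (count-× count-Fixed* #≢0))

  -- From (q - 1)(q³ - 1) orbits, 1 + m + m are removed with m = q³ - q - 3. The result is stated as
  -- a sum, which also shows that 3 q³ does not exceed q⁴ + q + 6, as the truncated subtraction in
  -- the final count requires.
  count-SpanningSpanning : ∃ λ k → Count Orb k (Char Spanning Spanning) × k ℕ.+ 3 ℕ.* q ℕ.^ 3 ≡ q ℕ.^ 4 ℕ.+ q ℕ.+ 6
  count-SpanningSpanning = remove-FlatFlat (count-∖ Orb-sym Orb-trans (char? flat? flat?) (char-Orb flat-Orb flat-Orb) Char.off
                                              (count-OffTriangle order≡) count-FlatFlat)
    where
    Remaining : Set
    Remaining = ∃ λ k → Count Orb k (Char Spanning Spanning) × k ℕ.+ 3 ℕ.* q ℕ.^ 3 ≡ q ℕ.^ 4 ℕ.+ q ℕ.+ 6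
    N = q-1 ℕ.* (q-1 ℕ.* suc (q ℕ.+ q ℕ.* q))
    arithmetic : ∀ {m k} → q ℕ.^ 3 ≡ 3 ℕ.+ q ℕ.+ m → N ≡ 1 ℕ.+ (m ℕ.+ (m ℕ.+ k)) → k ℕ.+ 3 ℕ.* q ℕ.^ 3 ≡ q ℕ.^ 4 ℕ.+ q ℕ.+ 6
    arithmetic {m} {k} e e′ = begin
      k ℕ.+ 3 ℕ.* q ℕ.^ 3                                  ≡⟨ split k (q ℕ.^ 3) ⟩
      k ℕ.+ (q ℕ.^ 3 ℕ.+ q ℕ.^ 3) ℕ.+ q ℕ.^ 3              ≡⟨ cong (λ a → k ℕ.+ (a ℕ.+ a) ℕ.+ q ℕ.^ 3) e ⟩
      k ℕ.+ ((3 ℕ.+ q ℕ.+ m) ℕ.+ (3 ℕ.+ q ℕ.+ m)) ℕ.+ q ℕ.^ 3  ≡⟨ regroup k m q (q ℕ.^ 3) ⟩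
      (1 ℕ.+ (m ℕ.+ (m ℕ.+ k))) ℕ.+ (q ℕ.+ q ℕ.+ 5 ℕ.+ q ℕ.^ 3)    ≡⟨ cong (ℕ._+ (q ℕ.+ q ℕ.+ 5 ℕ.+ q ℕ.^ 3)) e′ ⟨
      N ℕ.+ (q ℕ.+ q ℕ.+ 5 ℕ.+ q ℕ.^ 3)                    ≡⟨ expand ⟩
      q ℕ.^ 4 ℕ.+ q ℕ.+ 6                                  ∎
      where
      open ≡-Reasoning
      open ℕ-Solver.+-*-Solver using (_:+_; _:*_; con) renaming (solve to ℕ-solve; _:=_ to _:≡_)
      split : ∀ k c → k ℕ.+ 3 ℕ.* c ≡ k ℕ.+ (c ℕ.+ c) ℕ.+ c
      split = ℕ-solve 2 (λ k c → k :+ con 3 :* c :≡ k :+ (c :+ c) :+ c) refl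
      regroup : ∀ k m q c → k ℕ.+ ((3 ℕ.+ q ℕ.+ m) ℕ.+ (3 ℕ.+ q ℕ.+ m)) ℕ.+ c ≡ (1 ℕ.+ (m ℕ.+ (m ℕ.+ k))) ℕ.+ (q ℕ.+ q ℕ.+ 5 ℕ.+ c)
      regroup = ℕ-solve 4 (λ k m q c → k :+ ((con 3 :+ q :+ m) :+ (con 3 :+ q :+ m)) :+ c :≡
                            (con 1 :+ (m :+ (m :+ k))) :+ (q :+ q :+ con 5 :+ c)) refl
      expand : N ℕ.+ (q ℕ.+ q ℕ.+ 5 ℕ.+ q ℕ.^ 3) ≡ q ℕ.^ 4 ℕ.+ q ℕ.+ 6
      expand = subst (λ n → q-1 ℕ.* (q-1 ℕ.* suc (n ℕ.+ n ℕ.* n)) ℕ.+ (n ℕ.+ n ℕ.+ 5 ℕ.+ n ℕ.^ 3) ≡ n ℕ.^ 4 ℕ.+ n ℕ.+ 6) (sym q≡)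
        (ℕ-solve 1 (λ r → let n = con 1 :+ r in
          r :* (r :* (con 1 :+ (n :+ n :* n))) :+ (n :+ n :+ con 5 :+ n :* (n :* (n :* con 1))) :≡ n :* (n :* (n :* (n :* con 1))) :+ n :+ con 6) refl q-1)
    remove-FlatFlat : (∃ λ k → Count Orb k (λ P → OffTriangle P × ¬ Char Flat Flat P) × N ≡ 1 ℕ.+ k) → Remaining
    remove-FlatFlat (k₁ , #₁ , e₁) = remove-FlatSpanning count-FlatSpanning
      where
      remove-FlatSpanning : (∃ λ m → Count Orb m (Char Flat Spanning) × q ℕ.^ 3 ≡ 3 ℕ.+ q ℕ.+ m) → Remaining
      remove-FlatSpanning (m , #fs , e) = remove-SpanningFlat
          (count-∖ Orb-sym Orb-trans (char? flat? spanning?) (char-Orb flat-Orb spanning-Orb)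
             (λ (char off _ D*≢0) → off , λ (char _ _ D*≡0) → D*≢0 D*≡0) #₁ #fs)
        where
        remove-SpanningFlat : (∃ λ k → Count Orb k (λ P → (OffTriangle P × ¬ Char Flat Flat P) × ¬ Char Flat Spanning P) × k₁ ≡ m ℕ.+ k) → Remaining
        remove-SpanningFlat (k₂ , #₂ , e₂) = conclude
            (count-∖ Orb-sym Orb-trans (char? spanning? flat?) (char-Orb spanning-Orb flat-Orb)
               (λ (char off D≢0 _) → (off , λ (char _ D≡0 _) → D≢0 D≡0) , λ (char _ D≡0 _) → D≢0 D≡0) #₂ (count-dual #fs))
          where
          conclude : (∃ λ k → Count Orb k (λ P → ((OffTriangle P × ¬ Char Flat Flat P) × ¬ Char Flat Spanning P) × ¬ Char Spanning Flat P)
                       × k₂ ≡ m ℕ.+ k) → Remaining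
          conclude (k , #k , e₃) = k , count-resp to from #k ,
              arithmetic e (trans e₁ (cong suc (trans e₂ (cong (m ℕ.+_) e₃))))
            where
            to : ∀ {P} → ((OffTriangle P × ¬ Char Flat Flat P) × ¬ Char Flat Spanning P) × ¬ Char Spanning Flat P → Char Spanning Spanning P
            to {P} (((off , ¬ff) , ¬fs) , ¬sf) = char off D≢0 λ D*≡0 → ¬sf (char off D≢0 D*≡0)
              where
              D≢0 : D P ≢ 0#
              D≢0 D≡0 = ¬fs (char off D≡0 λ D*≡0 → ¬ff (char off D≡0 D*≡0))
            from : ∀ {P} → Char Spanning Spanning P → ((OffTriangle P × ¬ Char Flat Flat P) × ¬ Char Flat Spanning P) × ¬ Char Spanning Flat P
            from (char off D≢0 D*≢0) = ((off , λ (char _ D≡0 _) → D≢0 D≡0) , λ (char _ D≡0 _) → D≢0 D≡0) , λ (char _ _ D*≡0) → D*≢0 D*≡0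

  allPoints-Orb : ∀ {P} {U : Triple → Set} → NonZeroT P → AllPoints (Orb P) U → U P
  allPoints-Orb P≢0 all = all _ P≢0 Orb-refl

  allPoints-II : ∀ {P} → PointTypeII P → AllPoints (Orb P) PointTypeII
  allPoints-II ii Q _ o = typeII-Orb o ii

  allPoints-III : ∀ {P} → PointTypeIII P → AllPoints (Orb P) PointTypeIII
  allPoints-III iii Q _ o = typeIII-Orb o iii

  module _ {P : Triple} where

    char⇒Kind5 : Char Flat Spanning P → Kind5 (Orb P)
    char⇒Kind5 c@(char off D≡0 D*≢0) = isFqPlane-Orb off , allPoints-II (proj₂ (char⇒TypeIIOff c))
      , λ ℓ L → typeIII-Orb (lineOf⇒Orb-dual off L) D*≢0

    Kind5⇒char : OffTriangle P → Kind5 (Orb P) → Char Flat Spanning P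
    Kind5⇒char off (_ , points , lines) = char off (proj₂ (allPoints-Orb (offTriangle⇒nonZero off) points))
      (lines (dual P) (lineOf-dual off))

    char⇒Kind6 : Char Spanning Flat P → Kind6 (Orb P)
    char⇒Kind6 c@(char off D≢0 D*≡0) = isFqPlane-Orb off , allPoints-III D≢0
      , λ ℓ L → typeII-Orb (lineOf⇒Orb-dual off L) (proj₂ (char⇒TypeIIOff (dual-char {Spanning} {Flat} c)))

    Kind6⇒char : OffTriangle P → Kind6 (Orb P) → Char Spanning Flat P
    Kind6⇒char off (_ , points , lines) = char off (allPoints-Orb (offTriangle⇒nonZero off) points)
      (proj₂ (lines (dual P) (lineOf-dual off)))

    char⇒Kind7 : Char Spanning Spanning P → Kind7 (Orb P)
    char⇒Kind7 (char off D≢0 D*≢0) = isFqPlane-Orb off , allPoints-III D≢0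
      , λ ℓ L → typeIII-Orb (lineOf⇒Orb-dual off L) D*≢0

    Kind7⇒char : OffTriangle P → Kind7 (Orb P) → Char Spanning Spanning P
    Kind7⇒char off (_ , points , lines) = char off (allPoints-Orb (offTriangle⇒nonZero off) points)
      (lines (dual P) (lineOf-dual off))

  count-kind : ∀ {k U V} {K : PointSet → Set} → (∀ {P} → Char U V P → K (Orb P)) → (∀ {P} → OffTriangle P → K (Orb P) → Char U V P) →
               Count Orb k (Char U V) → Count Orb k (λ P → NonZeroT P × OffTriangle P × K (Orb P))
  count-kind to from = count-resp (λ c@(char off _ _) → offTriangle⇒nonZero off , off , to c) (λ (_ , off , kind) → from off kind)

  count56≡ : ∀ {m} → q ℕ.^ 3 ≡ 3 ℕ.+ q ℕ.+ m → m ≡ q ℕ.^ 3 ℕ.∸ q ℕ.∸ 3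
  count56≡ {m} e = begin
    m                                   ≡⟨ ℕₚ.m+n∸m≡n (q ℕ.+ 3) m ⟨
    (q ℕ.+ 3 ℕ.+ m) ℕ.∸ (q ℕ.+ 3)       ≡⟨ cong (λ a → (a ℕ.+ m) ℕ.∸ (q ℕ.+ 3)) (ℕₚ.+-comm q 3) ⟩
    (3 ℕ.+ q ℕ.+ m) ℕ.∸ (q ℕ.+ 3)       ≡⟨ cong (ℕ._∸ (q ℕ.+ 3)) e ⟨
    q ℕ.^ 3 ℕ.∸ (q ℕ.+ 3)               ≡⟨ ℕₚ.∸-+-assoc (q ℕ.^ 3) q 3 ⟨
    q ℕ.^ 3 ℕ.∸ q ℕ.∸ 3                 ∎
    where open ≡-Reasoning

  count7≡ : ∀ {k} → k ℕ.+ 3 ℕ.* q ℕ.^ 3 ≡ q ℕ.^ 4 ℕ.+ q ℕ.+ 6 → k ≡ q ℕ.^ 4 ℕ.+ q ℕ.+ 6 ℕ.∸ 3 ℕ.* q ℕ.^ 3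
  count7≡ {k} e = trans (sym (ℕₚ.m+n∸n≡m k (3 ℕ.* q ℕ.^ 3))) (cong (ℕ._∸ 3 ℕ.* q ℕ.^ 3) e)

  off-cover : ∀ {P} → OffTriangle P → Dec (Flat P) → Dec (Flat (dual P)) →
              P2q P ⊎ Kind5 (Orb P) ⊎ Kind6 (Orb P) ⊎ Kind7 (Orb P)
  off-cover off (yes D≡0) (yes D*≡0) = inj₁ (typeI⇒P2q (offTriangle⇒nonZero off) (D≡0⇒typeI off D≡0 D*≡0))
  off-cover off (yes D≡0) (no D*≢0)  = inj₂ (inj₁ (char⇒Kind5 (char off D≡0 D*≢0)))
  off-cover off (no D≢0)  (yes D*≡0) = inj₂ (inj₂ (inj₁ (char⇒Kind6 (char off D≢0 D*≡0))))
  off-cover off (no D≢0)  (no D*≢0)  = inj₂ (inj₂ (inj₂ (char⇒Kind7 (char off D≢0 D*≢0))))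

  vertex-ψ : ∀ v {t} → t ≢ 0# → ψ t (vertex v) ∼ vertex v
  vertex-ψ vT {t} t≢0 = ∼-sym (fr (fr t) , fr-≢0 (fr-≢0 t≢0) , triple-≡ (trans (zeroʳ _) (sym (zeroʳ _))) (trans (zeroʳ _) (sym (zeroʳ _))) refl)
  vertex-ψ vTφ {t} t≢0 = ∼-sym (t , t≢0 , triple-≡ refl (trans (zeroʳ _) (sym (zeroʳ _))) (trans (zeroʳ _) (sym (zeroʳ _))))
  vertex-ψ vTφ² {t} t≢0 = ∼-sym (fr t , fr-≢0 t≢0 , triple-≡ (trans (zeroʳ _) (sym (zeroʳ _))) refl (trans (zeroʳ _) (sym (zeroʳ _))))

  side-cover : ∀ v {P} → OnSide v P → Dec (Flat P) → AllPoints (Orb P) PointTypeII ⊎ AllPoints (Orb P) PointTypeIII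
  side-cover v side (yes D≡0) = inj₁ (allPoints-II (onSide⇒¬typeI v side , D≡0))
  side-cover v side (no D≢0)  = inj₂ (allPoints-III D≢0)

  slsII : ∀ v → Exactly SameOrb 1 (λ P → NonZeroT P × OnSide v P × AllPoints (Orb P) PointTypeII)
  slsII v = count-resp {S = λ P → OnSide v P × Flat P} {T = λ P → NonZeroT P × OnSide v P × AllPoints (Orb P) PointTypeII}
    (λ (side , D≡0) → onSide⇒nonZero v side , side , allPoints-II (onSide⇒¬typeI v side , D≡0))
    (λ (P≢0 , side , points) → side , proj₂ (allPoints-Orb P≢0 points))
    (count-side-II v)

  slsIII : ∀ v → Exactly SameOrb (q ℕ.∸ 2) (λ P → NonZeroT P × OnSide v P × AllPoints (Orb P) PointTypeIII)
  slsIII v = count-resp {S = λ P → OnSide v P × Spanning P} {T = λ P → NonZeroT P × OnSide v P × AllPoints (Orb P) PointTypeIII}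
    (λ (side , D≢0) → onSide⇒nonZero v side , side , allPoints-III D≢0)
    (λ (P≢0 , side , points) → side , allPoints-Orb {U = PointTypeIII} P≢0 points)
    (count-side-III v)

  kind5 : Exactly SameOrb (q ℕ.^ 3 ℕ.∸ q ℕ.∸ 3) (λ P → NonZeroT P × OffTriangle P × Kind5 (Orb P))
  kind5 = from-count count-FlatSpanning
    where
    from-count : (∃ λ m → Count Orb m (Char Flat Spanning) × q ℕ.^ 3 ≡ 3 ℕ.+ q ℕ.+ m) →
                 Exactly SameOrb (q ℕ.^ 3 ℕ.∸ q ℕ.∸ 3) (λ P → NonZeroT P × OffTriangle P × Kind5 (Orb P))
    from-count (m , #c , e) = subst (λ k → Exactly SameOrb k (λ P → NonZeroT P × OffTriangle P × Kind5 (Orb P))) (count56≡ e)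
      (count-kind {K = Kind5} char⇒Kind5 Kind5⇒char #c)

  kind6 : Exactly SameOrb (q ℕ.^ 3 ℕ.∸ q ℕ.∸ 3) (λ P → NonZeroT P × OffTriangle P × Kind6 (Orb P))
  kind6 = from-count count-FlatSpanning
    where
    from-count : (∃ λ m → Count Orb m (Char Flat Spanning) × q ℕ.^ 3 ≡ 3 ℕ.+ q ℕ.+ m) →
                 Exactly SameOrb (q ℕ.^ 3 ℕ.∸ q ℕ.∸ 3) (λ P → NonZeroT P × OffTriangle P × Kind6 (Orb P))
    from-count (m , #c , e) = subst (λ k → Exactly SameOrb k (λ P → NonZeroT P × OffTriangle P × Kind6 (Orb P))) (count56≡ e)
      (count-kind {K = Kind6} char⇒Kind6 Kind6⇒char (count-dual #c))

  kind7 : Exactly SameOrb (q ℕ.^ 4 ℕ.+ q ℕ.+ 6 ℕ.∸ 3 ℕ.* q ℕ.^ 3) (λ P → NonZeroT P × OffTriangle P × Kind7 (Orb P))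
  kind7 = from-count count-SpanningSpanning
    where
    from-count : (∃ λ k → Count Orb k (Char Spanning Spanning) × k ℕ.+ 3 ℕ.* q ℕ.^ 3 ≡ q ℕ.^ 4 ℕ.+ q ℕ.+ 6) →
                 Exactly SameOrb (q ℕ.^ 4 ℕ.+ q ℕ.+ 6 ℕ.∸ 3 ℕ.* q ℕ.^ 3) (λ P → NonZeroT P × OffTriangle P × Kind7 (Orb P))
    from-count (k , #c , e) = subst (λ k → Exactly SameOrb k (λ P → NonZeroT P × OffTriangle P × Kind7 (Orb P))) (count7≡ e)
      (count-kind {K = Kind7} char⇒Kind7 Kind7⇒char #c)

  p2qLines : AllLines P2q LineTypeI
  p2qLines ℓ (ℓ≢0 , Q , R , Q≢0 , R≢0 , s , r , rest) =
    typeI-Orb (lineOf⇒Orb-dual unitPoint-off (ℓ≢0 , Q , R , Q≢0 , R≢0 , P2q⇒Orb s , P2q⇒Orb r , rest)) (dual-typeI unitPoint-typeI)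

  orbitClassification : OrbitClassification
  orbitClassification = record
    { vertexOrbit = λ v Q _ → (λ (t , t≢0 , Q∼) → ∼-trans Q∼ (vertex-ψ v t≢0)) , ∼⇒Orb
    ; slsII       = slsII
    ; slsIII      = slsIII
    ; slsCover    = λ v P _ side → side-cover v side (flat? P)
    ; p2qOrbit    = λ Q _ → Orb⇒P2q , P2q⇒Orb
    ; p2qPlane    = isFqPlane-resp Orb⇒P2q P2q⇒Orb (isFqPlane-Orb unitPoint-off)
    ; p2qPoints   = λ P _ → P2q⇒typeI
    ; p2qLines    = p2qLines
    ; count5      = kind5
    ; count6      = kind6
    ; count7      = kind7
    ; offCover    = λ P _ off → off-cover off (flat? P) (flat? (dual P))
    }

theorem2p1 : (q : ℕ) → IsPrimePower q →
    (F : FiniteField) → FiniteField.order F ≡ q ^ 3 →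
    PG.OrbitClassification F q
theorem2p1 q q-primePower F order≡q³ = Orbits.orbitClassification F q q-primePower order≡q³
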